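{- Let $G$ be a finite simple graph. Then the independence attractor $\mathcal{A}(G)$ of $G$ is not a circle.
   Context: For a finite simple graph $G$, an independent set is a set of pairwise non-adjacent vertices. The independence polynomial is $I_G(z)=\sum_{i=0}^{\alpha} a_i z^i$, where $a_i$ is the number of independent sets of cardinality $i$ (so $a_0=1$) and $\alpha$ (the independence number) is the largest cardinality of an independent set. The lexicographic product $G[H]$ has vertex set $V(G)\times V(H)$, with $(u,v)\sim(u',v')$ iff $u\sim u'$ in $G$, or $u=u'$ and $v\sim v'$ in $H$. Let $G^1=G$ and $G^{m}=G[G^{m-1}]$ denote the $m$-fold lexicographic product of $G$ with itself. The independence attractor is $\mathcal{A}(G)=\lim_{m\to\infty}\{z\in\mathbb{C}: I_{G^m}(z)=0\}$, the limit taken in the Hausdorff metric on nonempty compact subsets of $\mathbb{C}$. (Equivalently, with $P_G=I_G-1$, $\mathcal{A}(G)=\lim_{m\to\infty}\{z: P_G^m(z)=-1\}$, where $P_G^m$ is the $m$-th iterate.) -}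

module Defs where

open import Level using (0ℓ)
open import Algebra.Bundles using (CommutativeMonoid)
open import Algebra.Bundles.Raw using (RawRing)
import Algebra.Definitions.RawSemiring as RawSemiringDefs
import Algebra.Properties.CommutativeSemigroup as CommutativeSemigroupProperties
open import Data.Bool.Base using (true; false)
open import Data.Fin.Base using (Fin; toℕ; remQuot)
import Data.Fin.Properties as Fin
open import Data.Fin.Subset using (Subset; _∈_; ∣_∣)
open import Data.Fin.Subset.Properties using (_∈?_)
open import Data.List.Base using (List; []; _∷_; [_]; _++_; map; filter; foldr; length)
open import Data.List.Relation.Unary.All using (All)
open import Data.List.Relation.Unary.Any using (Any)
open import Data.Nat.Base as ℕ using (ℕ; zero; suc)
import Data.Nat.Properties as ℕ
open import Data.Product.Base using (Σ; ∃; _×_; _,_; proj₁; proj₂)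
open import Data.Rational.Base as ℚ using (ℚ; 0ℚ; 1ℚ; ½)
import Data.Rational.Properties as ℚ
open import Data.Sum.Base using (_⊎_; inj₁; inj₂)
open import Data.Vec.Base as Vec using (_∷_)
open import Function.Base using (_∘_)
open import Function.Bundles using (_⇔_)
open import Relation.Binary.Core using (Rel)
open import Relation.Binary.Definitions using (Decidable; Irreflexive; Symmetric)
open import Relation.Binary.PropositionalEquality
  using (_≡_; refl; sym; trans; cong; cong₂; subst)
open import Relation.Nullary.Decidable
  using (Dec; ¬?; _×-dec_; _⊎-dec_; _→-dec_)
open import Relation.Nullary.Negation using (¬_)
import Relation.Unary as U
open U using (Pred)

------------------------------------------------------------------------
-- Real numbers: Cauchy sequences of rationals, with pointwise operations

IsCauchy : (ℕ → ℚ) → Set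
IsCauchy x = ∀ ε → 0ℚ ℚ.< ε →
  ∃ λ N → ∀ m n → N ℕ.≤ m → N ℕ.≤ n → ℚ.∣ x m ℚ.- x n ∣ ℚ.< ε

record ℝ : Set where
  constructor mkℝ
  field
    seq    : ℕ → ℚ
    cauchy : IsCauchy seq

open ℝ public

infix 4 _≈ᵣ_ _<ᵣ_

_≈ᵣ_ : Rel ℝ 0ℓ
x ≈ᵣ y = ∀ ε → 0ℚ ℚ.< ε →
  ∃ λ N → ∀ n → N ℕ.≤ n → ℚ.∣ seq x n ℚ.- seq y n ∣ ℚ.< ε

_<ᵣ_ : Rel ℝ 0ℓ
x <ᵣ y = ∃ λ ε → 0ℚ ℚ.< ε ×
  (∃ λ N → ∀ n → N ℕ.≤ n → seq x n ℚ.+ ε ℚ.≤ seq y n)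

module CauchyLemmas where
  open CommutativeSemigroupProperties
    (CommutativeMonoid.commutativeSemigroup ℚ.+-0-commutativeMonoid)
    using () renaming (interchange to +-interchange)

  cancel : ∀ p q → (p ℚ.- q) ℚ.+ q ≡ p
  cancel p q = trans (ℚ.+-assoc p (ℚ.- q) q)
    (trans (cong (p ℚ.+_) (ℚ.+-inverseˡ q)) (ℚ.+-identityʳ p))

  ∣p-p∣≡0 : ∀ p → ℚ.∣ p ℚ.- p ∣ ≡ 0ℚ
  ∣p-p∣≡0 p = cong ℚ.∣_∣ (ℚ.+-inverseʳ p)

  const-cauchy : ∀ p → IsCauchy (λ _ → p)
  const-cauchy p ε ε>0 =
    0 , λ _ _ _ _ → subst (ℚ._< ε) (sym (∣p-p∣≡0 p)) ε>0

  +-cauchy : ∀ x y → IsCauchy x → IsCauchy y → IsCauchy (λ n → x n ℚ.+ y n)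
  +-cauchy x y cx cy ε ε>0 = Nx ℕ.⊔ Ny , close
    where

    ε/2 : ℚ
    ε/2 = ½ ℚ.* ε

    ε/2>0 : 0ℚ ℚ.< ε/2
    ε/2>0 = subst (ℚ._< ε/2) (ℚ.*-zeroʳ ½) (ℚ.*-monoʳ-<-pos ½ ε>0)

    ε/2+ε/2≡ε : ε/2 ℚ.+ ε/2 ≡ ε
    ε/2+ε/2≡ε = trans (sym (ℚ.*-distribʳ-+ ε ½ ½)) (ℚ.*-identityˡ ε)

    Nx Ny : ℕ
    Nx = proj₁ (cx ε/2 ε/2>0)
    Ny = proj₁ (cy ε/2 ε/2>0)

    regroup : ∀ a b c d → (a ℚ.+ b) ℚ.- (c ℚ.+ d) ≡ (a ℚ.- c) ℚ.+ (b ℚ.- d)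
    regroup a b c d = trans (cong ((a ℚ.+ b) ℚ.+_) (ℚ.neg-distrib-+ c d))
      (+-interchange a b (ℚ.- c) (ℚ.- d))

    close : ∀ m n → Nx ℕ.⊔ Ny ℕ.≤ m → Nx ℕ.⊔ Ny ℕ.≤ n →
            ℚ.∣ (x m ℚ.+ y m) ℚ.- (x n ℚ.+ y n) ∣ ℚ.< ε
    close m n N≤m N≤n = begin-strict
      ℚ.∣ (x m ℚ.+ y m) ℚ.- (x n ℚ.+ y n) ∣
        ≡⟨ cong ℚ.∣_∣ (regroup (x m) (y m) (x n) (y n)) ⟩
      ℚ.∣ (x m ℚ.- x n) ℚ.+ (y m ℚ.- y n) ∣
        ≤⟨ ℚ.∣p+q∣≤∣p∣+∣q∣ (x m ℚ.- x n) (y m ℚ.- y n) ⟩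
      ℚ.∣ x m ℚ.- x n ∣ ℚ.+ ℚ.∣ y m ℚ.- y n ∣
        <⟨ ℚ.+-mono-<
             (proj₂ (cx ε/2 ε/2>0) m n (ℕ.m⊔n≤o⇒m≤o Nx Ny N≤m) (ℕ.m⊔n≤o⇒m≤o Nx Ny N≤n))
             (proj₂ (cy ε/2 ε/2>0) m n (ℕ.m⊔n≤o⇒n≤o Nx Ny N≤m) (ℕ.m⊔n≤o⇒n≤o Nx Ny N≤n)) ⟩
      ε/2 ℚ.+ ε/2
        ≡⟨ ε/2+ε/2≡ε ⟩
      ε ∎
      where open ℚ.≤-Reasoning

  neg-cauchy : ∀ x → IsCauchy x → IsCauchy (λ n → ℚ.- x n)
  neg-cauchy x cx ε ε>0 with cx ε ε>0
  ... | N , close = N , λ m n N≤m N≤n →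
    subst (ℚ._< ε) (sym (flip-sign (x m) (x n))) (close m n N≤m N≤n)
    where
    flip-sign : ∀ a b → ℚ.∣ (ℚ.- a) ℚ.- (ℚ.- b) ∣ ≡ ℚ.∣ a ℚ.- b ∣
    flip-sign a b = trans
      (cong ℚ.∣_∣ (sym (ℚ.neg-distrib-+ a (ℚ.- b))))
      (ℚ.∣-p∣≡∣p∣ (a ℚ.- b))

  1>0 : 0ℚ ℚ.< 1ℚ
  1>0 = ℚ.positive⁻¹ 1ℚ

  EventuallyBounded : (ℕ → ℚ) → Set
  EventuallyBounded x =
    ∃ λ B → 0ℚ ℚ.< B × (∃ λ N → ∀ n → N ℕ.≤ n → ℚ.∣ x n ∣ ℚ.≤ B)

  eventually-bounded : ∀ x → IsCauchy x → EventuallyBounded x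
  eventually-bounded x cx with cx 1ℚ 1>0
  ... | N , close = 1ℚ ℚ.+ ℚ.∣ x N ∣ , B>0 , N , bound
    where
    open ℚ.≤-Reasoning

    B>0 : 0ℚ ℚ.< 1ℚ ℚ.+ ℚ.∣ x N ∣
    B>0 = ℚ.+-mono-<-≤ 1>0 (ℚ.0≤∣p∣ (x N))

    bound : ∀ n → N ℕ.≤ n → ℚ.∣ x n ∣ ℚ.≤ 1ℚ ℚ.+ ℚ.∣ x N ∣
    bound n N≤n = begin
      ℚ.∣ x n ∣
        ≡⟨ cong ℚ.∣_∣ (sym (cancel (x n) (x N))) ⟩
      ℚ.∣ (x n ℚ.- x N) ℚ.+ x N ∣
        ≤⟨ ℚ.∣p+q∣≤∣p∣+∣q∣ (x n ℚ.- x N) (x N) ⟩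
      ℚ.∣ x n ℚ.- x N ∣ ℚ.+ ℚ.∣ x N ∣
        ≤⟨ ℚ.+-monoˡ-≤ ℚ.∣ x N ∣ (ℚ.<⇒≤ (close n N N≤n ℕ.≤-refl)) ⟩
      1ℚ ℚ.+ ℚ.∣ x N ∣ ∎

  *-cauchy-bounded : ∀ x y → EventuallyBounded x → EventuallyBounded y →
    IsCauchy x → IsCauchy y → IsCauchy (λ n → x n ℚ.* y n)
  *-cauchy-bounded x y (A , A>0 , Na , xbound) (B , B>0 , Nb , ybound) cx cy ε ε>0 =
    N , close
    where

    instance
      A-pos : ℚ.Positive A
      A-pos = ℚ.positive A>0

      B-pos : ℚ.Positive B
      B-pos = ℚ.positive B>0

      S-pos : ℚ.Positive (A ℚ.+ B)
      S-pos = ℚ.positive (ℚ.+-mono-< A>0 B>0)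

      S-nonZero : ℚ.NonZero (A ℚ.+ B)
      S-nonZero = ℚ.pos⇒nonZero (A ℚ.+ B)

      1/S-pos : ℚ.Positive (ℚ.1/ (A ℚ.+ B))
      1/S-pos = ℚ.1/pos⇒pos (A ℚ.+ B)

    δ : ℚ
    δ = ℚ.1/ (A ℚ.+ B) ℚ.* ε

    δ>0 : 0ℚ ℚ.< δ
    δ>0 = subst (ℚ._< δ) (ℚ.*-zeroʳ (ℚ.1/ (A ℚ.+ B)))
            (ℚ.*-monoʳ-<-pos (ℚ.1/ (A ℚ.+ B)) ε>0)

    Aδ+Bδ≡ε : A ℚ.* δ ℚ.+ B ℚ.* δ ≡ ε
    Aδ+Bδ≡ε = trans (sym (ℚ.*-distribʳ-+ δ A B))
      (trans (sym (ℚ.*-assoc (A ℚ.+ B) (ℚ.1/ (A ℚ.+ B)) ε))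
      (trans (cong (ℚ._* ε) (ℚ.*-inverseʳ (A ℚ.+ B))) (ℚ.*-identityˡ ε)))

    Nx Ny N : ℕ
    Nx = proj₁ (cx δ δ>0)
    Ny = proj₁ (cy δ δ>0)
    N  = (Na ℕ.⊔ Nb) ℕ.⊔ (Nx ℕ.⊔ Ny)

    distrib-minus : ∀ a b c → a ℚ.* (b ℚ.- c) ≡ a ℚ.* b ℚ.- a ℚ.* c
    distrib-minus a b c = trans (ℚ.*-distribˡ-+ a b (ℚ.- c))
      (cong (a ℚ.* b ℚ.+_) (sym (ℚ.neg-distribʳ-* a c)))

    split : ∀ a b c d → a ℚ.* b ℚ.- c ℚ.* d ≡ a ℚ.* (b ℚ.- d) ℚ.+ d ℚ.* (a ℚ.- c)
    split a b c d = sym (trans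
      (cong₂ ℚ._+_
        (distrib-minus a b d)
        (trans (distrib-minus d a c) (cong₂ ℚ._-_ (ℚ.*-comm d a) (ℚ.*-comm d c))))
      (trans (sym (ℚ.+-assoc (a ℚ.* b ℚ.- a ℚ.* d) (a ℚ.* d) (ℚ.- (c ℚ.* d))))
        (cong (ℚ._- c ℚ.* d) (cancel (a ℚ.* b) (a ℚ.* d)))))

    scaled : ∀ {C} .{{_ : ℚ.Positive C}} p q → ℚ.∣ p ∣ ℚ.≤ C → ℚ.∣ q ∣ ℚ.< δ →
             ℚ.∣ p ℚ.* q ∣ ℚ.< C ℚ.* δ
    scaled {C} p q p≤C q<δ = begin-strict
      ℚ.∣ p ℚ.* q ∣         ≡⟨ ℚ.∣p*q∣≡∣p∣*∣q∣ p q ⟩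
      ℚ.∣ p ∣ ℚ.* ℚ.∣ q ∣   ≤⟨ ℚ.*-monoʳ-≤-nonNeg ℚ.∣ q ∣ {{ℚ.nonNegative (ℚ.0≤∣p∣ q)}} p≤C ⟩
      C ℚ.* ℚ.∣ q ∣         <⟨ ℚ.*-monoʳ-<-pos C q<δ ⟩
      C ℚ.* δ               ∎
      where open ℚ.≤-Reasoning

    close : ∀ m n → N ℕ.≤ m → N ℕ.≤ n → ℚ.∣ x m ℚ.* y m ℚ.- x n ℚ.* y n ∣ ℚ.< ε
    close m n N≤m N≤n = begin-strict
      ℚ.∣ x m ℚ.* y m ℚ.- x n ℚ.* y n ∣
        ≡⟨ cong ℚ.∣_∣ (split (x m) (y m) (x n) (y n)) ⟩
      ℚ.∣ x m ℚ.* (y m ℚ.- y n) ℚ.+ y n ℚ.* (x m ℚ.- x n) ∣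
        ≤⟨ ℚ.∣p+q∣≤∣p∣+∣q∣ (x m ℚ.* (y m ℚ.- y n)) (y n ℚ.* (x m ℚ.- x n)) ⟩
      ℚ.∣ x m ℚ.* (y m ℚ.- y n) ∣ ℚ.+ ℚ.∣ y n ℚ.* (x m ℚ.- x n) ∣
        <⟨ ℚ.+-mono-<
             (scaled (x m) (y m ℚ.- y n) (xbound m (Na≤ N≤m)) (proj₂ (cy δ δ>0) m n (Ny≤ N≤m) (Ny≤ N≤n)))
             (scaled (y n) (x m ℚ.- x n) (ybound n (Nb≤ N≤n)) (proj₂ (cx δ δ>0) m n (Nx≤ N≤m) (Nx≤ N≤n))) ⟩
      A ℚ.* δ ℚ.+ B ℚ.* δ
        ≡⟨ Aδ+Bδ≡ε ⟩
      ε ∎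
      where
      open ℚ.≤-Reasoning
      L≤ : ∀ {k} → N ℕ.≤ k → Na ℕ.⊔ Nb ℕ.≤ k
      L≤ = ℕ.m⊔n≤o⇒m≤o (Na ℕ.⊔ Nb) (Nx ℕ.⊔ Ny)
      R≤ : ∀ {k} → N ℕ.≤ k → Nx ℕ.⊔ Ny ℕ.≤ k
      R≤ = ℕ.m⊔n≤o⇒n≤o (Na ℕ.⊔ Nb) (Nx ℕ.⊔ Ny)
      Na≤ : ∀ {k} → N ℕ.≤ k → Na ℕ.≤ k
      Na≤ N≤k = ℕ.m⊔n≤o⇒m≤o Na Nb (L≤ N≤k)
      Nb≤ : ∀ {k} → N ℕ.≤ k → Nb ℕ.≤ k
      Nb≤ N≤k = ℕ.m⊔n≤o⇒n≤o Na Nb (L≤ N≤k)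
      Nx≤ : ∀ {k} → N ℕ.≤ k → Nx ℕ.≤ k
      Nx≤ N≤k = ℕ.m⊔n≤o⇒m≤o Nx Ny (R≤ N≤k)
      Ny≤ : ∀ {k} → N ℕ.≤ k → Ny ℕ.≤ k
      Ny≤ N≤k = ℕ.m⊔n≤o⇒n≤o Nx Ny (R≤ N≤k)

  *-cauchy : ∀ x y → IsCauchy x → IsCauchy y → IsCauchy (λ n → x n ℚ.* y n)
  *-cauchy x y cx cy =
    *-cauchy-bounded x y (eventually-bounded x cx) (eventually-bounded y cy) cx cy

open CauchyLemmas

infixl 6 _+ᵣ_ _-ᵣ_
infixl 7 _*ᵣ_
infix  8 -ᵣ_

fromℚ : ℚ → ℝ
fromℚ p = mkℝ (λ _ → p) (const-cauchy p)

0ᵣ 1ᵣ : ℝ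
0ᵣ = fromℚ 0ℚ
1ᵣ = fromℚ 1ℚ

_+ᵣ_ : ℝ → ℝ → ℝ
x +ᵣ y = mkℝ (λ n → seq x n ℚ.+ seq y n) (+-cauchy (seq x) (seq y) (cauchy x) (cauchy y))

_*ᵣ_ : ℝ → ℝ → ℝ
x *ᵣ y = mkℝ (λ n → seq x n ℚ.* seq y n) (*-cauchy (seq x) (seq y) (cauchy x) (cauchy y))

-ᵣ_ : ℝ → ℝ
-ᵣ x = mkℝ (λ n → ℚ.- seq x n) (neg-cauchy (seq x) (cauchy x))

_-ᵣ_ : ℝ → ℝ → ℝ
x -ᵣ y = x +ᵣ (-ᵣ y)

------------------------------------------------------------------------
-- Complex numbers

record ℂ : Set where
  constructor _+i_
  field
    re im : ℝ

open ℂ public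

infix  4 _≈_
infixl 6 _+_ _-_
infixl 7 _*_
infix  8 -_

_≈_ : Rel ℂ 0ℓ
z ≈ w = (re z ≈ᵣ re w) × (im z ≈ᵣ im w)

0# 1# : ℂ
0# = 0ᵣ +i 0ᵣ
1# = 1ᵣ +i 0ᵣ

_+_ _*_ _-_ : ℂ → ℂ → ℂ
z + w = (re z +ᵣ re w) +i (im z +ᵣ im w)
z * w = (re z *ᵣ re w -ᵣ im z *ᵣ im w) +i (re z *ᵣ im w +ᵣ im z *ᵣ re w)
z - w = (re z -ᵣ re w) +i (im z -ᵣ im w)

-_ : ℂ → ℂ
- z = (-ᵣ re z) +i (-ᵣ im z)

ℂ-rawRing : RawRing 0ℓ 0ℓ
ℂ-rawRing = record
  { Carrier = ℂ ; _≈_ = _≈_ ; _+_ = _+_ ; _*_ = _*_ ; -_ = -_ ; 0# = 0# ; 1# = 1# }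

module ℂ-Semiring = RawSemiringDefs (RawRing.rawSemiring ℂ-rawRing)

-- The squared modulus; distances are compared through their squares, which
-- avoids square roots.
normSq : ℂ → ℝ
normSq z = re z *ᵣ re z +ᵣ im z *ᵣ im z

-- |z - w| < ε, meaningful for ε > 0 only.
Within : ℝ → ℂ → ℂ → Set
Within ε z w = normSq (z - w) <ᵣ ε *ᵣ ε

Positive : ℝ → Set
Positive ε = 0ᵣ <ᵣ ε

------------------------------------------------------------------------
-- Subsets of the complex plane

IsClosed : Pred ℂ 0ℓ → Set
IsClosed K = ∀ z → (∀ ε → Positive ε → ∃ λ w → K w × Within ε z w) → K z

IsTotallyBounded : Pred ℂ 0ℓ → Set
IsTotallyBounded K = ∀ ε → Positive ε →
  ∃ λ (ws : List ℂ) → All K ws × (∀ z → K z → Any (Within ε z) ws)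

-- Compactness in the sense of Bishop: ℂ is complete, so closed subsets are the
-- complete ones.
IsCompact : Pred ℂ 0ℓ → Set
IsCompact K = IsClosed K × IsTotallyBounded K

-- The open ε-neighbourhood of a set.
Nbhd : ℝ → Pred ℂ 0ℓ → Pred ℂ 0ℓ
Nbhd ε S z = ∃ λ w → S w × Within ε z w

-- The Hausdorff distance of S and T is the infimum of the ε > 0 with
-- S ⊆ Nbhd ε T and T ⊆ Nbhd ε S.
HausdorffConverges : (ℕ → Pred ℂ 0ℓ) → Pred ℂ 0ℓ → Set
HausdorffConverges S K = ∀ ε → Positive ε →
  ∃ λ N → ∀ m → N ℕ.≤ m → (S m U.⊆ Nbhd ε K) × (K U.⊆ Nbhd ε (S m))

IsCircle : Pred ℂ 0ℓ → Set
IsCircle K = ∃ λ (c : ℂ) → ∃ λ (r : ℝ) →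
  Positive r × (∀ z → K z ⇔ (normSq (z - c) ≈ᵣ r *ᵣ r))

------------------------------------------------------------------------
-- Finite simple graphs

record Graph : Set₁ where
  field
    order  : ℕ
    Adj    : Rel (Fin order) 0ℓ
    adj?   : Decidable Adj
    symm   : Symmetric Adj
    irrefl : Irreflexive _≡_ Adj

  Vertex : Set
  Vertex = Fin order

open Graph public

-- V(G) × V(H) is enumerated by Fin (order G * order H) through remQuot.
infixr 8 _⟦_⟧

_⟦_⟧ : Graph → Graph → Graph
G ⟦ H ⟧ = record
  { order  = order G ℕ.* order H
  ; Adj    = λ x y → LexAdj (remQuot (order H) x) (remQuot (order H) y)
  ; adj?   = λ x y → lexAdj? (remQuot (order H) x) (remQuot (order H) y)
  ; symm   = λ { (inj₁ a)       → inj₁ (symm G a)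
               ; (inj₂ (e , a)) → inj₂ (sym e , symm H a) }
  ; irrefl = λ { refl (inj₁ a)       → irrefl G refl a
               ; refl (inj₂ (_ , a)) → irrefl H refl a }
  }
  where
  LexAdj : Rel (Vertex G × Vertex H) 0ℓ
  LexAdj (u , v) (u′ , v′) = Adj G u u′ ⊎ (u ≡ u′ × Adj H v v′)

  lexAdj? : Decidable LexAdj
  lexAdj? (u , v) (u′ , v′) = adj? G u u′ ⊎-dec ((u Fin.≟ u′) ×-dec adj? H v v′)

-- lexPower G k is the (k+1)-fold product G^{k+1}.
lexPower : Graph → ℕ → Graph
lexPower G zero    = G
lexPower G (suc k) = G ⟦ lexPower G k ⟧

------------------------------------------------------------------------
-- Independence polynomial

module _ (G : Graph) where

  Independent : Pred (Subset (order G)) 0ℓ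
  Independent p = ∀ u v → u ∈ p → v ∈ p → ¬ Adj G u v

  independent? : U.Decidable Independent
  independent? p = Fin.all? λ u → Fin.all? λ v →
    (u ∈? p) →-dec ((v ∈? p) →-dec ¬? (adj? G u v))

allSubsets : ∀ n → List (Subset n)
allSubsets zero    = [ Vec.[] ]
allSubsets (suc n) = map (true ∷_) (allSubsets n) ++ map (false ∷_) (allSubsets n)

module _ (G : Graph) where

  independentSets : List (Subset (order G))
  independentSets = filter (independent? G) (allSubsets (order G))

  independentCount : ℕ → ℕ
  independentCount i = length (filter (λ p → ∣ p ∣ ℕ.≟ i) independentSets)

  independenceNumber : ℕ
  independenceNumber = foldr ℕ._⊔_ 0 (map ∣_∣ independentSets)

  independencePolynomial : ℂ → ℂ
  independencePolynomial z = sum {suc independenceNumber} λ i →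
    independentCount (toℕ i) ×′ (z ^ toℕ i)
    where open ℂ-Semiring using (sum; _^_) renaming (_×_ to _×′_)

  IndependenceRoot : Pred ℂ 0ℓ
  IndependenceRoot z = independencePolynomial z ≈ 0#

------------------------------------------------------------------------
-- Independence attractor

-- K is the limit of the root sets of I_{G^m} among nonempty compact sets.
IsIndependenceAttractor : Graph → Pred ℂ 0ℓ → Set
IsIndependenceAttractor G K =
  (∃ λ z → K z) × IsCompact K ×
  HausdorffConverges (λ k → IndependenceRoot (lexPower G k)) K

{-# OPTIONS --safe #-}

-- Write P = I_G - 1, d for the independence number and n for the order of G.
-- Independent sets of G[H] are independent sets of G with a nonempty independent
-- set of H chosen over each element, so I_{G[H]} = I_G ∘ (I_H - 1), and P maps the
-- roots of I_{G^{k+1}} to those of I_{G^k}.  If the attractor is a circle |z - c| = r,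
-- then P maps it to itself by continuity.  A polynomial of constant modulus on a
-- circle around c is a monomial in z - c, so P(z) = c + a (z - c)ᵈ.  As P(0) = 0 and
-- P′(0) = n, the number e = -c satisfies a eᵈ = e and a d eᵈ⁻¹ = n, hence n e = d e.
-- If 2 ≤ d < n this forces e = 0 and then n = 0, a contradiction.  If d ≤ 1 then P is
-- linear, and if d = n then G has no edges and P(z) = (1 + z)ⁿ - 1; in both cases
-- each I_{G^k} has at most one root, and single points do not approximate a circle.
module Submission where

open import Level using (0ℓ)
open import Algebra.Bundles using (CommutativeRing)
open import Algebra.Bundles.Raw using (RawRing; RawSemiring)
import Algebra.Consequences.Setoid as Consequences
open import Algebra.Core using (Op₂)
import Algebra.Definitions.RawSemiring as RawSemiringDefs
import Algebra.Properties.AbelianGroup as AbelianGroupProperties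
import Algebra.Properties.Ring as RingProperties
import Algebra.Properties.Semiring.Exp as SemiringExp
import Algebra.Properties.Semiring.Mult as SemiringMult
import Algebra.Properties.Semiring.Mult.TCOptimised as OptimisedMult
import Algebra.Properties.Semiring.Sum as SemiringSum
import Algebra.Solver.Ring as RingSolver
open import Algebra.Solver.Ring.AlmostCommutativeRing
  using (fromCommutativeRing; _-Raw-AlmostCommutative⟶_)
open import Algebra.Structures using (IsCommutativeRing)
open import Data.Bool.Base using (Bool; true; false; if_then_else_; _∨_)
open import Data.Fin.Base using (Fin; zero; suc; toℕ; combine; remQuot)
import Data.Fin.Properties as Fin
open import Data.Fin.Subset using (Subset; _∈_; ∣_∣; ⊥; ⁅_⁆)
open import Data.Fin.Subset.Properties using (∉⊥; x∈⁅y⁆⇒x≡y; ∣p∣≤n; ∣p∣≡n⇒p≡⊤; ∈⊤)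
open import Data.Integer.Base as ℤ using (ℤ; +_; -[1+_])
import Data.Integer.Properties as ℤ
open import Data.List.Base using (List; []; _∷_; _++_; map; filter; foldr; length)
open import Data.List.Membership.Propositional using () renaming (_∈_ to _∈ₗ_)
open import Data.List.Membership.Propositional.Properties
  using (foldr-selective; ∈-map⁻; ∈-filter⁺; ∈-filter⁻; ∈-length)
open import Data.List.Relation.Unary.All as All using (All; []; _∷_)
open import Data.Maybe.Base using (Maybe; just; nothing)
open import Data.Nat.Base as ℕ using (ℕ; zero; suc)
import Data.Nat.Properties as ℕ
open import Data.Product.Base using (∃; ∃₂; _×_; _,_; proj₁; proj₂)
open import Data.Rational.Base as ℚ using (ℚ; 0ℚ; 1ℚ; ½)
import Data.Rational.Properties as ℚ
import Data.Sign.Base as Sign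
open import Data.Sum.Base using (_⊎_; inj₁; inj₂)
open import Data.Vec.Base as Vec using (Vec; []; _∷_; lookup; concat; here; there)
import Data.Vec.Properties as Vec
open import Function.Base using (_∘_)
open import Function.Bundles using (Equivalence)
open import Relation.Binary.Bundles using (Setoid)
open import Relation.Binary.Core using (Rel)
open import Relation.Binary.PropositionalEquality as ≡ using (_≡_)
import Relation.Binary.Reasoning.Setoid as SetoidReasoning
open import Relation.Binary.Structures using (IsEquivalence)
open import Relation.Nullary.Decidable using (Dec; yes; no; does; dec-true; dec-false)
open import Relation.Nullary.Negation using (¬_; contradiction)
open import Relation.Unary using (Pred; Decidable)
import Defs
open import Defs hiding (_≈_; _+_; _*_; _-_; -_; 0#; 1#)

-- Reals are Cauchy sequences without decidable equality, so nonzero is replaced throughout by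
-- `Cancelable`, and divisions are multiplied out. A circle enters the algebra only through a
-- sequence of its points with cancelable differences, supplied by the parametrisation (1 + it) / (1
-- - it) of the unit circle; that many zeros force a polynomial function to vanish.
--
-- Constant modulus forces a monomial because conj (z - c) = ρ / (z - c) on the circle. Hence (z -
-- c)^d conj (f z) agrees there with a polynomial f#, and f f# = σ (z - c)^d holds on the circle, so
-- everywhere. At z = c and d ≥ 1 the right side is 0 while f#(c) is ρ^d times the conjugate leading
-- coefficient, so f(c) = 0; a factor z - c splits off and the argument repeats.
--
-- Only squared moduli are available, so the triangle inequality becomes |z + w|² ≤ 2|z|² + 2|w|²,
-- the source of the doubled sums in the estimates. The algebra is carried out over an abstract
-- commutative ring and instantiated at ℂ, where the contradiction is 1 = 0.

-- Ring solver with integer coefficients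

module IntegerSolver (R : CommutativeRing 0ℓ 0ℓ) where
  open CommutativeRing R
  open RingProperties ring using (-‿distribˡ-*; -‿distribʳ-*; -0#≈0#; -‿involutive)
  open AbelianGroupProperties +-abelianGroup using (⁻¹-∙-comm)
  open OptimisedMult semiring using (1+×; ×-homo-+; ×1-homo-*) renaming (_×_ to _×′_)
  open SetoidReasoning setoid

  ⟦_⟧ : ℤ → Carrier
  ⟦ + n ⟧      = n ×′ 1#
  ⟦ -[1+ n ] ⟧ = - (suc n ×′ 1#)

  -- A product of integers of opposite signs computes to this form, and `◃` sends zero to `+ 0`,
  -- hence the separate case.
  ⟦-◃_⟧ : ∀ n → ⟦ Sign.- ℤ.◃ n ⟧ ≈ - (n ×′ 1#)
  ⟦-◃ zero ⟧  = sym -0#≈0#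
  ⟦-◃ suc n ⟧ = refl

  ⟦⊖⟧ : ∀ m n → ⟦ m ℤ.⊖ n ⟧ ≈ m ×′ 1# - n ×′ 1#
  ⟦⊖⟧ m zero = sym (trans (+-congˡ -0#≈0#) (+-identityʳ _))
  ⟦⊖⟧ zero (suc n) = sym (+-identityˡ _)
  ⟦⊖⟧ (suc m) (suc n) = begin
    ⟦ suc m ℤ.⊖ suc n ⟧              ≡⟨ ≡.cong ⟦_⟧ (ℤ.[1+m]⊖[1+n]≡m⊖n m n) ⟩
    ⟦ m ℤ.⊖ n ⟧                      ≈⟨ ⟦⊖⟧ m n ⟩
    a - b                            ≈⟨ +-congʳ (+-identityˡ a) ⟨
    (0# + a) - b                     ≈⟨ +-congʳ (+-congʳ (-‿inverseʳ 1#)) ⟨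
    ((1# - 1#) + a) - b              ≈⟨ +-congʳ (+-assoc _ _ _) ⟩
    (1# + (- 1# + a)) - b            ≈⟨ +-congʳ (+-congˡ (+-comm _ _)) ⟩
    (1# + (a - 1#)) - b              ≈⟨ +-congʳ (+-assoc _ _ _) ⟨
    ((1# + a) - 1#) - b              ≈⟨ +-assoc _ _ _ ⟩
    (1# + a) + (- 1# - b)            ≈⟨ +-congˡ (⁻¹-∙-comm 1# b) ⟩
    (1# + a) - (1# + b)              ≈⟨ +-cong (1+× m 1#) (-‿cong (1+× n 1#)) ⟨
    suc m ×′ 1# - suc n ×′ 1#        ∎
    where
    a = m ×′ 1#
    b = n ×′ 1#

  ⟦⟧-homo-+ : ∀ i j → ⟦ i ℤ.+ j ⟧ ≈ ⟦ i ⟧ + ⟦ j ⟧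
  ⟦⟧-homo-+ (+ m)    (+ n)    = ×-homo-+ 1# m n
  ⟦⟧-homo-+ (+ m)    -[1+ n ] = ⟦⊖⟧ m (suc n)
  ⟦⟧-homo-+ -[1+ m ] (+ n)    = trans (⟦⊖⟧ n (suc m)) (+-comm _ _)
  ⟦⟧-homo-+ -[1+ m ] -[1+ n ] = begin
    - (suc (suc (m ℕ.+ n)) ×′ 1#)     ≡⟨ ≡.cong (λ k → - (suc k ×′ 1#)) (≡.sym (ℕ.+-suc m n)) ⟩
    - ((suc m ℕ.+ suc n) ×′ 1#)       ≈⟨ -‿cong (×-homo-+ 1# (suc m) (suc n)) ⟩
    - (suc m ×′ 1# + suc n ×′ 1#)     ≈⟨ ⁻¹-∙-comm _ _ ⟨
    - (suc m ×′ 1#) - suc n ×′ 1#     ∎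

  ⟦⟧-homo-* : ∀ i j → ⟦ i ℤ.* j ⟧ ≈ ⟦ i ⟧ * ⟦ j ⟧
  ⟦⟧-homo-* (+ m) (+ n) = trans (reflexive (≡.cong ⟦_⟧ (ℤ.+◃n≡+n (m ℕ.* n)))) (×1-homo-* m n)
  ⟦⟧-homo-* (+ m) -[1+ n ] =
    trans ⟦-◃ m ℕ.* suc n ⟧ (trans (-‿cong (×1-homo-* m (suc n))) (-‿distribʳ-* _ _))
  ⟦⟧-homo-* -[1+ m ] (+ n) =
    trans ⟦-◃ suc m ℕ.* n ⟧ (trans (-‿cong (×1-homo-* (suc m) n)) (-‿distribˡ-* _ _))
  ⟦⟧-homo-* -[1+ m ] -[1+ n ] = begin
    (suc m ℕ.* suc n) ×′ 1#                 ≈⟨ ×1-homo-* (suc m) (suc n) ⟩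
    suc m ×′ 1# * suc n ×′ 1#               ≈⟨ -‿involutive _ ⟨
    - - (suc m ×′ 1# * suc n ×′ 1#)         ≈⟨ -‿cong (-‿distribʳ-* _ _) ⟩
    - (suc m ×′ 1# * - (suc n ×′ 1#))       ≈⟨ -‿distribˡ-* _ _ ⟩
    - (suc m ×′ 1#) * - (suc n ×′ 1#)       ∎

  ⟦⟧-homo-neg : ∀ i → ⟦ ℤ.- i ⟧ ≈ - ⟦ i ⟧
  ⟦⟧-homo-neg (+ zero)  = sym -0#≈0#
  ⟦⟧-homo-neg (+ suc n) = refl
  ⟦⟧-homo-neg -[1+ n ]  = sym (-‿involutive _)

  ℤ-rawRing : RawRing 0ℓ 0ℓ
  ℤ-rawRing = record
    { Carrier = ℤ ; _≈_ = ≡._≡_ ; _+_ = ℤ._+_ ; _*_ = ℤ._*_ ; -_ = ℤ.-_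
    ; 0# = ℤ.0ℤ ; 1# = ℤ.1ℤ }

  morphism : ℤ-rawRing -Raw-AlmostCommutative⟶ fromCommutativeRing R
  morphism = record
    { ⟦_⟧    = ⟦_⟧
    ; +-homo = ⟦⟧-homo-+
    ; *-homo = ⟦⟧-homo-*
    ; -‿homo = ⟦⟧-homo-neg
    ; 0-homo = refl
    ; 1-homo = refl
    }

  -- The solver has to recognise equal coefficients. Equality in the ring itself is undecidable for
  -- ℂ, so the test is made on integers.
  equal? : ∀ i j → Maybe (⟦ i ⟧ ≈ ⟦ j ⟧)
  equal? i j with i ℤ.≟ j
  ... | yes i≡j = just (reflexive (≡.cong ⟦_⟧ i≡j))
  ... | no _    = nothing

  open RingSolver ℤ-rawRing (fromCommutativeRing R) morphism equal? public
    using (solve; _:=_; _:+_; _:*_; _:-_; :-_; con)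

-- Ring identities for complex arithmetic, the circle and the estimates

-- Rings are kept abstract here: with the concrete operations of ℚ, which unfold
-- on neutral arguments, the solver's conversion checks become infeasible.
module Identities (S : CommutativeRing 0ℓ 0ℓ) where
  open CommutativeRing S
  open IntegerSolver S using (solve; _:=_; _:+_; _:*_; _:-_; :-_; con)
  open SetoidReasoning setoid

  x[yz]≈y[xz] : ∀ x y z → x * (y * z) ≈ y * (x * z)
  x[yz]≈y[xz] = solve 3 (λ x y z → x :* (y :* z) := y :* (x :* z)) refl

  neg-sub : ∀ x y → y - x ≈ - (x - y)
  neg-sub = solve 2 (λ x y → y :- x := :- (x :- y)) refl

  sub-via : ∀ x y z → x - z ≈ (x - y) + (y - z)
  sub-via = solve 3 (λ x y z → x :- z := (x :- y) :+ (y :- z)) refl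

  sub-+ : ∀ x x′ y y′ → (x + y) - (x′ + y′) ≈ (x - x′) + (y - y′)
  sub-+ = solve 4 (λ x x′ y y′ → (x :+ y) :- (x′ :+ y′) := (x :- x′) :+ (y :- y′)) refl

  sub-neg : ∀ x x′ → - x - - x′ ≈ - (x - x′)
  sub-neg = solve 2 (λ x x′ → (:- x) :- (:- x′) := :- (x :- x′)) refl

  sub-* : ∀ x x′ y y′ → x * y - x′ * y′ ≈ x * (y - y′) + y′ * (x - x′)
  sub-* = solve 4 (λ x x′ y y′ → (x :* y) :- (x′ :* y′) := x :* (y :- y′) :+ y′ :* (x :- x′)) refl

  re-*-assoc : ∀ a b c d e f →
    (a * c - b * d) * e - (a * d + b * c) * f ≈ a * (c * e - d * f) - b * (c * f + d * e)
  re-*-assoc = solve 6 (λ a b c d e f →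
    (a :* c :- b :* d) :* e :- (a :* d :+ b :* c) :* f
      := a :* (c :* e :- d :* f) :- b :* (c :* f :+ d :* e)) refl

  im-*-assoc : ∀ a b c d e f →
    (a * c - b * d) * f + (a * d + b * c) * e ≈ a * (c * f + d * e) + b * (c * e - d * f)
  im-*-assoc = solve 6 (λ a b c d e f →
    (a :* c :- b :* d) :* f :+ (a :* d :+ b :* c) :* e
      := a :* (c :* f :+ d :* e) :+ b :* (c :* e :- d :* f)) refl

  re-*-comm : ∀ a b c d → a * c - b * d ≈ c * a - d * b
  re-*-comm = solve 4 (λ a b c d → a :* c :- b :* d := c :* a :- d :* b) refl

  im-*-comm : ∀ a b c d → a * d + b * c ≈ c * b + d * a
  im-*-comm = solve 4 (λ a b c d → a :* d :+ b :* c := c :* b :+ d :* a) refl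

  re-*-identityˡ : ∀ a b → 1# * a - 0# * b ≈ a
  re-*-identityˡ = solve 2 (λ a b → con ℤ.1ℤ :* a :- con ℤ.0ℤ :* b := a) refl

  im-*-identityˡ : ∀ a b → 1# * b + 0# * a ≈ b
  im-*-identityˡ = solve 2 (λ a b → con ℤ.1ℤ :* b :+ con ℤ.0ℤ :* a := b) refl

  re-*-distribˡ : ∀ a b c d e f → a * (c + e) - b * (d + f) ≈ (a * c - b * d) + (a * e - b * f)
  re-*-distribˡ = solve 6 (λ a b c d e f →
    a :* (c :+ e) :- b :* (d :+ f) := (a :* c :- b :* d) :+ (a :* e :- b :* f)) refl

  im-*-distribˡ : ∀ a b c d e f → a * (d + f) + b * (c + e) ≈ (a * d + b * c) + (a * f + b * e)
  im-*-distribˡ = solve 6 (λ a b c d e f →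
    a :* (d :+ f) :+ b :* (c :+ e) := (a :* d :+ b :* c) :+ (a :* f :+ b :* e)) refl

  neg-*-neg : ∀ p → - p * - p ≈ p * p
  neg-*-neg = solve 1 (λ p → (:- p) :* (:- p) := p :* p) refl

  -- Brahmagupta's two-square identity, which is the multiplicativity of the squared modulus in
  -- coordinates.
  norm-*-norm : ∀ a b c d → (a * c - b * d) * (a * c - b * d) + (a * d + b * c) * (a * d + b * c)
                        ≈ (a * a + b * b) * (c * c + d * d)
  norm-*-norm = solve 4 (λ a b c d →
    (a :* c :- b :* d) :* (a :* c :- b :* d) :+ (a :* d :+ b :* c) :* (a :* d :+ b :* c)
      := (a :* a :+ b :* b) :* (c :* c :+ d :* d)) refl

  -- Dropping the square of the difference on the left yields the substitute for the triangle
  -- inequality.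
  parallelogram : ∀ a b c d →
    ((a + c) * (a + c) + (b + d) * (b + d)) + ((a - c) * (a - c) + (b - d) * (b - d))
      ≈ ((a * a + b * b) + (c * c + d * d)) + ((a * a + b * b) + (c * c + d * d))
  parallelogram = solve 4 (λ a b c d →
    ((a :+ c) :* (a :+ c) :+ (b :+ d) :* (b :+ d)) :+ ((a :- c) :* (a :- c) :+ (b :- d) :* (b :- d))
      := ((a :* a :+ b :* b) :+ (c :* c :+ d :* d)) :+ ((a :* a :+ b :* b) :+ (c :* c :+ d :* d))) refl

  x+[y-x] : ∀ x y → x + (y - x) ≈ y
  x+[y-x] = solve 2 (λ x y → x :+ (y :- x) := y) refl

  x-0 : ∀ x → x - 0# ≈ x
  x-0 = solve 1 (λ x → x :- con ℤ.0ℤ := x) refl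

  swap-middle : ∀ p q e → (p + q) + e ≈ (p + e) + q
  swap-middle = solve 3 (λ p q e → (p :+ q) :+ e := (p :+ e) :+ q) refl

  norm-neg : ∀ a b → - a * - a + - b * - b ≈ a * a + b * b
  norm-neg = solve 2 (λ a b → (:- a) :* (:- a) :+ (:- b) :* (:- b) := a :* a :+ b :* b) refl

  re-*-conj : ∀ a b → a * a - b * - b ≈ a * a + b * b
  re-*-conj = solve 2 (λ a b → a :* a :- b :* (:- b) := a :* a :+ b :* b) refl

  im-*-conj : ∀ a b → a * - b + b * a ≈ 0#
  im-*-conj = solve 2 (λ a b → a :* (:- b) :+ b :* a := con ℤ.0ℤ) refl

  re-conj-* : ∀ a b c d → a * c - b * d ≈ a * c - - b * - d
  re-conj-* = solve 4 (λ a b c d → a :* c :- b :* d := a :* c :- (:- b) :* (:- d)) refl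

  im-conj-* : ∀ a b c d → - (a * d + b * c) ≈ a * - d + - b * c
  im-conj-* = solve 4 (λ a b c d → :- (a :* d :+ b :* c) := a :* (:- d) :+ (:- b) :* c) refl

  im-conj-+ : ∀ b d → - (b + d) ≈ - b + - d
  im-conj-+ = solve 2 (λ b d → :- (b :+ d) := (:- b) :+ (:- d)) refl

  module _ (u t : Carrier) (ut≈1 : (1# + t * t) * u ≈ 1#) where

    -- Tangent half-angle formulas: with `u` the inverse of 1 + t², the numbers u(1 - t²) and 2ut
    -- are the real and imaginary parts of (1 + it) / (1 - it), here multiplied by 1 - it.
    half-angle-re : (u * (1# - t * t)) * 1# - (u * (t + t)) * - t ≈ 1#
    half-angle-re = trans (solve 2 (λ u t →
      (u :* (con ℤ.1ℤ :- t :* t)) :* con ℤ.1ℤ :- (u :* (t :+ t)) :* (:- t)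
        := (con ℤ.1ℤ :+ t :* t) :* u) refl u t) ut≈1

    half-angle-im : (u * (1# - t * t)) * - t + (u * (t + t)) * 1# ≈ t
    half-angle-im = trans (solve 2 (λ u t →
      (u :* (con ℤ.1ℤ :- t :* t)) :* (:- t) :+ (u :* (t :+ t)) :* con ℤ.1ℤ
        := ((con ℤ.1ℤ :+ t :* t) :* u) :* t) refl u t) (trans (*-congʳ ut≈1) (*-identityˡ t))

    on-circle : ∀ c₁ c₂ r →
      let a = u * (1# - t * t) ; b = u * (t + t)
          x = (c₁ + (r * a - 0# * b)) - c₁ ; y = (c₂ + (r * b + 0# * a)) - c₂ in x * x + y * y ≈ r * r
    on-circle c₁ c₂ r = begin
      _ ≈⟨ solve 5 (λ u t c₁ c₂ r →
             let a = u :* (con ℤ.1ℤ :- t :* t) ; b = u :* (t :+ t)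
                 x = (c₁ :+ (r :* a :- con ℤ.0ℤ :* b)) :- c₁ ; y = (c₂ :+ (r :* b :+ con ℤ.0ℤ :* a)) :- c₂
                 v = (con ℤ.1ℤ :+ t :* t) :* u
             in x :* x :+ y :* y := (r :* v) :* (r :* v)) refl u t c₁ c₂ r ⟩
      (r * ((1# + t * t) * u)) * (r * ((1# + t * t) * u))
        ≈⟨ *-cong (*-congˡ ut≈1) (*-congˡ ut≈1) ⟩
      (r * 1#) * (r * 1#)  ≈⟨ *-cong (*-identityʳ r) (*-identityʳ r) ⟩
      r * r                ∎

  re-real-* : ∀ x → x * x ≈ x * x - 0# * 0#
  re-real-* = solve 1 (λ x → x :* x := x :* x :- con ℤ.0ℤ :* con ℤ.0ℤ) refl

  im-real-* : ∀ x → 0# ≈ x * 0# + 0# * x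
  im-real-* = solve 1 (λ x → con ℤ.0ℤ := x :* con ℤ.0ℤ :+ con ℤ.0ℤ :* x) refl

  im-chord : ∀ s t → (1# * - s + t * 1#) - (1# * - t + s * 1#) ≈ (t - s) + (t - s)
  im-chord = solve 2 (λ s t → (con ℤ.1ℤ :* (:- s) :+ t :* con ℤ.1ℤ) :- (con ℤ.1ℤ :* (:- t) :+ s :* con ℤ.1ℤ)
    := (t :- s) :+ (t :- s)) refl

  -- Subtraction of the fractions p / q and p′ / q′ with the denominators cleared, since inverses of
  -- q and q′ are not at hand.
  chord : ∀ w w′ p p′ q q′ → w * q ≈ p → w′ * q′ ≈ p′ → (w′ - w) * (q * q′) ≈ p′ * q - p * q′
  chord w w′ p p′ q q′ wq≈p w′q′≈p′ = begin
    (w′ - w) * (q * q′)              ≈⟨ solve 4 (λ w w′ q q′ →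
        (w′ :- w) :* (q :* q′) := (w′ :* q′) :* q :- (w :* q) :* q′) refl w w′ q q′ ⟩
    (w′ * q′) * q - (w * q) * q′     ≈⟨ +-cong (*-congʳ w′q′≈p′) (-‿cong (*-congʳ wq≈p)) ⟩
    p′ * q - p * q′                  ∎

  scaled-difference : ∀ c r w w′ → (c + r * w′) - (c + r * w) ≈ r * (w′ - w)
  scaled-difference = solve 4 (λ c r w w′ → (c :+ r :* w′) :- (c :+ r :* w) := r :* (w′ :- w)) refl

  lipschitz-constant : ∀ Z L K δ → (Z * (L * δ) + δ * K) + (Z * (L * δ) + δ * K)
                                 ≈ ((Z * L + K) + (Z * L + K)) * δ
  lipschitz-constant = solve 4 (λ Z L K δ → (Z :* (L :* δ) :+ δ :* K) :+ (Z :* (L :* δ) :+ δ :* K)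
    := ((Z :* L :+ K) :+ (Z :* L :+ K)) :* δ) refl

  collect : ∀ L δ → (L * δ + δ) + (L * δ + δ) ≈ ((L + 1#) + (L + 1#)) * δ
  collect = solve 2 (λ L δ → (L :* δ :+ δ) :+ (L :* δ :+ δ) := ((L :+ con ℤ.1ℤ) :+ (L :+ con ℤ.1ℤ)) :* δ) refl

  y≈x-[x-y] : ∀ x y → x + - (x - y) ≈ y
  y≈x-[x-y] = solve 2 (λ x y → x :+ :- (x :- y) := y) refl

  difference-quotient : ∀ b z w gz gw → (b + z * gz) - (b + w * gw) ≈ z * (gz - gw) + (z - w) * gw
  difference-quotient = solve 5 (λ b z w gz gw → (b :+ z :* gz) :- (b :+ w :* gw)
    := z :* (gz :- gw) :+ (z :- w) :* gw) refl

  cancel-subtrahend : ∀ x y a → (x - a) - (y - a) ≈ x - y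
  cancel-subtrahend = solve 3 (λ x y a → (x :- a) :- (y :- a) := x :- y) refl

  detour : ∀ x y u v → u ≈ v → (x - u) + - (y - v) ≈ x - y
  detour x y u v u≈v = trans (+-congʳ (+-congˡ (-‿cong u≈v)))
    (solve 3 (λ x y v → (x :- v) :+ :- (y :- v) := x :- y) refl x y v)

-- Cancelable elements and polynomial functions

module Polynomials (R : CommutativeRing 0ℓ 0ℓ) where
  open CommutativeRing R renaming (Carrier to C) hiding (zero)
  open IntegerSolver R using (solve; _:=_; _:+_; _:*_; _:-_; :-_; con)
  open SemiringExp semiring using (_^_)
  open SetoidReasoning setoid

  -- Stands in for nonzero. Constructively a negated equation in ℂ yields neither an inverse nor
  -- cancellation, whereas this property gives cancellation directly and is closed under products.
  record Cancelable (x : C) : Set where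
    constructor cancelable
    field cancel : ∀ y → x * y ≈ 0# → y ≈ 0#

  open Cancelable public

  cancelable-resp : ∀ {x y} → x ≈ y → Cancelable x → Cancelable y
  cancelable-resp x≈y cx = cancelable λ z yz≈0 → cancel cx z (trans (*-congʳ x≈y) yz≈0)

  cancelable-1 : Cancelable 1#
  cancelable-1 = cancelable λ y 1y≈0 → trans (sym (*-identityˡ y)) 1y≈0

  cancelable-* : ∀ {x y} → Cancelable x → Cancelable y → Cancelable (x * y)
  cancelable-* cx cy = cancelable λ z xyz≈0 → cancel cy z (cancel cx _ (trans (sym (*-assoc _ _ _)) xyz≈0))

  cancelable-^ : ∀ {x} → Cancelable x → ∀ n → Cancelable (x ^ n)
  cancelable-^ cx zero    = cancelable-1
  cancelable-^ cx (suc n) = cancelable-* cx (cancelable-^ cx n)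

  cancelable-factor : ∀ {x} y → Cancelable (x * y) → Cancelable x
  cancelable-factor {x} y cxy = cancelable λ z xz≈0 → cancel cxy z (begin
    (x * y) * z  ≈⟨ solve 3 (λ x y z → (x :* y) :* z := y :* (x :* z)) refl x y z ⟩
    y * (x * z)  ≈⟨ *-congˡ xz≈0 ⟩
    y * 0#       ≈⟨ zeroʳ y ⟩
    0#           ∎)

  -- f is a polynomial function ∑ aᵢ zⁱ of formal degree d with a_d = a.
  Poly : ℕ → C → (C → C) → Set
  Poly zero    a f = ∀ z → f z ≈ a
  Poly (suc d) a f = ∃₂ λ b g → Poly d a g × (∀ z → f z ≈ b + z * g z)

  poly-cong : ∀ d {a f} → Poly d a f → ∀ {u v} → u ≈ v → f u ≈ f v
  poly-cong zero    p u≈v = trans (p _) (sym (p _))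
  poly-cong (suc d) (b , g , p , f≈) u≈v =
    trans (f≈ _) (trans (+-congˡ (*-cong u≈v (poly-cong d p u≈v))) (sym (f≈ _)))

  poly-resp : ∀ d {a f g} → (∀ z → g z ≈ f z) → Poly d a f → Poly d a g
  poly-resp zero    g≈f p z = trans (g≈f z) (p z)
  poly-resp (suc d) g≈f (b , h , p , f≈) = b , h , p , λ z → trans (g≈f z) (f≈ z)

  -- Synthetic division in Horner form. The quotient inherits the leading coefficient, so the
  -- descent in `constantModulus⇒monomial` can keep `a` fixed.
  poly-divide : ∀ d {a f} → Poly (suc d) a f → ∀ c →
                ∃ λ q → Poly d a q × (∀ z → f z ≈ f c + (z - c) * q z)
  poly-divide zero {a} {f} (b , g , p , f≈) c = g , p , λ z → begin
    f z                                ≈⟨ f≈ z ⟩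
    b + z * g z                        ≈⟨ solve 4 (λ b c z g →
        b :+ z :* g := (b :+ c :* g) :+ (z :- c) :* g) refl b c z (g z) ⟩
    (b + c * g z) + (z - c) * g z
      ≈⟨ +-congʳ (+-congˡ (*-congˡ (trans (p z) (sym (p c))))) ⟩
    (b + c * g c) + (z - c) * g z      ≈⟨ +-congʳ (f≈ c) ⟨
    f c + (z - c) * g z                ∎
  poly-divide (suc d) {a} {f} (b , g , p , f≈) c with poly-divide d p c
  ... | h , ph , g≈ = (λ z → g c + z * h z) , (g c , h , ph , λ _ → refl) , λ z → begin
    f z                                          ≈⟨ f≈ z ⟩
    b + z * g z                                  ≈⟨ +-congˡ (*-congˡ (g≈ z)) ⟩
    b + z * (g c + (z - c) * h z)                ≈⟨ solve 5 (λ b c z k h →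
        b :+ z :* (k :+ (z :- c) :* h) := (b :+ c :* k) :+ (z :- c) :* (k :+ z :* h))
        refl b c z (g c) (h z) ⟩
    (b + c * g c) + (z - c) * (g c + z * h z)    ≈⟨ +-congʳ (f≈ c) ⟨
    f c + (z - c) * (g c + z * h z)              ∎

  -- Degree and leading coefficient are existential because for a sum they depend on which degree is
  -- larger; the vanishing argument asks only that some degree exist.
  IsPolynomial : (C → C) → Set
  IsPolynomial f = ∃₂ λ d a → Poly d a f

  isPolynomial-resp : ∀ {f g} → (∀ z → g z ≈ f z) → IsPolynomial f → IsPolynomial g
  isPolynomial-resp g≈f (d , a , p) = d , a , poly-resp d g≈f p

  const-isPolynomial : ∀ a → IsPolynomial (λ _ → a)
  const-isPolynomial a = 0 , a , λ _ → refl

  shift-isPolynomial : ∀ b {g} → IsPolynomial g → IsPolynomial (λ z → b + z * g z)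
  shift-isPolynomial b (d , a , p) = suc d , a , b , _ , p , λ _ → refl

  +-isPolynomial : ∀ {f g} → IsPolynomial f → IsPolynomial g → IsPolynomial (λ z → f z + g z)
  +-isPolynomial (d , a , p) (e , b , q) = sum d e p q
    where
    sum : ∀ d e {a b f g} → Poly d a f → Poly e b g → IsPolynomial (λ z → f z + g z)
    sum zero    zero    p q = 0 , _ , λ z → +-cong (p z) (q z)
    sum zero    (suc e) {a} p (b , h , ph , g≈) = suc e , _ , a + b , h , ph , λ z →
      trans (+-cong (p z) (g≈ z)) (sym (+-assoc _ _ _))
    sum (suc d) zero    {b = b} (c , h , ph , f≈) q = suc d , _ , c + b , h , ph , λ z →
      trans (+-cong (f≈ z) (q z))
        (solve 3 (λ c x b → (c :+ x) :+ b := (c :+ b) :+ x) refl _ _ _)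
    sum (suc d) (suc e) (b , h , ph , f≈) (c , k , pk , g≈) =
      isPolynomial-resp
        (λ z → trans (+-cong (f≈ z) (g≈ z))
          (solve 5 (λ b c z h k →
            (b :+ z :* h) :+ (c :+ z :* k) := (b :+ c) :+ z :* (h :+ k)) refl b c z (h z) (k z)))
        (shift-isPolynomial (b + c) (sum d e ph pk))

  scale-isPolynomial : ∀ k {f} → IsPolynomial f → IsPolynomial (λ z → k * f z)
  scale-isPolynomial k (d , a , p) = d , k * a , scale d p
    where
    scale : ∀ d {a f} → Poly d a f → Poly d (k * a) (λ z → k * f z)
    scale zero    p z = *-congˡ (p z)
    scale (suc d) (b , g , p , f≈) = k * b , _ , scale d p , λ z →
      trans (*-congˡ (f≈ z))
        (solve 4 (λ k b z g → k :* (b :+ z :* g) := k :* b :+ z :* (k :* g)) refl k b z (g z))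

  *-isPolynomial : ∀ {f g} → IsPolynomial f → IsPolynomial g → IsPolynomial (λ z → f z * g z)
  *-isPolynomial {g = g} (d , a , p) isPoly-g = product d p
    where
    product : ∀ d {a f} → Poly d a f → IsPolynomial (λ z → f z * g z)
    product zero p = isPolynomial-resp (λ z → *-congʳ (p z)) (scale-isPolynomial _ isPoly-g)
    product (suc d) (b , h , ph , f≈) = isPolynomial-resp
      (λ z → trans (*-congʳ (f≈ z))
        (solve 4 (λ b z h g → (b :+ z :* h) :* g := b :* g :+ (con ℤ.0ℤ :+ z :* (h :* g)))
          refl b z (h z) (g z)))
      (+-isPolynomial (scale-isPolynomial b isPoly-g) (shift-isPolynomial 0# (product d ph)))

  linear-isPolynomial : ∀ c → IsPolynomial (λ z → z - c)
  linear-isPolynomial c = isPolynomial-resp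
    (λ z → trans (+-comm z (- c)) (+-congˡ (sym (*-identityʳ z))))
    (shift-isPolynomial (- c) (const-isPolynomial 1#))

  ^-isPolynomial : ∀ n {f} → IsPolynomial f → IsPolynomial (λ z → f z ^ n)
  ^-isPolynomial zero    p = const-isPolynomial 1#
  ^-isPolynomial (suc n) p = *-isPolynomial p (^-isPolynomial n p)

  -- Induction on the degree: after division by z - s k the quotient vanishes at all later points,
  -- since s i - s k can be cancelled there.
  vanishes-everywhere : (s : ℕ → C) → (∀ i j → i ℕ.< j → Cancelable (s j - s i)) →
                        ∀ {f} → IsPolynomial f → (∀ i → f (s i) ≈ 0#) → ∀ z → f z ≈ 0#
  vanishes-everywhere s distinct (d , a , p) zeros = go d 0 p (λ i _ → zeros i)
    where
    -- `k` is the first sample point not yet divided out; later ones never run out, whatever the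
    -- degree.
    go : ∀ d k {a f} → Poly d a f → (∀ i → k ℕ.≤ i → f (s i) ≈ 0#) → ∀ z → f z ≈ 0#
    go zero k p zeros z = trans (p z) (trans (sym (p (s k))) (zeros k ℕ.≤-refl))
    go (suc d) k {f = f} p zeros z with poly-divide d p (s k)
    ... | q , pq , f≈ = begin
      f z                          ≈⟨ f≈ z ⟩
      f (s k) + (z - s k) * q z    ≈⟨ +-cong (zeros k ℕ.≤-refl) (*-congˡ (go d (suc k) pq q-zeros z)) ⟩
      0# + (z - s k) * 0#          ≈⟨ trans (+-identityˡ _) (zeroʳ _) ⟩
      0#                           ∎
      where
      q-zeros : ∀ i → suc k ℕ.≤ i → q (s i) ≈ 0#
      q-zeros i k<i = cancel (distinct k i k<i) (q (s i)) (begin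
        (s i - s k) * q (s i)              ≈⟨ +-identityˡ _ ⟨
        0# + (s i - s k) * q (s i)         ≈⟨ +-congʳ (zeros k ℕ.≤-refl) ⟨
        f (s k) + (s i - s k) * q (s i)    ≈⟨ f≈ (s i) ⟨
        f (s i)                            ≈⟨ zeros i (ℕ.<⇒≤ k<i) ⟩
        0#                                 ∎)

  -- Polynomials of constant modulus on a circle

  -- The circle |z - c|² = ρ is represented by infinitely many points s i on it.
  module ConstantModulus
    (conj : C → C)
    (conj-cong : ∀ {x y} → x ≈ y → conj x ≈ conj y)
    (conj-+ : ∀ x y → conj (x + y) ≈ conj x + conj y)
    (conj-* : ∀ x y → conj (x * y) ≈ conj x * conj y)
    (c ρ : C) (ρ-cancelable : Cancelable ρ)
    (s : ℕ → C) (distinct : ∀ i j → i ℕ.< j → Cancelable (s j - s i))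
    (on-circle : ∀ i → (s i - c) * conj (s i - c) ≈ ρ)
    where

    -- The reversed polynomial: on the circle conj (z - c) = ρ / (z - c).
    reverse : ∀ d {a f} → Poly d a f →
      ∃ λ f# → IsPolynomial f# × f# c ≈ conj a * ρ ^ d ×
               (∀ z → (z - c) * conj (z - c) ≈ ρ → f# z ≈ (z - c) ^ d * conj (f z))
    reverse zero {a} p = (λ _ → conj a) , const-isPolynomial (conj a) , sym (*-identityʳ _) ,
      λ z _ → trans (conj-cong (sym (p z))) (sym (*-identityˡ _))
    reverse (suc d) {a} {f} p with poly-divide d p c
    ... | g , pg , f≈ with reverse d pg
    ... | g# , pg# , g#c , g#circle =
        f#
      , +-isPolynomial (scale-isPolynomial _ (^-isPolynomial (suc d) (linear-isPolynomial c)))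
                       (scale-isPolynomial ρ pg#)
      , (begin
          conj (f c) * ((c - c) * (c - c) ^ d) + ρ * g# c
            ≈⟨ +-cong (*-congˡ (trans (*-congʳ (-‿inverseʳ c)) (zeroˡ _))) (*-congˡ g#c) ⟩
          conj (f c) * 0# + ρ * (conj a * ρ ^ d)
            ≈⟨ trans (+-congʳ (zeroʳ _)) (+-identityˡ _) ⟩
          ρ * (conj a * ρ ^ d)
            ≈⟨ solve 3 (λ r a p → r :* (a :* p) := a :* (r :* p)) refl ρ (conj a) (ρ ^ d) ⟩
          conj a * (ρ * ρ ^ d) ∎)
      , λ z z∈ → begin
          conj (f c) * ((z - c) * (z - c) ^ d) + ρ * g# z
            ≈⟨ +-congˡ (*-cong (sym z∈) (g#circle z z∈)) ⟩
          conj (f c) * ((z - c) * (z - c) ^ d) + ((z - c) * conj (z - c)) * ((z - c) ^ d * conj (g z))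
            ≈⟨ solve 5 (λ k x x^d x̄ ḡ →
                 k :* (x :* x^d) :+ (x :* x̄) :* (x^d :* ḡ) := (x :* x^d) :* (k :+ x̄ :* ḡ))
                 refl (conj (f c)) (z - c) ((z - c) ^ d) (conj (z - c)) (conj (g z)) ⟩
          ((z - c) * (z - c) ^ d) * (conj (f c) + conj (z - c) * conj (g z))
            ≈⟨ *-congˡ (trans (conj-cong (f≈ z)) (trans (conj-+ _ _) (+-congˡ (conj-* _ _)))) ⟨
          ((z - c) * (z - c) ^ d) * conj (f z) ∎
      where
      -- Conjugating f = f(c) + (z - c) g and multiplying by (z - c)^(d+1) turns one product (z - c)
      -- conj (z - c) into ρ and leaves (z - c)^d conj g, which is `g#` on the circle.
      f# : C → C
      f# z = conj (f c) * (z - c) ^ suc d + ρ * g# z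

    -- The factor `τ` collects one ρ for each z - c split off: |f|² = ρ |g|² on the circle, and
    -- dividing by ρ is avoided. At c only the term of `F` containing f#(c) survives, and the
    -- coefficients in it are all cancelable.
    constantModulus⇒monomial : ∀ d {a f} τ σ → Poly d a f → Cancelable (conj a) → Cancelable τ →
      (∀ i → τ * (f (s i) * conj (f (s i))) ≈ σ) → ∀ z → f z ≈ a * (z - c) ^ d
    constantModulus⇒monomial zero τ σ p _ _ _ z = trans (p z) (sym (*-identityʳ _))
    constantModulus⇒monomial (suc d) {a} {f} τ σ p ca cτ modulus z = begin
      f z                      ≈⟨ f≈₀ z ⟩
      (z - c) * g z            ≈⟨ *-congˡ (constantModulus⇒monomial d (τ * ρ) σ pg ca
                                    (cancelable-* cτ ρ-cancelable) g-modulus z) ⟩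
      (z - c) * (a * (z - c) ^ d)
        ≈⟨ solve 3 (λ x a p → x :* (a :* p) := a :* (x :* p)) refl (z - c) a ((z - c) ^ d) ⟩
      a * (z - c) ^ suc d      ∎
      where
      g = proj₁ (poly-divide d p c)
      pg = proj₁ (proj₂ (poly-divide d p c))
      f≈ = proj₂ (proj₂ (poly-divide d p c))
      f# = proj₁ (reverse (suc d) p)
      pf# = proj₁ (proj₂ (reverse (suc d) p))
      f#c = proj₁ (proj₂ (proj₂ (reverse (suc d) p)))
      f#circle = proj₂ (proj₂ (proj₂ (reverse (suc d) p)))

      F : C → C
      F z = τ * (f z * f# z) + - σ * (z - c) ^ suc d

      F-zero : ∀ z → F z ≈ 0#
      F-zero = vanishes-everywhere s distinct
        (+-isPolynomial (scale-isPolynomial τ (*-isPolynomial (suc d , a , p) pf#))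
          (scale-isPolynomial (- σ) (^-isPolynomial (suc d) (linear-isPolynomial c))))
        λ i → let x^d = (s i - c) ^ suc d ; w = f (s i) ; w̄ = conj w in begin
          τ * (w * f# (s i)) + - σ * x^d     ≈⟨ +-congʳ (*-congˡ (*-congˡ (f#circle (s i) (on-circle i)))) ⟩
          τ * (w * (x^d * w̄)) + - σ * x^d
            ≈⟨ solve 5 (λ τ σ w w̄ x → τ :* (w :* (x :* w̄)) :+ (:- σ) :* x
                                    := (τ :* (w :* w̄) :- σ) :* x) refl τ σ w w̄ x^d ⟩
          (τ * (w * w̄) - σ) * x^d            ≈⟨ *-congʳ (trans (+-congʳ (modulus i)) (-‿inverseʳ σ)) ⟩
          0# * x^d                           ≈⟨ zeroˡ _ ⟩
          0#                                 ∎

      fc≈0 : f c ≈ 0#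
      fc≈0 = cancel (cancelable-* cτ (cancelable-* ca (cancelable-^ ρ-cancelable (suc d)))) (f c) (begin
        (τ * (conj a * ρ ^ suc d)) * f c
          ≈⟨ solve 4 (λ τ a r x → (τ :* (a :* r)) :* x := τ :* (x :* (a :* r)))
               refl τ (conj a) (ρ ^ suc d) (f c) ⟩
        τ * (f c * (conj a * ρ ^ suc d))            ≈⟨ *-congˡ (*-congˡ f#c) ⟨
        τ * (f c * f# c)                            ≈⟨ +-identityʳ _ ⟨
        τ * (f c * f# c) + 0#                       ≈⟨ +-congˡ (zeroʳ _) ⟨
        τ * (f c * f# c) + - σ * 0#
          ≈⟨ +-congˡ (*-congˡ (trans (*-congʳ (-‿inverseʳ c)) (zeroˡ _))) ⟨
        F c                                         ≈⟨ F-zero c ⟩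
        0#                                          ∎)

      f≈₀ : ∀ z → f z ≈ (z - c) * g z
      f≈₀ z = trans (f≈ z) (trans (+-congʳ fc≈0) (+-identityˡ _))

      g-modulus : ∀ i → (τ * ρ) * (g (s i) * conj (g (s i))) ≈ σ
      g-modulus i = let x = s i - c ; w = g (s i) in begin
        (τ * ρ) * (w * conj w)                ≈⟨ *-congʳ (*-congˡ (on-circle i)) ⟨
        (τ * (x * conj x)) * (w * conj w)
          ≈⟨ solve 5 (λ τ x x̄ w w̄ → (τ :* (x :* x̄)) :* (w :* w̄) := τ :* ((x :* w) :* (x̄ :* w̄)))
               refl τ x (conj x) w (conj w) ⟩
        τ * ((x * w) * (conj x * conj w))     ≈⟨ *-congˡ (*-congˡ (conj-* x w)) ⟨
        τ * ((x * w) * conj (x * w))          ≈⟨ *-congˡ (*-cong (f≈₀ (s i)) (conj-cong (f≈₀ (s i)))) ⟨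
        τ * (f (s i) * conj (f (s i)))        ≈⟨ modulus i ⟩
        σ                                     ∎

  -- Coefficient comparison in characteristic zero

  module CharacteristicZero where
    open SemiringMult semiring renaming (_×_ to _×′_)
    open RingProperties ring using (-0#≈0#)

    module _ (char0 : ∀ n → Cancelable (suc n ×′ 1#)) where

      naturals-distinct : ∀ i j → i ℕ.< j → Cancelable (suc j ×′ 1# - suc i ×′ 1#)
      naturals-distinct i j i<j with ℕ.m≤n⇒∃[o]m+o≡n i<j
      ... | k , ≡.refl = cancelable-resp (begin
        suc k ×′ 1#                                ≈⟨ solve 2 (λ x y → y := (x :+ y) :- x) refl _ _ ⟩
        (suc i ×′ 1# + suc k ×′ 1#) - suc i ×′ 1#  ≈⟨ +-congʳ (×-homo-+ 1# (suc i) (suc k)) ⟨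
        (suc i ℕ.+ suc k) ×′ 1# - suc i ×′ 1#
          ≡⟨ ≡.cong (λ m → m ×′ 1# - suc i ×′ 1#) (ℕ.+-suc (suc i) k) ⟩
        suc (suc i ℕ.+ k) ×′ 1# - suc i ×′ 1#      ∎) (char0 k)

      -- Setting z = 0 gives b = c. Then z (f - g) vanishes, and z can be cancelled at the positive
      -- integers, which are points enough for f - g to vanish at 0 as well.
      derivative-unique : ∀ {b c f g} → IsPolynomial f → IsPolynomial g →
                          (∀ z → b + z * f z ≈ c + z * g z) → f 0# ≈ g 0#
      derivative-unique {b} {c} {f} {g} pf pg eq = begin
        f 0#                          ≈⟨ solve 2 (λ x y → x := (x :+ :- y) :+ y) refl _ _ ⟩
        (f 0# + - g 0#) + g 0#        ≈⟨ +-congʳ (+-congˡ (solve 1 (λ y → :- y := (:- con ℤ.1ℤ) :* y) refl _)) ⟩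
        (f 0# + - 1# * g 0#) + g 0#   ≈⟨ +-congʳ (f-g≈0 0#) ⟩
        0# + g 0#                     ≈⟨ +-identityˡ _ ⟩
        g 0#                          ∎
        where
        b≈c : b ≈ c
        b≈c = trans (solve 2 (λ b x → b := b :+ con ℤ.0ℤ :* x) refl b (f 0#))
             (trans (eq 0#) (solve 2 (λ b x → b :+ con ℤ.0ℤ :* x := b) refl c (g 0#)))

        f-g≈0 : ∀ z → f z + - 1# * g z ≈ 0#
        f-g≈0 = vanishes-everywhere (λ i → suc i ×′ 1#) naturals-distinct
          (+-isPolynomial pf (scale-isPolynomial (- 1#) pg))
          λ i → let z = suc i ×′ 1# in cancel (char0 i) _ (begin
            z * (f z + - 1# * g z)
              ≈⟨ solve 4 (λ b z f g → z :* (f :+ (:- con ℤ.1ℤ) :* g)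
                                   := (b :+ z :* f) :- (b :+ z :* g)) refl b z (f z) (g z) ⟩
            (b + z * f z) - (b + z * g z)    ≈⟨ +-cong (eq z) (-‿cong (+-congʳ b≈c)) ⟩
            (c + z * g z) - (c + z * g z)    ≈⟨ -‿inverseʳ _ ⟩
            0#                               ∎)

      -- Degree D = d + 2 and N = D + (k + 1) encode 2 ≤ D < N, so that N - D is the positive
      -- integer k + 1, which can be cancelled from (N - D) e = 0.
      no-monomial : ∀ {f a c} d k → let N = suc (suc d) ℕ.+ suc k in IsPolynomial f → f 0# ≈ N ×′ 1# →
                    (∀ z → z * f z ≈ c + a * (z - c) ^ suc (suc d)) → 1# ≈ 0#
      no-monomial {f} {a} {c} d k pf f0 eq = cancel (char0 (suc d ℕ.+ suc k)) 1# (trans (*-identityʳ _) (begin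
        (D ℕ.+ suc k) ×′ 1#                   ≈⟨ N≈ ⟩
        a * slope D 0#
          -- As D is at least 2, both summands of the slope at 0 contain a factor `e`: the power
          -- e^(D-1) and the product of 0 - c with the previous slope.
          ≈⟨ *-congˡ (+-cong (*-congʳ e≈0) (*-congʳ (trans (+-identityˡ e) e≈0))) ⟩
        a * (0# * e ^ d + 0# * slope (suc d) 0#)
          ≈⟨ solve 3 (λ a x y → a :* (con ℤ.0ℤ :* x :+ con ℤ.0ℤ :* y) := con ℤ.0ℤ) refl _ _ _ ⟩
        0#                                    ∎))
        where
        e = - c
        D = suc (suc d)

        -- The divided difference ((z - c)^n - e^n) / z, given by a recursion that shows it to be a
        -- polynomial.
        slope : ℕ → C → C
        slope zero    z = 0#
        slope (suc n) z = e ^ n + (z - c) * slope n z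

        slope-isPolynomial : ∀ n → IsPolynomial (slope n)
        slope-isPolynomial zero    = const-isPolynomial 0#
        slope-isPolynomial (suc n) = +-isPolynomial (const-isPolynomial (e ^ n))
          (*-isPolynomial (linear-isPolynomial c) (slope-isPolynomial n))

        power≈ : ∀ n z → (z - c) ^ n ≈ e ^ n + z * slope n z
        power≈ zero    z = sym (trans (+-congˡ (zeroʳ z)) (+-identityʳ 1#))
        power≈ (suc n) z = trans (*-congˡ (power≈ n z))
          (solve 4 (λ z e p s → (z :+ e) :* (p :+ z :* s) := e :* p :+ z :* (p :+ (z :+ e) :* s))
            refl z e (e ^ n) (slope n z))

        -- The derivative n e^(n-1) at 0; the extra factor `e` avoids the exponent n - 1.
        slope₀ : ∀ n → slope n 0# * e ≈ n ×′ 1# * e ^ n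
        slope₀ zero    = trans (zeroˡ e) (sym (zeroˡ _))
        slope₀ (suc n) = begin
          (e ^ n + (0# + e) * slope n 0#) * e
            ≈⟨ solve 3 (λ p e s → (p :+ (con ℤ.0ℤ :+ e) :* s) :* e := e :* p :+ e :* (s :* e))
                 refl (e ^ n) e (slope n 0#) ⟩
          e * e ^ n + e * (slope n 0# * e)     ≈⟨ +-congˡ (*-congˡ (slope₀ n)) ⟩
          e * e ^ n + e * (n ×′ 1# * e ^ n)
            ≈⟨ solve 3 (λ e p m → e :* p :+ e :* (m :* p) := (con ℤ.1ℤ :+ m) :* (e :* p))
                 refl e (e ^ n) (n ×′ 1#) ⟩
          (1# + n ×′ 1#) * (e * e ^ n)         ∎

        expansion : ∀ z → 0# + z * f z ≈ (c + a * e ^ D) + z * (a * slope D z)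
        expansion z = begin
          0# + z * f z                             ≈⟨ trans (+-identityˡ _) (eq z) ⟩
          c + a * (z - c) ^ D                      ≈⟨ +-congˡ (*-congˡ (power≈ D z)) ⟩
          c + a * (e ^ D + z * slope D z)          ≈⟨ solve 5 (λ c a p z s →
              c :+ a :* (p :+ z :* s) := (c :+ a :* p) :+ z :* (a :* s)) refl c a (e ^ D) z (slope D z) ⟩
          (c + a * e ^ D) + z * (a * slope D z)    ∎

        N≈ : (D ℕ.+ suc k) ×′ 1# ≈ a * slope D 0#
        N≈ = trans (sym f0) (derivative-unique pf (scale-isPolynomial a (slope-isPolynomial D)) expansion)

        ae^D≈e : a * e ^ D ≈ e
        ae^D≈e = begin
          a * e ^ D                ≈⟨ solve 2 (λ c x → x := :- c :+ (c :+ x)) refl c _ ⟩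
          e + (c + a * e ^ D)      ≈⟨ +-congˡ (begin
             c + a * e ^ D                              ≈⟨ solve 2 (λ x y → x := x :+ con ℤ.0ℤ :* y) refl _ _ ⟩
             (c + a * e ^ D) + 0# * (a * slope D 0#)    ≈⟨ expansion 0# ⟨
             0# + 0# * f 0#                             ≈⟨ trans (+-identityˡ _) (zeroˡ _) ⟩
             0#                                         ∎) ⟩
          e + 0#                   ≈⟨ +-identityʳ e ⟩
          e                        ∎

        e≈0 : e ≈ 0#
        e≈0 = cancel (char0 k) e (begin
          suc k ×′ 1# * e
            ≈⟨ solve 3 (λ x y e → y :* e := (x :+ y) :* e :- x :* e) refl (D ×′ 1#) (suc k ×′ 1#) e ⟩
          (D ×′ 1# + suc k ×′ 1#) * e - D ×′ 1# * e
            ≈⟨ +-congʳ (begin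
                 (D ×′ 1# + suc k ×′ 1#) * e     ≈⟨ *-congʳ (×-homo-+ 1# D (suc k)) ⟨
                 (D ℕ.+ suc k) ×′ 1# * e         ≈⟨ *-congʳ N≈ ⟩
                 (a * slope D 0#) * e            ≈⟨ *-assoc _ _ _ ⟩
                 a * (slope D 0# * e)            ≈⟨ *-congˡ (slope₀ D) ⟩
                 a * (D ×′ 1# * e ^ D)
                   ≈⟨ solve 3 (λ a m p → a :* (m :* p) := m :* (a :* p)) refl a (D ×′ 1#) (e ^ D) ⟩
                 D ×′ 1# * (a * e ^ D)           ≈⟨ *-congˡ ae^D≈e ⟩
                 D ×′ 1# * e                     ∎) ⟩
          D ×′ 1# * e - D ×′ 1# * e              ≈⟨ -‿inverseʳ _ ⟩
          0#                                     ∎)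

-- Independent sets of a lexicographic product

occupied : ∀ {m} → Subset m → Bool
occupied []      = false
occupied (b ∷ q) = b ∨ occupied q

∈⇒occupied : ∀ {m} {q : Subset m} {j} → j ∈ q → occupied q ≡ true
∈⇒occupied here = ≡.refl
∈⇒occupied {q = false ∷ q} (there j∈q) = ∈⇒occupied j∈q
∈⇒occupied {q = true ∷ q}  (there j∈q) = ≡.refl

occupied⇒∈ : ∀ {m} (q : Subset m) → occupied q ≡ true → ∃ (_∈ q)
occupied⇒∈ (true  ∷ q) _ = zero , here
occupied⇒∈ (false ∷ q) o with occupied⇒∈ q o
... | j , j∈q = suc j , there j∈q

-- A subset of V(G) × V(H) is stored as `concat qs`, one block for each vertex of G, in the order
-- used by `remQuot`. This is its projection to V(G).
support : ∀ {m n} → Vec (Subset m) n → Subset n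
support = Vec.map occupied

module _ {m n : ℕ} (qs : Vec (Subset m) n) where

  ∈concat⁺ : ∀ {i j} → j ∈ lookup qs i → combine i j ∈ concat qs
  ∈concat⁺ {i} {j} j∈qᵢ = Vec.lookup⇒[]= _ _
    (≡.trans (Vec.lookup-concat qs i j) (Vec.[]=⇒lookup j∈qᵢ))

  ∈concat⁻ : ∀ {x i j} → remQuot m x ≡ (i , j) → x ∈ concat qs → j ∈ lookup qs i
  ∈concat⁻ {x} {i} {j} x≡ x∈ = Vec.lookup⇒[]= _ _ (≡.trans (≡.sym (Vec.lookup-concat qs i j))
    (≡.trans (≡.cong (lookup (concat qs)) ij≡x) (Vec.[]=⇒lookup x∈)))
    where
    ij≡x : combine i j ≡ x
    ij≡x = ≡.trans (≡.cong (λ (i , j) → combine i j) (≡.sym x≡)) (Fin.combine-remQuot {n} m x)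

  ∈support⁺ : ∀ {i j} → j ∈ lookup qs i → i ∈ support qs
  ∈support⁺ {i} j∈qᵢ = Vec.lookup⇒[]= _ _ (≡.trans (Vec.lookup-map i occupied qs) (∈⇒occupied j∈qᵢ))

  ∈support⁻ : ∀ {i} → i ∈ support qs → ∃ (_∈ lookup qs i)
  ∈support⁻ {i} i∈ = occupied⇒∈ _ (≡.trans (≡.sym (Vec.lookup-map i occupied qs)) (Vec.[]=⇒lookup i∈))

module _ (G H : Graph) (qs : Vec (Subset (order H)) (order G)) where

  independent-support : Independent (G ⟦ H ⟧) (concat qs) → Independent G (support qs)
  independent-support ind u v u∈ v∈ u~v with ∈support⁻ qs u∈ | ∈support⁻ qs v∈
  ... | i , i∈ | j , j∈ = ind (combine u i) (combine v j) (∈concat⁺ qs i∈) (∈concat⁺ qs j∈)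
    -- `remQuot` does not reduce on `combine`, so the adjacency is transported along
    -- `remQuot-combine`.
    (≡.subst₂ (λ (u , i) (v , j) → Adj G u v ⊎ (u ≡ v × Adj H i j))
      (≡.sym (Fin.remQuot-combine u i)) (≡.sym (Fin.remQuot-combine v j)) (inj₁ u~v))

  independent-blocks : Independent (G ⟦ H ⟧) (concat qs) → ∀ u → Independent H (lookup qs u)
  independent-blocks ind u i j i∈ j∈ i~j =
    ind (combine u i) (combine u j) (∈concat⁺ qs i∈) (∈concat⁺ qs j∈)
    (≡.subst₂ (λ (u , i) (v , j) → Adj G u v ⊎ (u ≡ v × Adj H i j))
      (≡.sym (Fin.remQuot-combine u i)) (≡.sym (Fin.remQuot-combine u j)) (inj₂ (≡.refl , i~j)))

  independent-concat : Independent G (support qs) → (∀ u → Independent H (lookup qs u)) →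
                       Independent (G ⟦ H ⟧) (concat qs)
  independent-concat indG indH x y x∈ y∈ (inj₁ u~v) = indG _ _
    (∈support⁺ qs (∈concat⁻ qs ≡.refl x∈)) (∈support⁺ qs (∈concat⁻ qs ≡.refl y∈)) u~v
  independent-concat indG indH x y x∈ y∈ (inj₂ (u≡v , i~j)) = indH _ _ _
    (∈concat⁻ qs ≡.refl x∈) (∈concat⁻ qs (≡.cong (_, _) (≡.sym u≡v)) y∈) i~j

∣++∣ : ∀ {m n} (q : Subset m) (p : Subset n) → ∣ q Vec.++ p ∣ ≡ ∣ q ∣ ℕ.+ ∣ p ∣
∣++∣ []          p = ≡.refl
∣++∣ (true ∷ q)  p = ≡.cong suc (∣++∣ q p)
∣++∣ (false ∷ q) p = ∣++∣ q p

∈-independentSets⇒independent : ∀ G {p} → p ∈ₗ independentSets G → Independent G p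
∈-independentSets⇒independent G p∈ = proj₂ (∈-filter⁻ (independent? G) {xs = allSubsets (order G)} p∈)

maximum-attained : ∀ G → 0 ℕ.< independenceNumber G →
                   ∃ λ p → p ∈ₗ independentSets G × ∣ p ∣ ≡ independenceNumber G
maximum-attained G α>0 with foldr-selective ℕ.⊔-sel 0 (map ∣_∣ (independentSets G))
-- This alternative is the seed 0 of the fold, excluded by positivity.
... | inj₁ α≡0 = contradiction (≡.sym α≡0) (ℕ.<⇒≢ α>0)
... | inj₂ α∈  with ∈-map⁻ ∣_∣ α∈
...   | p , p∈ , α≡∣p∣ = p , p∈ , ≡.sym α≡∣p∣

independenceNumber≤order : ∀ G → 0 ℕ.< independenceNumber G → independenceNumber G ℕ.≤ order G
independenceNumber≤order G α>0 with maximum-attained G α>0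
... | p , _ , ∣p∣≡α = ≡.subst (ℕ._≤ order G) ∣p∣≡α (∣p∣≤n p)

-- Puts the leading coefficient of the independence polynomial in the form `suc k`, cancelable in
-- characteristic zero.
leadingCount-positive : ∀ G → 0 ℕ.< independenceNumber G →
                        ∃ λ k → independentCount G (independenceNumber G) ≡ suc k
leadingCount-positive G α>0 with maximum-attained G α>0
... | p , p∈ , ∣p∣≡α = ℕ.pred count , ≡.sym (ℕ.suc-pred count {{ℕ.>-nonZero
  (∈-length (∈-filter⁺ (λ p → ∣ p ∣ ℕ.≟ independenceNumber G) p∈ ∣p∣≡α))}})
  where count = independentCount G (independenceNumber G)

full⇒edgeless : ∀ G → 0 ℕ.< independenceNumber G → independenceNumber G ≡ order G → ∀ u v → ¬ Adj G u v
full⇒edgeless G α>0 α≡n u v with maximum-attained G α>0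
... | p , p∈ , ∣p∣≡α = ∈-independentSets⇒independent G p∈ u v (∈p u) (∈p v)
  where
  ∈p : ∀ x → x ∈ p
  ∈p x = ≡.subst (x ∈_) (≡.sym (∣p∣≡n⇒p≡⊤ (≡.trans ∣p∣≡α α≡n))) ∈⊤

-- Independence polynomials as sums over subsets

module IndependencePolynomials (R : CommutativeRing 0ℓ 0ℓ) where
  open CommutativeRing R renaming (Carrier to C) hiding (zero)
  open IntegerSolver R using (solve; _:=_; _:+_; _:*_; _:-_; :-_; con)
  open Polynomials R
  open SemiringMult semiring using (×-congʳ; ×-assoc-*) renaming (_×_ to _×′_)
  open SemiringExp semiring using (_^_; ^-congˡ; ^-homo-*; ^-assocʳ)
  open SemiringSum semiring using (sum; sum-cong-≋; sum-replicate-zero; ∑-distrib-+; *-distribˡ-sum)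
  open SetoidReasoning setoid

  private variable
    A B : Set

  ∑ : List A → (A → C) → C
  ∑ []       f = 0#
  ∑ (x ∷ xs) f = f x + ∑ xs f

  ∑-cong : ∀ (xs : List A) {f g} → (∀ x → f x ≈ g x) → ∑ xs f ≈ ∑ xs g
  ∑-cong []       f≈g = refl
  ∑-cong (x ∷ xs) f≈g = +-cong (f≈g x) (∑-cong xs f≈g)

  ∑-++ : ∀ (xs ys : List A) f → ∑ (xs ++ ys) f ≈ ∑ xs f + ∑ ys f
  ∑-++ []       ys f = sym (+-identityˡ _)
  ∑-++ (x ∷ xs) ys f = trans (+-congˡ (∑-++ xs ys f)) (sym (+-assoc _ _ _))

  ∑-map : ∀ (h : A → B) xs f → ∑ (map h xs) f ≈ ∑ xs (f ∘ h)
  ∑-map h []       f = refl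
  ∑-map h (x ∷ xs) f = +-congˡ (∑-map h xs f)

  ∑-*ˡ : ∀ k (xs : List A) f → ∑ xs (λ x → k * f x) ≈ k * ∑ xs f
  ∑-*ˡ k []       f = sym (zeroʳ k)
  ∑-*ˡ k (x ∷ xs) f = trans (+-congˡ (∑-*ˡ k xs f)) (sym (distribˡ k _ _))

  ∑-zero : ∀ (xs : List A) → ∑ xs (λ _ → 0#) ≈ 0#
  ∑-zero []       = refl
  ∑-zero (x ∷ xs) = trans (+-identityˡ _) (∑-zero xs)

  ∑-filter : ∀ {P : A → Set} (P? : Decidable P) xs f →
             ∑ (filter P? xs) f ≈ ∑ xs (λ x → if does (P? x) then f x else 0#)
  ∑-filter P? []       f = refl
  ∑-filter P? (x ∷ xs) f with does (P? x)
  ... | true  = +-congˡ (∑-filter P? xs f)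
  ... | false = trans (∑-filter P? xs f) (sym (+-identityˡ _))

  ∑-allSubsets-suc : ∀ n f → ∑ (allSubsets (suc n)) f
                   ≈ ∑ (allSubsets n) (f ∘ (true ∷_)) + ∑ (allSubsets n) (f ∘ (false ∷_))
  ∑-allSubsets-suc n f = trans (∑-++ (map (true ∷_) (allSubsets n)) (map (false ∷_) (allSubsets n)) f)
    (+-cong (∑-map _ (allSubsets n) f) (∑-map _ (allSubsets n) f))

  ∑-allSubsets-+ : ∀ m n f → ∑ (allSubsets (m ℕ.+ n)) f
                 ≈ ∑ (allSubsets m) (λ q → ∑ (allSubsets n) (λ p → f (q Vec.++ p)))
  ∑-allSubsets-+ zero    n f = sym (+-identityʳ _)
  ∑-allSubsets-+ (suc m) n f = begin
    ∑ (allSubsets (suc m ℕ.+ n)) f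
      ≈⟨ ∑-allSubsets-suc (m ℕ.+ n) f ⟩
    ∑ (allSubsets (m ℕ.+ n)) (f ∘ (true ∷_)) + ∑ (allSubsets (m ℕ.+ n)) (f ∘ (false ∷_))
      ≈⟨ +-cong (∑-allSubsets-+ m n _) (∑-allSubsets-+ m n _) ⟩
    ∑ (allSubsets m) (λ q → ∑ (allSubsets n) (λ p → f (true ∷ q Vec.++ p)))
      + ∑ (allSubsets m) (λ q → ∑ (allSubsets n) (λ p → f (false ∷ q Vec.++ p)))
      ≈⟨ ∑-allSubsets-suc m _ ⟨
    ∑ (allSubsets (suc m)) (λ q → ∑ (allSubsets n) (λ p → f (q Vec.++ p))) ∎

  -- The correction term comes from ⊥, the only block that is not occupied.
  ∑-occupied : ∀ m (g : Bool → C) (w : Subset m → C) →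
    ∑ (allSubsets m) (λ q → g (occupied q) * w q)
      ≈ g true * ∑ (allSubsets m) w + (g false - g true) * w ⊥
  ∑-occupied zero g w = solve 3 (λ x y w →
    y :* w :+ con ℤ.0ℤ := x :* (w :+ con ℤ.0ℤ) :+ (y :- x) :* w) refl (g true) (g false) (w [])
  ∑-occupied (suc m) g w = begin
    ∑ (allSubsets (suc m)) (λ q → g (occupied q) * w q)
      ≈⟨ ∑-allSubsets-suc m _ ⟩
    ∑ (allSubsets m) (λ q → g true * w (true ∷ q)) + ∑ (allSubsets m) (λ q → g (occupied q) * w (false ∷ q))
      ≈⟨ +-cong (∑-*ˡ (g true) (allSubsets m) _) (∑-occupied m g (w ∘ (false ∷_))) ⟩
    g true * S₁ + (g true * S₀ + (g false - g true) * w ⊥)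
      ≈⟨ solve 4 (λ t x y z → t :* x :+ (t :* y :+ z) := t :* (x :+ y) :+ z) refl (g true) S₁ S₀ _ ⟩
    g true * (S₁ + S₀) + (g false - g true) * w ⊥
      ≈⟨ +-congʳ (*-congˡ (∑-allSubsets-suc m w)) ⟨
    g true * ∑ (allSubsets (suc m)) w + (g false - g true) * w ⊥ ∎
    where
    S₁ = ∑ (allSubsets m) (w ∘ (true ∷_))
    S₀ = ∑ (allSubsets m) (w ∘ (false ∷_))

  ∏ : ∀ {n} → (A → C) → Vec A n → C
  ∏ w []       = 1#
  ∏ w (x ∷ xs) = w x * ∏ w xs

  -- Over a single block the nonempty choices have total weight `J`, all of the weight except w ⊥ =
  -- 1, and the empty choice has weight 1; each vertex of the support thus yields one factor J. `F`
  -- is arbitrary so that the induction can absorb the weight of the first block.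
  ∑-concat : ∀ m n (w : Subset m → C) (f : Subset (n ℕ.* m) → C) (F : Subset n → C) → w ⊥ ≈ 1# →
    (∀ qs → f (concat qs) ≈ F (support qs) * ∏ w qs) →
    ∑ (allSubsets (n ℕ.* m)) f ≈ ∑ (allSubsets n) (λ p → F p * (∑ (allSubsets m) w - 1#) ^ ∣ p ∣)
  ∑-concat m zero w f F w⊥ f≈ = +-congʳ (f≈ [])
  ∑-concat m (suc n) w f F w⊥ f≈ = begin
    ∑ (allSubsets (m ℕ.+ n ℕ.* m)) f
      ≈⟨ ∑-allSubsets-+ m (n ℕ.* m) f ⟩
    ∑ (allSubsets m) (λ q → ∑ (allSubsets (n ℕ.* m)) (λ p → f (q Vec.++ p)))
      ≈⟨ ∑-cong (allSubsets m) (λ q → trans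
           (∑-concat m n w (λ p → f (q Vec.++ p)) (λ p → w q * F (occupied q ∷ p)) w⊥ (λ qs →
             trans (f≈ (q ∷ qs)) (solve 3 (λ f w p → f :* (w :* p) := (w :* f) :* p) refl _ _ _)))
           (trans (∑-cong (allSubsets n) (λ p → *-assoc _ _ _))
             (trans (∑-*ˡ (w q) (allSubsets n) _) (*-comm _ _)))) ⟩
    ∑ (allSubsets m) (λ q → g (occupied q) * w q)
      ≈⟨ ∑-occupied m g w ⟩
    g true * ∑ (allSubsets m) w + (g false - g true) * w ⊥
      ≈⟨ +-congˡ (*-congˡ w⊥) ⟩
    g true * ∑ (allSubsets m) w + (g false - g true) * 1#
      ≈⟨ solve 3 (λ t f s → t :* s :+ (f :- t) :* con ℤ.1ℤ := (s :- con ℤ.1ℤ) :* t :+ f)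
           refl (g true) (g false) (∑ (allSubsets m) w) ⟩
    J * g true + g false
      ≈⟨ +-congʳ (trans (sym (∑-*ˡ J (allSubsets n) _)) (∑-cong (allSubsets n) λ p →
           solve 3 (λ j f x → j :* (f :* x) := f :* (j :* x)) refl _ _ _)) ⟩
    ∑ (allSubsets n) (λ p → F (true ∷ p) * (J * J ^ ∣ p ∣)) + g false
      ≈⟨ ∑-allSubsets-suc n _ ⟨
    ∑ (allSubsets (suc n)) (λ p → F p * J ^ ∣ p ∣) ∎
    where
    J = ∑ (allSubsets m) w - 1#
    g : Bool → C
    g b = ∑ (allSubsets n) (λ p → F (b ∷ p) * J ^ ∣ p ∣)

  if-yes : ∀ {P : Set} (P? : Dec P) {x : C} → P → (if does P? then x else 0#) ≈ x
  if-yes P? p = reflexive (≡.cong (if_then _ else _) (dec-true P? p))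

  if-no : ∀ {P : Set} (P? : Dec P) {x : C} → ¬ P → (if does P? then x else 0#) ≈ 0#
  if-no P? ¬p = reflexive (≡.cong (if_then _ else _) (dec-false P? ¬p))

  weight : ∀ G → C → Subset (order G) → C
  weight G z p = if does (independent? G p) then z ^ ∣ p ∣ else 0#

  -- Summing over all subsets, with weight zero off the independent ones, preserves the recursion of
  -- `allSubsets`; `independencePolynomial≈I` recovers the form by coefficients.
  I : Graph → C → C
  I G z = ∑ (allSubsets (order G)) (weight G z)

  ⊥-independent : ∀ G → Independent G ⊥
  ⊥-independent G u v u∈⊥ = contradiction u∈⊥ ∉⊥

  ∣⊥∣≡0 : ∀ n → ∣ ⊥ {n} ∣ ≡ 0
  ∣⊥∣≡0 zero    = ≡.refl
  ∣⊥∣≡0 (suc n) = ∣⊥∣≡0 n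

  weight-⊥ : ∀ G z → weight G z ⊥ ≈ 1#
  weight-⊥ G z = trans (if-yes (independent? G ⊥) (⊥-independent G))
    (reflexive (≡.cong (z ^_) (∣⊥∣≡0 (order G))))

  ∏-weight : ∀ G z {n} (qs : Vec (Subset (order G)) n) →
    ((∀ i → Independent G (lookup qs i)) × ∏ (weight G z) qs ≈ z ^ ∣ concat qs ∣)
    ⊎ (¬ (∀ i → Independent G (lookup qs i)) × ∏ (weight G z) qs ≈ 0#)
  ∏-weight G z [] = inj₁ ((λ ()) , refl)
  ∏-weight G z (q ∷ qs) with independent? G q | ∏-weight G z qs
  ... | yes indq | inj₁ (inds , ∏≈) = inj₁ ((λ { zero → indq ; (suc i) → inds i }) ,
    trans (*-cong (if-yes (independent? G q) indq) ∏≈) (trans (sym (^-homo-* z ∣ q ∣ ∣ concat qs ∣))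
      (reflexive (≡.cong (z ^_) (≡.sym (∣++∣ q (concat qs)))))))
  ... | yes indq | inj₂ (¬inds , ∏≈) = inj₂ ((λ inds → ¬inds (inds ∘ suc)) , trans (*-congˡ ∏≈) (zeroʳ _))
  ... | no ¬indq | _ = inj₂ ((λ inds → ¬indq (inds zero)) ,
    trans (*-congʳ (if-no (independent? G q) ¬indq)) (zeroˡ _))

  weight-concat : ∀ G H z qs → weight (G ⟦ H ⟧) z (concat qs)
    ≈ (if does (independent? G (support qs)) then 1# else 0#) * ∏ (weight H z) qs
  weight-concat G H z qs = cases (independent? (G ⟦ H ⟧) (concat qs)) (∏-weight H z qs)
    where
    cases : Dec (Independent (G ⟦ H ⟧) (concat qs)) → _ → _
    cases (yes ind) (inj₁ (_ , ∏≈)) = trans (if-yes (independent? (G ⟦ H ⟧) (concat qs)) ind)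
      (trans (sym (*-identityˡ _))
        (*-cong (sym (if-yes (independent? G (support qs)) (independent-support G H qs ind))) (sym ∏≈)))
    cases (yes ind) (inj₂ (¬inds , _)) = contradiction (independent-blocks G H qs ind) ¬inds
    cases (no ¬ind) (inj₂ (_ , ∏≈)) = trans (if-no (independent? (G ⟦ H ⟧) (concat qs)) ¬ind)
      (sym (trans (*-congˡ ∏≈) (zeroʳ _)))
    cases (no ¬ind) (inj₁ (inds , _)) = trans (if-no (independent? (G ⟦ H ⟧) (concat qs)) ¬ind)
      (sym (trans (*-congʳ (if-no (independent? G (support qs))
        λ indG → ¬ind (independent-concat G H qs indG inds))) (zeroˡ _)))

  I-lex : ∀ G H z → I (G ⟦ H ⟧) z ≈ I G (I H z - 1#)
  I-lex G H z = trans
    (∑-concat (order H) (order G) (weight H z) (weight (G ⟦ H ⟧) z)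
      (λ p → if does (independent? G p) then 1# else 0#) (weight-⊥ H z) (weight-concat G H z))
    (∑-cong (allSubsets (order G)) λ p → indicator (does (independent? G p)) _)
    where
    indicator : ∀ b x → (if b then 1# else 0#) * x ≈ (if b then x else 0#)
    indicator true  x = *-identityˡ x
    indicator false x = zeroˡ x

  -- Only the empty set contributes, through 0^0 = 1.
  ∑-subsets-at-0 : ∀ n (ok : Subset n → Bool) → ok ⊥ ≡ true →
    ∑ (allSubsets n) (λ p → if ok p then 0# ^ ∣ p ∣ else 0#) ≈ 1#
  ∑-subsets-at-0 zero ok ok⊥ rewrite ok⊥ = +-identityʳ _
  ∑-subsets-at-0 (suc n) ok ok⊥ = begin
    ∑ (allSubsets (suc n)) (λ p → if ok p then 0# ^ ∣ p ∣ else 0#)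
      ≈⟨ ∑-allSubsets-suc n _ ⟩
    ∑ (allSubsets n) (λ p → if ok (true ∷ p) then 0# * 0# ^ ∣ p ∣ else 0#)
      + ∑ (allSubsets n) (λ p → if ok (false ∷ p) then 0# ^ ∣ p ∣ else 0#)
      ≈⟨ +-cong (trans (∑-cong (allSubsets n) (λ p → vanish (ok (true ∷ p)) _)) (∑-zero (allSubsets n)))
                (∑-subsets-at-0 n (ok ∘ (false ∷_)) ok⊥) ⟩
    0# + 1#  ≈⟨ +-identityˡ 1# ⟩
    1#       ∎
    where
    vanish : ∀ b x → (if b then 0# * x else 0#) ≈ 0#
    vanish true  x = zeroˡ x
    vanish false x = refl

  ∑-subsets-isPolynomial : ∀ {n} (xs : List (Subset n)) (ok : Subset n → Bool) →
    IsPolynomial (λ z → ∑ xs (λ p → if ok p then z ^ ∣ p ∣ else 0#))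
  ∑-subsets-isPolynomial []       ok = const-isPolynomial 0#
  ∑-subsets-isPolynomial (p ∷ xs) ok =
    +-isPolynomial (term (ok p)) (∑-subsets-isPolynomial xs ok)
    where
    identity-isPolynomial : IsPolynomial (λ z → z)
    identity-isPolynomial = isPolynomial-resp
      (λ z → solve 1 (λ z → z := z :- con ℤ.0ℤ) refl z) (linear-isPolynomial 0#)

    term : ∀ b → IsPolynomial (λ z → if b then z ^ ∣ p ∣ else 0#)
    term true  = ^-isPolynomial ∣ p ∣ identity-isPolynomial
    term false = const-isPolynomial 0#

  -- `ok` is arbitrary because fixing the membership of the first vertex turns independence into
  -- another predicate on the remaining ones. Sets through that vertex contribute z h(z), where h(0)
  -- = 1 stems from its singleton; so f(0) counts the singletons.
  ∑-subsets-expansion : ∀ n (ok : Subset n → Bool) → ok ⊥ ≡ true → (∀ i → ok ⁅ i ⁆ ≡ true) →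
    ∃ λ f → IsPolynomial f × f 0# ≈ n ×′ 1# ×
            (∀ z → ∑ (allSubsets n) (λ p → if ok p then z ^ ∣ p ∣ else 0#) ≈ 1# + z * f z)
  ∑-subsets-expansion zero ok ok⊥ _ = (λ _ → 0#) , const-isPolynomial 0# , refl , expansion
    where
    expansion : ∀ z → (if ok [] then 1# else 0#) + 0# ≈ 1# + z * 0#
    expansion z rewrite ok⊥ = +-congˡ (sym (zeroʳ z))
  ∑-subsets-expansion (suc n) ok ok⊥ ok⁅⁆
    with ∑-subsets-expansion n (ok ∘ (false ∷_)) ok⊥ (ok⁅⁆ ∘ suc)
  ... | f , pf , f0 , f≈ =
    (λ z → h z + f z) ,
    +-isPolynomial (∑-subsets-isPolynomial (allSubsets n) (ok ∘ (true ∷_))) pf ,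
    +-cong (∑-subsets-at-0 n (ok ∘ (true ∷_)) (ok⁅⁆ zero)) f0 ,
    λ z → begin
      ∑ (allSubsets (suc n)) (λ p → if ok p then z ^ ∣ p ∣ else 0#)
        ≈⟨ ∑-allSubsets-suc n _ ⟩
      ∑ (allSubsets n) (λ p → if ok (true ∷ p) then z * z ^ ∣ p ∣ else 0#)
        + ∑ (allSubsets n) (λ p → if ok (false ∷ p) then z ^ ∣ p ∣ else 0#)
        ≈⟨ +-cong (trans (∑-cong (allSubsets n) (λ p → pull (ok (true ∷ p)) z _)) (∑-*ˡ z (allSubsets n) _))
                  (f≈ z) ⟩
      z * h z + (1# + z * f z)
        ≈⟨ solve 3 (λ z h f → z :* h :+ (con ℤ.1ℤ :+ z :* f) := con ℤ.1ℤ :+ z :* (h :+ f)) refl z (h z) (f z) ⟩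
      1# + z * (h z + f z) ∎
    where
    h : C → C
    h z = ∑ (allSubsets n) (λ p → if ok (true ∷ p) then z ^ ∣ p ∣ else 0#)

    pull : ∀ b z x → (if b then z * x else 0#) ≈ z * (if b then x else 0#)
    pull true  z x = refl
    pull false z x = sym (zeroʳ z)

  I-expansion : ∀ G → ∃ λ f → IsPolynomial f × f 0# ≈ order G ×′ 1# × (∀ z → I G z ≈ 1# + z * f z)
  I-expansion G = ∑-subsets-expansion (order G) (does ∘ independent? G)
    (dec-true (independent? G ⊥) (⊥-independent G))
    (λ i → dec-true (independent? G ⁅ i ⁆) (⁅⁆-independent i))
    where
    ⁅⁆-independent : ∀ i → Independent G ⁅ i ⁆
    ⁅⁆-independent i u v u∈ v∈ = irrefl G (≡.trans (x∈⁅y⁆⇒x≡y i u∈) (≡.sym (x∈⁅y⁆⇒x≡y i v∈)))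

  I-edgeless : ∀ G → (∀ u v → ¬ Adj G u v) → ∀ z → I G z ≈ (z + 1#) ^ order G
  I-edgeless G edgeless z = trans
    (∑-cong (allSubsets (order G)) λ p → if-yes (independent? G p) λ u v _ _ → edgeless u v)
    (binomial (order G))
    where
    binomial : ∀ n → ∑ (allSubsets n) (λ p → z ^ ∣ p ∣) ≈ (z + 1#) ^ n
    binomial zero    = +-identityʳ 1#
    binomial (suc n) = begin
      ∑ (allSubsets (suc n)) (λ p → z ^ ∣ p ∣)
        ≈⟨ ∑-allSubsets-suc n _ ⟩
      ∑ (allSubsets n) (λ p → z * z ^ ∣ p ∣) + ∑ (allSubsets n) (λ p → z ^ ∣ p ∣)
        ≈⟨ +-cong (trans (∑-*ˡ z (allSubsets n) _) (*-congˡ (binomial n))) (binomial n) ⟩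
      z * (z + 1#) ^ n + (z + 1#) ^ n
        ≈⟨ solve 2 (λ z x → z :* x :+ x := (z :+ con ℤ.1ℤ) :* x) refl z _ ⟩
      (z + 1#) ^ suc n ∎

  sum-poly : ∀ d (a : ℕ → C) → Poly d (a d) (λ z → sum {suc d} (λ i → a (toℕ i) * z ^ toℕ i))
  sum-poly zero    a z = trans (+-identityʳ _) (*-identityʳ _)
  sum-poly (suc d) a = a 0 , _ , sum-poly d (a ∘ suc) , λ z → +-cong (*-identityʳ _) (begin
    sum {suc d} (λ i → a (suc (toℕ i)) * (z * z ^ toℕ i))
      ≈⟨ sum-cong-≋ {suc d} (λ i → solve 3 (λ a z x → a :* (z :* x) := z :* (a :* x)) refl
           (a (suc (toℕ i))) z (z ^ toℕ i)) ⟩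
    sum {suc d} (λ i → z * (a (suc (toℕ i)) * z ^ toℕ i))
      ≈⟨ *-distribˡ-sum {suc d} z (λ i → a (suc (toℕ i)) * z ^ toℕ i) ⟨
    z * sum {suc d} (λ i → a (suc (toℕ i)) * z ^ toℕ i) ∎)

  sum-indicator : ∀ N k (f : ℕ → C) → k ℕ.< N →
    sum {N} (λ i → if does (k ℕ.≟ toℕ i) then f (toℕ i) else 0#) ≈ f k
  sum-indicator (suc N) zero    f _ = trans (+-congˡ (sum-replicate-zero N)) (+-identityʳ _)
  sum-indicator (suc N) (suc k) f (ℕ.s≤s k<N) = trans (+-identityˡ _) (sum-indicator N k (f ∘ suc) k<N)

  -- Double counting: `x` contributes at the single index `size x`, which lies below `N`.
  sum-by-size : ∀ N (size : A → ℕ) xs (f : ℕ → C) → All (λ x → size x ℕ.< N) xs →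
    sum {N} (λ i → length (filter (λ x → size x ℕ.≟ toℕ i) xs) ×′ f (toℕ i)) ≈ ∑ xs (f ∘ size)
  sum-by-size N size []       f []        = sum-replicate-zero N
  sum-by-size N size (x ∷ xs) f (x< ∷ xs<) = begin
    sum {N} (λ i → length (filter (λ x → size x ℕ.≟ toℕ i) (x ∷ xs)) ×′ f (toℕ i))
      ≈⟨ sum-cong-≋ {N} (λ i → count-∷ (toℕ i)) ⟩
    sum {N} (λ i → (if does (size x ℕ.≟ toℕ i) then f (toℕ i) else 0#)
                   + length (filter (λ x → size x ℕ.≟ toℕ i) xs) ×′ f (toℕ i))
      ≈⟨ ∑-distrib-+ {N} _ _ ⟩
    sum {N} (λ i → if does (size x ℕ.≟ toℕ i) then f (toℕ i) else 0#)
      + sum {N} (λ i → length (filter (λ x → size x ℕ.≟ toℕ i) xs) ×′ f (toℕ i))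
      ≈⟨ +-cong (sum-indicator N (size x) f x<) (sum-by-size N size xs f xs<) ⟩
    f (size x) + ∑ xs (f ∘ size) ∎
    where
    count-∷ : ∀ i → length (filter (λ x → size x ℕ.≟ i) (x ∷ xs)) ×′ f i
      ≈ (if does (size x ℕ.≟ i) then f i else 0#) + length (filter (λ x → size x ℕ.≟ i) xs) ×′ f i
    count-∷ i with does (size x ℕ.≟ i)
    ... | true  = refl
    ... | false = sym (+-identityˡ _)

  independencePolynomial≈I : ∀ G z →
    sum {suc (independenceNumber G)} (λ i → independentCount G (toℕ i) ×′ z ^ toℕ i) ≈ I G z
  independencePolynomial≈I G z = trans
    (sum-by-size (suc (independenceNumber G)) ∣_∣ (independentSets G) (z ^_)
      (All.map ℕ.s≤s (≤-maximum ∣_∣ (independentSets G))))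
    (∑-filter (independent? G) (allSubsets (order G)) _)
    where
    ≤-maximum : ∀ (size : A → ℕ) xs → All (λ x → size x ℕ.≤ foldr ℕ._⊔_ 0 (map size xs)) xs
    ≤-maximum size []       = []
    ≤-maximum size (x ∷ xs) = ℕ.m≤m⊔n (size x) _
      ∷ All.map (λ le → ℕ.≤-trans le (ℕ.m≤n⊔m (size x) _)) (≤-maximum size xs)

  I-poly : ∀ G → Poly (independenceNumber G) (independentCount G (independenceNumber G) ×′ 1#) (I G)
  I-poly G = poly-resp (independenceNumber G)
    (λ z → trans (sym (independencePolynomial≈I G z)) (sum-cong-≋ {suc (independenceNumber G)} λ i →
      trans (×-congʳ (independentCount G (toℕ i)) (sym (*-identityˡ (z ^ toℕ i))))
            (sym (×-assoc-* (independentCount G (toℕ i)) 1# (z ^ toℕ i)))))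
    (sum-poly (independenceNumber G) (λ i → independentCount G i ×′ 1#))

  I-cong : ∀ G {z w} → z ≈ w → I G z ≈ I G w
  I-cong G = poly-cong (independenceNumber G) (I-poly G)

  -- `lexPower` adds its factor on the outside, but carrying roots from one power to the next
  -- requires peeling off the innermost factor. All factors being the same G, induction moves it
  -- inwards.
  I-lexPower-suc : ∀ G k z → I (lexPower G (suc k)) z ≈ I (lexPower G k) (I G z - 1#)
  I-lexPower-suc G zero    z = I-lex G G z
  I-lexPower-suc G (suc k) z = begin
    I (G ⟦ lexPower G (suc k) ⟧) z                     ≈⟨ I-lex G (lexPower G (suc k)) z ⟩
    I G (I (lexPower G (suc k)) z - 1#)                ≈⟨ I-cong G (+-congʳ (I-lexPower-suc G k z)) ⟩
    I G (I (lexPower G k) (I G z - 1#) - 1#)           ≈⟨ I-lex G (lexPower G k) (I G z - 1#) ⟨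
    I (lexPower G (suc k)) (I G z - 1#)                ∎

  UniqueRoots : Graph → Set
  UniqueRoots G = ∀ k z w → I (lexPower G k) z ≈ 0# → I (lexPower G k) w ≈ 0# → z ≈ w

  affine⇒uniqueRoots : ∀ G a → (∀ z → I G z ≈ 1# + z * a) → UniqueRoots G
  affine⇒uniqueRoots G a affine k z w z-root w-root with affine-power k
    where
    affine-power : ∀ k → ∃ λ b → ∀ z → I (lexPower G k) z ≈ 1# + z * b
    affine-power zero = a , affine
    affine-power (suc k) with affine-power k
    ... | b , I≈ = b * a , λ z → begin
      I (lexPower G (suc k)) z          ≈⟨ I-lex G (lexPower G k) z ⟩
      I G (I (lexPower G k) z - 1#)     ≈⟨ affine _ ⟩
      1# + (I (lexPower G k) z - 1#) * a   ≈⟨ +-congˡ (*-congʳ (+-congʳ (I≈ z))) ⟩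
      1# + ((1# + z * b) - 1#) * a
        ≈⟨ solve 3 (λ z a b → con ℤ.1ℤ :+ ((con ℤ.1ℤ :+ z :* b) :- con ℤ.1ℤ) :* a
                           := con ℤ.1ℤ :+ z :* (b :* a)) refl z a b ⟩
      1# + z * (b * a) ∎
  -- `b` may fail to be cancelable; the combination (1 + w b) z - (1 + z b) w = z - w eliminates it.
  ... | b , I≈ = begin
    z                                            ≈⟨ solve 3 (λ z w b →
        z := (con ℤ.1ℤ :+ w :* b) :* z :- (con ℤ.1ℤ :+ z :* b) :* w :+ w) refl z w b ⟩
    (1# + w * b) * z - (1# + z * b) * w + w
      ≈⟨ +-congʳ (+-cong (*-congʳ (trans (sym (I≈ w)) w-root)) (-‿cong (*-congʳ (trans (sym (I≈ z)) z-root)))) ⟩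
    0# * z - 0# * w + w
      ≈⟨ solve 2 (λ z w → con ℤ.0ℤ :* z :- con ℤ.0ℤ :* w :+ w := w) refl z w ⟩
    w                                            ∎

  module _ (reduced : ∀ x → x * x ≈ 0# → x ≈ 0#) where

    ^≈0⇒≈0 : ∀ n x → x ^ n ≈ 0# → x ≈ 0#
    ^≈0⇒≈0 zero          x 1≈0   = trans (sym (*-identityʳ x)) (trans (*-congˡ 1≈0) (zeroʳ x))
    ^≈0⇒≈0 (suc zero)    x x1≈0  = trans (sym (*-identityʳ x)) x1≈0
    -- The square of x^(n+1) contains the factor x^(n+2) = 0, so the exponent drops by one.
    ^≈0⇒≈0 (suc (suc n)) x xxⁿ≈0 = ^≈0⇒≈0 (suc n) x (reduced (x * x ^ n) (begin
      (x * x ^ n) * (x * x ^ n)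
        ≈⟨ solve 2 (λ x y → (x :* y) :* (x :* y) := (x :* (x :* y)) :* y) refl x (x ^ n) ⟩
      (x * (x * x ^ n)) * x ^ n    ≈⟨ *-congʳ xxⁿ≈0 ⟩
      0# * x ^ n                   ≈⟨ zeroˡ _ ⟩
      0#                           ∎))

    edgeless⇒uniqueRoots : ∀ G → (∀ u v → ¬ Adj G u v) → UniqueRoots G
    edgeless⇒uniqueRoots G edgeless k z w z-root w-root with edgeless-power k
      where
      edgeless-power : ∀ k → ∃ λ n → ∀ z → I (lexPower G k) z ≈ (z + 1#) ^ n
      edgeless-power zero = order G , I-edgeless G edgeless
      edgeless-power (suc k) with edgeless-power k
      ... | n , I≈ = n ℕ.* order G , λ z → begin
        I (lexPower G (suc k)) z                       ≈⟨ I-lex G (lexPower G k) z ⟩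
        I G (I (lexPower G k) z - 1#)                  ≈⟨ I-edgeless G edgeless _ ⟩
        (I (lexPower G k) z - 1# + 1#) ^ order G
          ≈⟨ ^-congˡ (order G) (trans (solve 1 (λ x → x :- con ℤ.1ℤ :+ con ℤ.1ℤ := x) refl _) (I≈ z)) ⟩
        ((z + 1#) ^ n) ^ order G                       ≈⟨ ^-assocʳ (z + 1#) n (order G) ⟩
        (z + 1#) ^ (n ℕ.* order G)                     ∎
    ... | n , I≈ = begin
      z                          ≈⟨ solve 2 (λ z w → z := (z :+ con ℤ.1ℤ) :- (w :+ con ℤ.1ℤ) :+ w) refl z w ⟩
      (z + 1#) - (w + 1#) + w
        ≈⟨ +-congʳ (+-cong (^≈0⇒≈0 n _ (trans (sym (I≈ z)) z-root))
                           (-‿cong (^≈0⇒≈0 n _ (trans (sym (I≈ w)) w-root)))) ⟩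
      0# - 0# + w                ≈⟨ trans (+-congʳ (-‿inverseʳ 0#)) (+-identityˡ w) ⟩
      w                          ∎

  small-independenceNumber⇒uniqueRoots : ∀ G → independenceNumber G ℕ.≤ 1 → UniqueRoots G
  small-independenceNumber⇒uniqueRoots G α≤1 with independenceNumber G | I-poly G | I-expansion G
  ... | zero  | I≈a | f , _ , _ , I≈ = affine⇒uniqueRoots G 0# λ z → begin
    I G z              ≈⟨ trans (I≈a z) (sym (I≈a 0#)) ⟩
    I G 0#             ≈⟨ I≈ 0# ⟩
    1# + 0# * f 0#     ≈⟨ solve 2 (λ z f → con ℤ.1ℤ :+ con ℤ.0ℤ :* f := con ℤ.1ℤ :+ z :* con ℤ.0ℤ) refl z _ ⟩
    1# + z * 0#        ∎
  ... | suc zero | b , g , g≈a , I≈b | f , _ , _ , I≈ = affine⇒uniqueRoots G _ λ z → begin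
    I G z              ≈⟨ I≈b z ⟩
    b + z * g z        ≈⟨ +-cong b≈1 (*-congˡ (g≈a z)) ⟩
    1# + z * _         ∎
    where
    b≈1 : b ≈ 1#
    b≈1 = begin
      b                  ≈⟨ solve 2 (λ b g → b := b :+ con ℤ.0ℤ :* g) refl b (g 0#) ⟩
      b + 0# * g 0#      ≈⟨ I≈b 0# ⟨
      I G 0#             ≈⟨ I≈ 0# ⟩
      1# + 0# * f 0#     ≈⟨ solve 1 (λ f → con ℤ.1ℤ :+ con ℤ.0ℤ :* f := con ℤ.1ℤ) refl _ ⟩
      1#                 ∎
  ... | suc (suc _) | _ | _ with α≤1
  ...   | ℕ.s≤s ()

-- Excluding an invariant circle

module InvariantCircle (R : CommutativeRing 0ℓ 0ℓ) where
  open CommutativeRing R renaming (Carrier to C) hiding (zero)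
  open IntegerSolver R using (solve; _:=_; _:+_; _:*_; _:-_; :-_; con)
  open Polynomials R
  open IndependencePolynomials R
  open SemiringMult semiring using (×-congˡ) renaming (_×_ to _×′_)
  open SemiringExp semiring using (_^_)
  open SetoidReasoning setoid

  module _
    (conj : C → C)
    (conj-cong : ∀ {x y} → x ≈ y → conj x ≈ conj y)
    (conj-+ : ∀ x y → conj (x + y) ≈ conj x + conj y)
    (conj-* : ∀ x y → conj (x * y) ≈ conj x * conj y)
    (char0 : ∀ n → Cancelable (suc n ×′ 1#))
    (conj-char0 : ∀ n → Cancelable (conj (suc n ×′ 1#)))
    (c ρ : C) (ρ-cancelable : Cancelable ρ)
    (s : ℕ → C) (distinct : ∀ i j → i ℕ.< j → Cancelable (s j - s i))
    (on-circle : ∀ i → (s i - c) * conj (s i - c) ≈ ρ)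
    where
    open ConstantModulus conj conj-cong conj-+ conj-* c ρ ρ-cancelable s distinct on-circle

    -- The conclusion is 1 = 0 rather than absurdity because an abstract ring may be trivial; for ℂ
    -- it is refuted by `1≄0`.
    no-invariant-circle : ∀ G → 2 ℕ.≤ independenceNumber G → independenceNumber G ℕ.< order G →
      (∀ i → ((I G (s i) - 1#) - c) * conj ((I G (s i) - 1#) - c) ≈ ρ) → 1# ≈ 0#
    no-invariant-circle G 2≤α α<n invariant
      with leadingCount-positive G (ℕ.<⇒≤ 2≤α) | ℕ.m≤n⇒∃[o]m+o≡n 2≤α | ℕ.m≤n⇒∃[o]m+o≡n α<n
    ... | m , count≡ | d , α≡ | k , n≡ = CharacteristicZero.no-monomial char0 d k f-poly
        (trans f0 (×-congˡ order≡))
        λ z → begin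
          z * f z
            ≈⟨ solve 2 (λ c x → x := c :+ ((con ℤ.1ℤ :+ x) :- con ℤ.1ℤ :- c)) refl c _ ⟩
          c + ((1# + z * f z) - 1# - c)              ≈⟨ +-congˡ (+-congʳ (+-congʳ (I≈ z))) ⟨
          c + ((I G z - 1#) - c)                     ≈⟨ +-congˡ (monomial z) ⟩
          c + suc m ×′ 1# * (z - c) ^ suc (suc d)    ∎
      where
      f = proj₁ (I-expansion G)
      f-poly = proj₁ (proj₂ (I-expansion G))
      f0 = proj₁ (proj₂ (proj₂ (I-expansion G)))
      I≈ = proj₂ (proj₂ (proj₂ (I-expansion G)))

      order≡ : order G ≡ suc (suc d) ℕ.+ suc k
      order≡ = ≡.trans (≡.sym n≡) (≡.trans (≡.cong (λ α → suc α ℕ.+ k) (≡.sym α≡))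
        (≡.sym (ℕ.+-suc (suc (suc d)) k)))

      leading : Poly (suc (suc d)) (suc m ×′ 1#) (I G)
      leading = ≡.subst₂ (λ α a → Poly α (a ×′ 1#) (I G)) (≡.sym α≡) count≡ (I-poly G)

      shifted : Poly (suc (suc d)) (suc m ×′ 1#) (λ z → (I G z - 1#) - c)
      shifted with leading
      ... | b , g , p , I≈b = (b - 1#) - c , g , p , λ z →
        trans (+-congʳ (+-congʳ (I≈b z)))
          (solve 4 (λ b z g c → (b :+ z :* g) :- con ℤ.1ℤ :- c := (b :- con ℤ.1ℤ) :- c :+ z :* g)
            refl b z (g z) c)

      monomial : ∀ z → (I G z - 1#) - c ≈ suc m ×′ 1# * (z - c) ^ suc (suc d)
      -- The descent starts with τ = 1 and σ = ρ, as P maps the sample points into the same circle.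
      monomial = constantModulus⇒monomial (suc (suc d)) 1# ρ shifted (conj-char0 m)
        cancelable-1 (λ i → trans (*-identityˡ _) (invariant i))

-- Comparison of semiring operations over two equalities

-- The semiring operations of Defs depend, as terms, on the equality of their raw
-- semiring, so those over _≈_ and over the record _≃_ below are only
-- propositionally equal.
module Agreement {A : Set} (_≈₁_ _≈₂_ : Rel A 0ℓ) (_⊕_ _⊗_ : Op₂ A) (o e : A) where
  S₁ S₂ : RawSemiring 0ℓ 0ℓ
  S₁ = record { _≈_ = _≈₁_ ; _+_ = _⊕_ ; _*_ = _⊗_ ; 0# = o ; 1# = e }
  S₂ = record { _≈_ = _≈₂_ ; _+_ = _⊕_ ; _*_ = _⊗_ ; 0# = o ; 1# = e }
  module M₁ = RawSemiringDefs S₁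
  module M₂ = RawSemiringDefs S₂

  ×-agrees : ∀ n z → n M₁.× z ≡ n M₂.× z
  ×-agrees zero    z = ≡.refl
  ×-agrees (suc n) z = ≡.cong (z ⊕_) (×-agrees n z)

  ^-agrees : ∀ z n → z M₁.^ n ≡ z M₂.^ n
  ^-agrees z zero    = ≡.refl
  ^-agrees z (suc n) = ≡.cong (z ⊗_) (^-agrees z n)

  sum-agrees : ∀ n {f g : Fin n → A} → (∀ i → f i ≡ g i) → M₁.sum f ≡ M₂.sum g
  sum-agrees zero    f≡g = ≡.refl
  sum-agrees (suc n) f≡g = ≡.cong₂ _⊕_ (f≡g zero) (sum-agrees n (f≡g ∘ suc))

  polynomial-agrees : ∀ n (a : ℕ → ℕ) z →
    M₁.sum {n} (λ i → a (toℕ i) M₁.× (z M₁.^ toℕ i))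
      ≡ M₂.sum {n} (λ i → a (toℕ i) M₂.× (z M₂.^ toℕ i))
  polynomial-agrees n a z = sum-agrees n λ i →
    ≡.trans (≡.cong (a (toℕ i) M₁.×_) (^-agrees z (toℕ i))) (×-agrees (a (toℕ i)) _)

module ℚ-Identities = Identities ℚ.+-*-commutativeRing

open Defs using (_≈_)

-- Null sequences and congruences for the reals

-- `x ≈ᵣ y` unfolds to `Null (difference x y)`, so each congruence reduces to a closure property of
-- null sequences.
Null : (ℕ → ℚ) → Set
Null s = ∀ ε → 0ℚ ℚ.< ε → ∃ λ N → ∀ n → N ℕ.≤ n → ℚ.∣ s n ∣ ℚ.< ε

opaque
  divide : ∀ {a} ε → 0ℚ ℚ.< a → 0ℚ ℚ.< ε → ∃ λ δ → 0ℚ ℚ.< δ × a ℚ.* δ ≡ ε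
  divide {a} ε a>0 ε>0 = ε ℚ.* ℚ.1/ a ,
    ℚ.positive⁻¹ _ {{ℚ.pos*pos⇒pos ε {{ℚ.positive ε>0}} (ℚ.1/ a) {{ℚ.1/pos⇒pos a}}}} ,
    ≡.trans (ℚ-Identities.x[yz]≈y[xz] a ε (ℚ.1/ a))
      (≡.trans (≡.cong (ε ℚ.*_) (ℚ.*-inverseʳ a)) (ℚ.*-identityʳ ε))
    where
    instance
      a-positive : ℚ.Positive a
      a-positive = ℚ.positive a>0
      a-nonZero : ℚ.NonZero a
      a-nonZero = ℚ.pos⇒nonZero a

  half : ∀ ε → 0ℚ ℚ.< ε → ∃ λ δ → 0ℚ ℚ.< δ × δ ℚ.+ δ ≡ ε
  half ε ε>0 = ½ ℚ.* ε ,
    ≡.subst (ℚ._< ½ ℚ.* ε) (ℚ.*-zeroʳ ½) (ℚ.*-monoʳ-<-pos ½ ε>0) ,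
    ≡.trans (≡.sym (ℚ.*-distribʳ-+ ε ½ ½)) (ℚ.*-identityˡ ε)

null-resp : ∀ s t → (∀ n → t n ≡ s n) → Null s → Null t
null-resp s t t≡s s-null ε ε>0 with s-null ε ε>0
... | N , small = N , λ n N≤n → ≡.subst (λ p → ℚ.∣ p ∣ ℚ.< ε) (≡.sym (t≡s n)) (small n N≤n)

null-0 : Null (λ _ → 0ℚ)
null-0 ε ε>0 = 0 , λ _ _ → ε>0

null-+ : ∀ s t → Null s → Null t → Null (λ n → s n ℚ.+ t n)
null-+ s t s-null t-null ε ε>0 with half ε ε>0
... | δ , δ>0 , δ+δ≡ε with s-null δ δ>0 | t-null δ δ>0
... | M , s-small | N , t-small = M ℕ.⊔ N , λ n MN≤n → begin-strict
  ℚ.∣ s n ℚ.+ t n ∣          ≤⟨ ℚ.∣p+q∣≤∣p∣+∣q∣ (s n) (t n) ⟩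
  ℚ.∣ s n ∣ ℚ.+ ℚ.∣ t n ∣    <⟨ ℚ.+-mono-< (s-small n (ℕ.m⊔n≤o⇒m≤o M N MN≤n))
                                            (t-small n (ℕ.m⊔n≤o⇒n≤o M N MN≤n)) ⟩
  δ ℚ.+ δ                    ≡⟨ δ+δ≡ε ⟩
  ε                          ∎
  where open ℚ.≤-Reasoning

null-neg : ∀ s → Null s → Null (λ n → ℚ.- s n)
null-neg s s-null ε ε>0 with s-null ε ε>0
... | N , small = N , λ n N≤n → ≡.subst (ℚ._< ε) (≡.sym (ℚ.∣-p∣≡∣p∣ (s n))) (small n N≤n)

null-* : ∀ s t → CauchyLemmas.EventuallyBounded s → Null t → Null (λ n → s n ℚ.* t n)
null-* s t (B , B>0 , M , s-bounded) t-null ε ε>0 with divide ε B>0 ε>0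
... | δ , δ>0 , Bδ≡ε with t-null δ δ>0
... | N , t-small = M ℕ.⊔ N , λ n MN≤n → begin-strict
  ℚ.∣ s n ℚ.* t n ∣          ≡⟨ ℚ.∣p*q∣≡∣p∣*∣q∣ (s n) (t n) ⟩
  ℚ.∣ s n ∣ ℚ.* ℚ.∣ t n ∣
    ≤⟨ ℚ.*-monoʳ-≤-nonNeg ℚ.∣ t n ∣ {{ℚ.nonNegative (ℚ.0≤∣p∣ (t n))}} (s-bounded n (ℕ.m⊔n≤o⇒m≤o M N MN≤n)) ⟩
  B ℚ.* ℚ.∣ t n ∣            <⟨ ℚ.*-monoʳ-<-pos B {{ℚ.positive B>0}} (t-small n (ℕ.m⊔n≤o⇒n≤o M N MN≤n)) ⟩
  B ℚ.* δ                    ≡⟨ Bδ≡ε ⟩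
  ε                          ∎
  where open ℚ.≤-Reasoning

difference : ℝ → ℝ → ℕ → ℚ
difference x y n = seq x n ℚ.- seq y n

≡⇒≈ᵣ : ∀ x y → (∀ n → seq x n ≡ seq y n) → x ≈ᵣ y
≡⇒≈ᵣ x y x≡y = null-resp (λ _ → 0ℚ) (difference x y)
  (λ n → ≡.trans (≡.cong (ℚ._- seq y n) (x≡y n)) (ℚ.+-inverseʳ (seq y n))) null-0

≈ᵣ-refl : ∀ x → x ≈ᵣ x
≈ᵣ-refl x = ≡⇒≈ᵣ x x (λ _ → ≡.refl)

≈ᵣ-sym : ∀ x y → x ≈ᵣ y → y ≈ᵣ x
≈ᵣ-sym x y x≈y = null-resp (λ n → ℚ.- difference x y n) (difference y x)
  (λ n → ℚ-Identities.neg-sub (seq x n) (seq y n)) (null-neg (difference x y) x≈y)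

≈ᵣ-trans : ∀ x y z → x ≈ᵣ y → y ≈ᵣ z → x ≈ᵣ z
≈ᵣ-trans x y z x≈y y≈z = null-resp (λ n → difference x y n ℚ.+ difference y z n) (difference x z)
  (λ n → ℚ-Identities.sub-via (seq x n) (seq y n) (seq z n))
  (null-+ (difference x y) (difference y z) x≈y y≈z)

+ᵣ-cong : ∀ x x′ y y′ → x ≈ᵣ x′ → y ≈ᵣ y′ → x +ᵣ y ≈ᵣ x′ +ᵣ y′
+ᵣ-cong x x′ y y′ x≈ y≈ = null-resp
  (λ n → difference x x′ n ℚ.+ difference y y′ n) (difference (x +ᵣ y) (x′ +ᵣ y′))
  (λ n → ℚ-Identities.sub-+ (seq x n) (seq x′ n) (seq y n) (seq y′ n))
  (null-+ (difference x x′) (difference y y′) x≈ y≈)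

-ᵣ-cong : ∀ x x′ → x ≈ᵣ x′ → -ᵣ x ≈ᵣ -ᵣ x′
-ᵣ-cong x x′ x≈ = null-resp (λ n → ℚ.- difference x x′ n) (difference (-ᵣ x) (-ᵣ x′))
  (λ n → ℚ-Identities.sub-neg (seq x n) (seq x′ n)) (null-neg (difference x x′) x≈)

*ᵣ-cong : ∀ x x′ y y′ → x ≈ᵣ x′ → y ≈ᵣ y′ → x *ᵣ y ≈ᵣ x′ *ᵣ y′
*ᵣ-cong x x′ y y′ x≈ y≈ = null-resp
  (λ n → seq x n ℚ.* difference y y′ n ℚ.+ seq y′ n ℚ.* difference x x′ n) (difference (x *ᵣ y) (x′ *ᵣ y′))
  (λ n → ℚ-Identities.sub-* (seq x n) (seq x′ n) (seq y n) (seq y′ n))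
  (null-+ (λ n → seq x n ℚ.* difference y y′ n) (λ n → seq y′ n ℚ.* difference x x′ n)
    (null-* (seq x) (difference y y′) (CauchyLemmas.eventually-bounded (seq x) (cauchy x)) y≈)
    (null-* (seq y′) (difference x x′) (CauchyLemmas.eventually-bounded (seq y′) (cauchy y′)) x≈))

-- The commutative ring of complex numbers

module ComplexRing where
  open Defs using (_+_; _*_; _-_; -_; 0#; 1#)

  -- Unlike _≈_, which unfolds, a record type determines its two sides.
  infix 4 _≃_
  record _≃_ (z w : ℂ) : Set where
    constructor ≃-intro
    field ≃⇒≈ : z ≈ w

  open _≃_ public

  -- The ring laws hold term by term for the representing rational sequences, and so pass to ℂ
  -- without any limit estimate.
  pointwise : ∀ z w → (∀ n → seq (re z) n ≡ seq (re w) n) → (∀ n → seq (im z) n ≡ seq (im w) n) → z ≃ w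
  pointwise z w p q = ≃-intro (≡⇒≈ᵣ (re z) (re w) p , ≡⇒≈ᵣ (im z) (im w) q)

  +-congruent : ∀ {z z′ w w′} → z ≃ z′ → w ≃ w′ → z + w ≃ z′ + w′
  +-congruent {z} {z′} {w} {w′} (≃-intro (p , q)) (≃-intro (p′ , q′)) = ≃-intro
    (+ᵣ-cong (re z) (re z′) (re w) (re w′) p p′ , +ᵣ-cong (im z) (im z′) (im w) (im w′) q q′)

  *-congruent : ∀ {z z′ w w′} → z ≃ z′ → w ≃ w′ → z * w ≃ z′ * w′
  *-congruent {z} {z′} {w} {w′} (≃-intro (p , q)) (≃-intro (p′ , q′)) = ≃-intro (
    +ᵣ-cong (re z *ᵣ re w) (re z′ *ᵣ re w′) (-ᵣ (im z *ᵣ im w)) (-ᵣ (im z′ *ᵣ im w′))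
      (*ᵣ-cong (re z) (re z′) (re w) (re w′) p p′)
      (-ᵣ-cong (im z *ᵣ im w) (im z′ *ᵣ im w′) (*ᵣ-cong (im z) (im z′) (im w) (im w′) q q′)) ,
    +ᵣ-cong (re z *ᵣ im w) (re z′ *ᵣ im w′) (im z *ᵣ re w) (im z′ *ᵣ re w′)
      (*ᵣ-cong (re z) (re z′) (im w) (im w′) p q′)
      (*ᵣ-cong (im z) (im z′) (re w) (re w′) q p′))

  *-associative : ∀ z w v → (z * w) * v ≃ z * (w * v)
  *-associative z w v = pointwise ((z * w) * v) (z * (w * v))
    (λ n → ℚ-Identities.re-*-assoc (seq (re z) n) (seq (im z) n) (seq (re w) n) (seq (im w) n)
                                     (seq (re v) n) (seq (im v) n))
    (λ n → ℚ-Identities.im-*-assoc (seq (re z) n) (seq (im z) n) (seq (re w) n) (seq (im w) n)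
                                     (seq (re v) n) (seq (im v) n))

  *-commutative : ∀ z w → z * w ≃ w * z
  *-commutative z w = pointwise (z * w) (w * z)
    (λ n → ℚ-Identities.re-*-comm (seq (re z) n) (seq (im z) n) (seq (re w) n) (seq (im w) n))
    (λ n → ℚ-Identities.im-*-comm (seq (re z) n) (seq (im z) n) (seq (re w) n) (seq (im w) n))

  *-identityL : ∀ z → 1# * z ≃ z
  *-identityL z = pointwise (1# * z) z
    (λ n → ℚ-Identities.re-*-identityˡ (seq (re z) n) (seq (im z) n))
    (λ n → ℚ-Identities.im-*-identityˡ (seq (re z) n) (seq (im z) n))

  *-distributesˡ : ∀ z w v → z * (w + v) ≃ z * w + z * v
  *-distributesˡ z w v = pointwise (z * (w + v)) (z * w + z * v)
    (λ n → ℚ-Identities.re-*-distribˡ (seq (re z) n) (seq (im z) n) (seq (re w) n) (seq (im w) n)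
                                     (seq (re v) n) (seq (im v) n))
    (λ n → ℚ-Identities.im-*-distribˡ (seq (re z) n) (seq (im z) n) (seq (re w) n) (seq (im w) n)
                                     (seq (re v) n) (seq (im v) n))

  ≃-isEquivalence : IsEquivalence _≃_
  ≃-isEquivalence = record
    { refl  = λ {z} → ≃-intro (≈ᵣ-refl (re z) , ≈ᵣ-refl (im z))
    ; sym   = λ {z} {w} (≃-intro (p , q)) → ≃-intro (≈ᵣ-sym (re z) (re w) p , ≈ᵣ-sym (im z) (im w) q)
    ; trans = λ {z} {w} {v} (≃-intro (p , q)) (≃-intro (p′ , q′)) →
        ≃-intro (≈ᵣ-trans (re z) (re w) (re v) p p′ , ≈ᵣ-trans (im z) (im w) (im v) q q′)
    }

  open IsEquivalence ≃-isEquivalence public using () renaming (refl to ≃-refl; sym to ≃-sym; trans to ≃-trans)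

  ℂ-setoid : Setoid 0ℓ 0ℓ
  ℂ-setoid = record { isEquivalence = ≃-isEquivalence }

  open Consequences ℂ-setoid using (comm∧idˡ⇒id; comm∧distrˡ⇒distr)

  opaque
    ℂ-isCommutativeRing : IsCommutativeRing _≃_ _+_ _*_ -_ 0# 1#
    ℂ-isCommutativeRing = record
      { isRing = record
        { +-isAbelianGroup = record
          { isGroup = record
            { isMonoid = record
              { isSemigroup = record
                { isMagma = record
                  { isEquivalence = ≃-isEquivalence
                  ; ∙-cong = λ {z} {z′} {w} {w′} → +-congruent {z} {z′} {w} {w′}
                  }
                ; assoc = λ z w v → pointwise (z + w + v) (z + (w + v))
                    (λ n → ℚ.+-assoc (seq (re z) n) (seq (re w) n) (seq (re v) n))
                    (λ n → ℚ.+-assoc (seq (im z) n) (seq (im w) n) (seq (im v) n))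
                }
              ; identity = (λ z → pointwise (0# + z) z
                  (λ n → ℚ.+-identityˡ (seq (re z) n)) (λ n → ℚ.+-identityˡ (seq (im z) n)))
                         , (λ z → pointwise (z + 0#) z
                               (λ n → ℚ.+-identityʳ (seq (re z) n)) (λ n → ℚ.+-identityʳ (seq (im z) n)))
              }
            ; inverse = (λ z → pointwise (- z + z) 0#
                (λ n → ℚ.+-inverseˡ (seq (re z) n)) (λ n → ℚ.+-inverseˡ (seq (im z) n)))
                      , (λ z → pointwise (z + - z) 0#
                            (λ n → ℚ.+-inverseʳ (seq (re z) n)) (λ n → ℚ.+-inverseʳ (seq (im z) n)))
            ; ⁻¹-cong = λ {z} {w} (≃-intro (p , q)) →
                ≃-intro (-ᵣ-cong (re z) (re w) p , -ᵣ-cong (im z) (im w) q)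
            }
          ; comm = λ z w → pointwise (z + w) (w + z)
              (λ n → ℚ.+-comm (seq (re z) n) (seq (re w) n)) (λ n → ℚ.+-comm (seq (im z) n) (seq (im w) n))
          }
        ; *-cong = λ {z} {z′} {w} {w′} → *-congruent {z} {z′} {w} {w′}
        ; *-assoc = *-associative
        ; *-identity = comm∧idˡ⇒id {_*_} *-commutative {1#} *-identityL
        ; distrib = comm∧distrˡ⇒distr {_*_} {_+_}
            (λ {z} {z′} {w} {w′} → +-congruent {z} {z′} {w} {w′})
            *-commutative *-distributesˡ
        }
      ; *-comm = *-commutative
      }

  infixl 6 _⊕_
  infixl 7 _⊛_
  infix  8 ⊖_

  -- Opaque, as unfolding ℂ down to the arithmetic of ℚ makes conversion infeasible.
  opaque
    _⊕_ _⊛_ : ℂ → ℂ → ℂ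
    _⊕_ = _+_
    _⊛_ = _*_

    ⊖_ : ℂ → ℂ
    ⊖_ = -_

    0ℂ 1ℂ : ℂ
    0ℂ = 0#
    1ℂ = 1#

    ⊕-⊛-isCommutativeRing : IsCommutativeRing _≃_ _⊕_ _⊛_ ⊖_ 0ℂ 1ℂ
    ⊕-⊛-isCommutativeRing = ℂ-isCommutativeRing

  ℂ-commutativeRing : CommutativeRing 0ℓ 0ℓ
  ℂ-commutativeRing = record { isCommutativeRing = ⊕-⊛-isCommutativeRing }

open ComplexRing
open CommutativeRing ℂ-commutativeRing using (_+_; _*_; _-_; -_; 0#; 1#; semiring)
module ℂ-Identities = Identities ℂ-commutativeRing
module ℂ-Poly = Polynomials ℂ-commutativeRing
open ℂ-Poly using (Poly; Cancelable; cancelable-*; cancelable-resp; cancelable-factor)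
open IndependencePolynomials ℂ-commutativeRing
  using (I; I-poly; I-lexPower-suc; UniqueRoots; independencePolynomial≈I;
         edgeless⇒uniqueRoots; small-independenceNumber⇒uniqueRoots)
module ℂ× = SemiringMult semiring

-- Order and squares in ℚ

0≤p*q : ∀ {p q} → 0ℚ ℚ.≤ p → 0ℚ ℚ.≤ q → 0ℚ ℚ.≤ p ℚ.* q
0≤p*q {p} {q} 0≤p 0≤q = ℚ.nonNegative⁻¹ (p ℚ.* q)
  {{ℚ.nonNeg*nonNeg⇒nonNeg p {{ℚ.nonNegative 0≤p}} q {{ℚ.nonNegative 0≤q}}}}

0<p*q : ∀ {p q} → 0ℚ ℚ.< p → 0ℚ ℚ.< q → 0ℚ ℚ.< p ℚ.* q
0<p*q {p} {q} 0<p 0<q = ℚ.positive⁻¹ (p ℚ.* q)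
  {{ℚ.pos*pos⇒pos p {{ℚ.positive 0<p}} q {{ℚ.positive 0<q}}}}

*-mono-≤ : ∀ {p p′ q q′} → 0ℚ ℚ.≤ p′ → 0ℚ ℚ.≤ q → p ℚ.≤ p′ → q ℚ.≤ q′ → p ℚ.* q ℚ.≤ p′ ℚ.* q′
*-mono-≤ {p} {p′} {q} {q′} 0≤p′ 0≤q p≤p′ q≤q′ = ℚ.≤-trans
  (ℚ.*-monoʳ-≤-nonNeg q {{ℚ.nonNegative 0≤q}} p≤p′) (ℚ.*-monoˡ-≤-nonNeg p′ {{ℚ.nonNegative 0≤p′}} q≤q′)

square-mono : ∀ e x → 0ℚ ℚ.< e → e ℚ.≤ x → e ℚ.* e ℚ.≤ x ℚ.* x
square-mono e x e>0 e≤x = *-mono-≤ {e} {x} {e} {x} (ℚ.≤-trans (ℚ.<⇒≤ e>0) e≤x) (ℚ.<⇒≤ e>0) e≤x e≤x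

p≤p+q : ∀ p {q} → 0ℚ ℚ.≤ q → p ℚ.≤ p ℚ.+ q
p≤p+q p {q} 0≤q = ≡.subst (ℚ._≤ p ℚ.+ q) (ℚ.+-identityʳ p) (ℚ.+-monoʳ-≤ p 0≤q)

p<p+q : ∀ p {q} → 0ℚ ℚ.< q → p ℚ.< p ℚ.+ q
p<p+q p {q} 0<q = ≡.subst (ℚ._< p ℚ.+ q) (ℚ.+-identityʳ p) (ℚ.+-monoʳ-< p 0<q)

∣p∣²≡p² : ∀ p → ℚ.∣ p ∣ ℚ.* ℚ.∣ p ∣ ≡ p ℚ.* p
∣p∣²≡p² p with ℚ.∣p∣≡p∨∣p∣≡-p p
... | inj₁ ∣p∣≡p  = ≡.cong₂ ℚ._*_ ∣p∣≡p ∣p∣≡p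
... | inj₂ ∣p∣≡-p = ≡.trans (≡.cong₂ ℚ._*_ ∣p∣≡-p ∣p∣≡-p) (ℚ-Identities.neg-*-neg p)

0≤p² : ∀ p → 0ℚ ℚ.≤ p ℚ.* p
0≤p² p = ≡.subst (0ℚ ℚ.≤_) (∣p∣²≡p² p) (0≤p*q (ℚ.0≤∣p∣ p) (ℚ.0≤∣p∣ p))

p≤∣p∣ : ∀ p → p ℚ.≤ ℚ.∣ p ∣
p≤∣p∣ p with ℚ.≤-total 0ℚ p
... | inj₁ 0≤p = ℚ.≤-reflexive (≡.sym (ℚ.0≤p⇒∣p∣≡p 0≤p))
... | inj₂ p≤0 = ℚ.≤-trans p≤0 (ℚ.0≤∣p∣ p)

p²<q²⇒∣p∣<q : ∀ p {q} → 0ℚ ℚ.≤ q → p ℚ.* p ℚ.< q ℚ.* q → ℚ.∣ p ∣ ℚ.< q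
p²<q²⇒∣p∣<q p {q} 0≤q p²<q² with q ℚ.≤? ℚ.∣ p ∣
... | no q≰∣p∣  = ℚ.≰⇒> q≰∣p∣
... | yes q≤∣p∣ = contradiction
  (ℚ.<-≤-trans p²<q² (ℚ.≤-trans (*-mono-≤ (ℚ.0≤∣p∣ p) 0≤q q≤∣p∣ q≤∣p∣) (ℚ.≤-reflexive (∣p∣²≡p² p))))
  (ℚ.<-irrefl ≡.refl)

x+[y-x]≡y : ∀ x y → x ℚ.+ (y ℚ.- x) ≡ y
x+[y-x]≡y = ℚ-Identities.x+[y-x]

x-0≡x : ∀ x → x ℚ.- 0ℚ ≡ x
x-0≡x = ℚ-Identities.x-0

swap-middle : ∀ p q e → (p ℚ.+ q) ℚ.+ e ≡ (p ℚ.+ e) ℚ.+ q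
swap-middle = ℚ-Identities.swap-middle

-- Half of the gap `g` pays for the perturbation; the other half remains as the new gap.
perturbed-bound : ∀ {p q d g B} → ℚ.∣ q ℚ.- p ∣ ℚ.< d → d ℚ.+ d ≡ g → p ℚ.+ g ℚ.≤ B → q ℚ.+ d ℚ.≤ B
perturbed-bound {p} {q} {d} {g} {B} close ≡.refl p+g≤B = begin
  q ℚ.+ d                        ≡⟨ ≡.cong (ℚ._+ d) (x+[y-x]≡y p q) ⟨
  (p ℚ.+ (q ℚ.- p)) ℚ.+ d
    ≤⟨ ℚ.+-monoˡ-≤ d (ℚ.+-monoʳ-≤ p (ℚ.≤-trans (p≤∣p∣ (q ℚ.- p)) (ℚ.<⇒≤ close))) ⟩
  (p ℚ.+ d) ℚ.+ d                ≡⟨ ℚ.+-assoc p d d ⟩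
  p ℚ.+ (d ℚ.+ d)                ≤⟨ p+g≤B ⟩
  B                              ∎
  where open ℚ.≤-Reasoning

sum-bound : ∀ {p q r g A B} → r ℚ.≤ (p ℚ.+ q) ℚ.+ (p ℚ.+ q) → p ℚ.+ g ℚ.≤ A → p ℚ.≤ A → q ℚ.≤ B →
            r ℚ.+ g ℚ.≤ (A ℚ.+ B) ℚ.+ (A ℚ.+ B)
sum-bound {p} {q} {r} {g} {A} {B} r≤ p+g≤A p≤A q≤B = begin
  r ℚ.+ g                              ≤⟨ ℚ.+-monoˡ-≤ g r≤ ⟩
  ((p ℚ.+ q) ℚ.+ (p ℚ.+ q)) ℚ.+ g      ≡⟨ ℚ.+-assoc (p ℚ.+ q) (p ℚ.+ q) g ⟩
  (p ℚ.+ q) ℚ.+ ((p ℚ.+ q) ℚ.+ g)      ≡⟨ ≡.cong ((p ℚ.+ q) ℚ.+_) (swap-middle p q g) ⟩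
  (p ℚ.+ q) ℚ.+ ((p ℚ.+ g) ℚ.+ q)      ≤⟨ ℚ.+-mono-≤ (ℚ.+-mono-≤ p≤A q≤B) (ℚ.+-mono-≤ p+g≤A q≤B) ⟩
  (A ℚ.+ B) ℚ.+ (A ℚ.+ B)              ∎
  where open ℚ.≤-Reasoning

product-bound : ∀ {p q r g A B} → r ≡ p ℚ.* q → 0ℚ ℚ.≤ p → 0ℚ ℚ.≤ B → p ℚ.+ g ℚ.≤ A → q ℚ.≤ B →
                r ℚ.+ g ℚ.* B ℚ.≤ A ℚ.* B
product-bound {p} {q} {r} {g} {A} {B} ≡.refl 0≤p 0≤B p+g≤A q≤B = begin
  p ℚ.* q ℚ.+ g ℚ.* B    ≤⟨ ℚ.+-monoˡ-≤ (g ℚ.* B) (ℚ.*-monoˡ-≤-nonNeg p {{ℚ.nonNegative 0≤p}} q≤B) ⟩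
  p ℚ.* B ℚ.+ g ℚ.* B    ≡⟨ ℚ.*-distribʳ-+ B p g ⟨
  (p ℚ.+ g) ℚ.* B        ≤⟨ ℚ.*-monoʳ-≤-nonNeg B {{ℚ.nonNegative 0≤B}} p+g≤A ⟩
  A ℚ.* B                ∎
  where open ℚ.≤-Reasoning

-- Squared moduli and strict bounds on them

opaque
  unfolding _⊕_

  norm : ℂ → ℕ → ℚ
  norm z = seq (normSq z)

  norm≡normSq : ∀ z n → norm z n ≡ seq (normSq z) n
  norm≡normSq z n = ≡.refl

  0≤norm : ∀ z n → 0ℚ ℚ.≤ norm z n
  0≤norm z n = ℚ.+-mono-≤ (0≤p² (seq (re z) n)) (0≤p² (seq (im z) n))

  norm-0# : ∀ n → norm 0# n ≡ 0ℚ
  norm-0# n = ≡.refl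

  re²≤norm : ∀ z n → seq (re z) n ℚ.* seq (re z) n ℚ.≤ norm z n
  re²≤norm z n = p≤p+q (seq (re z) n ℚ.* seq (re z) n) (0≤p² (seq (im z) n))

  im²≤norm : ∀ z n → seq (im z) n ℚ.* seq (im z) n ℚ.≤ norm z n
  im²≤norm z n = ≡.subst (seq (im z) n ℚ.* seq (im z) n ℚ.≤_)
    (ℚ.+-comm (seq (im z) n ℚ.* seq (im z) n) (seq (re z) n ℚ.* seq (re z) n))
    (p≤p+q (seq (im z) n ℚ.* seq (im z) n) (0≤p² (seq (re z) n)))

  norm-* : ∀ z w n → norm (z * w) n ≡ norm z n ℚ.* norm w n
  norm-* z w n = ℚ-Identities.norm-*-norm (seq (re z) n) (seq (im z) n) (seq (re w) n) (seq (im w) n)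

  -- The parallelogram law with the nonnegative term `norm (z - w) n` dropped.
  norm-+ : ∀ z w n → norm (z + w) n ℚ.≤ (norm z n ℚ.+ norm w n) ℚ.+ (norm z n ℚ.+ norm w n)
  norm-+ z w n = ℚ.≤-trans (p≤p+q (norm (z + w) n) (0≤norm (z - w) n))
    (ℚ.≤-reflexive (ℚ-Identities.parallelogram (seq (re z) n) (seq (im z) n) (seq (re w) n) (seq (im w) n)))

  components≈0⇒≃0 : ∀ z → re z ≈ᵣ 0ᵣ → im z ≈ᵣ 0ᵣ → z ≃ 0#
  components≈0⇒≃0 z p q = ≃-intro (p , q)

  norm-bounded : ∀ z → CauchyLemmas.EventuallyBounded (norm z)
  norm-bounded z = CauchyLemmas.eventually-bounded (norm z) (cauchy (normSq z))

  norm-cong : ∀ {z w} → z ≃ w → Null (λ n → norm z n ℚ.- norm w n)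
  norm-cong {z} {w} (≃-intro (p , q)) = +ᵣ-cong (re z *ᵣ re z) (re w *ᵣ re w) (im z *ᵣ im z) (im w *ᵣ im w)
    (*ᵣ-cong (re z) (re w) (re z) (re w) p p) (*ᵣ-cong (im z) (im w) (im z) (im w) q q)

norm-close : ∀ {z w} → z ≃ w → ∀ ε → 0ℚ ℚ.< ε →
             ∃ λ N → ∀ n → N ℕ.≤ n → ℚ.∣ norm w n ℚ.- norm z n ∣ ℚ.< ε
norm-close {z} {w} z≃w = norm-cong {w} {z} (≃-sym z≃w)

-- |z|² < B as real numbers.
infix 4 _⊏_
record _⊏_ (z : ℂ) (B : ℚ) : Set where
  constructor ⊏-intro
  field
    gap   : ℚ
    gap>0 : 0ℚ ℚ.< gap
    start : ℕ
    bound : ∀ n → start ℕ.≤ n → norm z n ℚ.+ gap ℚ.≤ B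

⊏⇒norm< : ∀ {z B} (z⊏B : z ⊏ B) n → _⊏_.start z⊏B ℕ.≤ n → norm z n ℚ.< B
⊏⇒norm< {z} (⊏-intro g g>0 N bound) n N≤n = ℚ.<-≤-trans (p<p+q (norm z n) g>0) (bound n N≤n)

⊏⇒0< : ∀ {z B} → z ⊏ B → 0ℚ ℚ.< B
⊏⇒0< {z} z⊏B = ℚ.≤-<-trans (0≤norm z _) (⊏⇒norm< z⊏B _ ℕ.≤-refl)

⊏-mono : ∀ {z A B} → A ℚ.≤ B → z ⊏ A → z ⊏ B
⊏-mono A≤B (⊏-intro g g>0 N bound) = ⊏-intro g g>0 N λ n N≤n → ℚ.≤-trans (bound n N≤n) A≤B

⊏-perturb : ∀ {z w B} → (∀ ε → 0ℚ ℚ.< ε → ∃ λ N → ∀ n → N ℕ.≤ n → ℚ.∣ norm w n ℚ.- norm z n ∣ ℚ.< ε) →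
            z ⊏ B → w ⊏ B
⊏-perturb {z} {w} {B} close (⊏-intro g g>0 M bound) with half g g>0
... | δ , δ>0 , δ+δ≡g with close δ δ>0
... | N , close-δ = ⊏-intro δ δ>0 (M ℕ.⊔ N) λ n MN≤n →
  perturbed-bound {norm z n} {norm w n} {δ} {g} {B}
    (close-δ n (ℕ.m⊔n≤o⇒n≤o M N MN≤n)) δ+δ≡g (bound n (ℕ.m⊔n≤o⇒m≤o M N MN≤n))

⊏-resp : ∀ {z w B} → z ≃ w → z ⊏ B → w ⊏ B
⊏-resp {z} {w} {B} z≃w = ⊏-perturb {z} {w} {B} (norm-close {z} {w} z≃w)

⊏-+ : ∀ {z w A B} → z ⊏ A → w ⊏ B → z + w ⊏ (A ℚ.+ B) ℚ.+ (A ℚ.+ B)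
⊏-+ {z} {w} {A} {B} z⊏A@(⊏-intro g g>0 M z-bound) w⊏B@(⊏-intro _ _ N _) =
  ⊏-intro g g>0 (M ℕ.⊔ N) λ n MN≤n →
    sum-bound {norm z n} {norm w n} {norm (z + w) n} {g} {A} {B} (norm-+ z w n)
    (z-bound n (ℕ.m⊔n≤o⇒m≤o M N MN≤n))
    (ℚ.<⇒≤ (⊏⇒norm< z⊏A n (ℕ.m⊔n≤o⇒m≤o M N MN≤n)))
    (ℚ.<⇒≤ (⊏⇒norm< w⊏B n (ℕ.m⊔n≤o⇒n≤o M N MN≤n)))

⊏-* : ∀ {z w A B} → z ⊏ A → w ⊏ B → z * w ⊏ A ℚ.* B
⊏-* {z} {w} {A} {B} (⊏-intro g g>0 M z-bound) w⊏B@(⊏-intro _ _ N _) =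
  -- From |z|² + g ≤ A and |w|² ≤ B the product is at most A B - g B, hence the new gap g B; it is
  -- positive because `w ⊏ B` forces B > 0.
  ⊏-intro (g ℚ.* B) (0<p*q g>0 (⊏⇒0< w⊏B)) (M ℕ.⊔ N) λ n MN≤n →
    product-bound {norm z n} {norm w n} {norm (z * w) n} {g} {A} {B}
      (norm-* z w n) (0≤norm z n) (ℚ.<⇒≤ (⊏⇒0< w⊏B))
      (z-bound n (ℕ.m⊔n≤o⇒m≤o M N MN≤n))
      (ℚ.<⇒≤ (⊏⇒norm< w⊏B n (ℕ.m⊔n≤o⇒n≤o M N MN≤n)))

⊏-0 : ∀ {B} → 0ℚ ℚ.< B → 0# ⊏ B
⊏-0 {B} B>0 = ⊏-intro B B>0 0 λ n _ →
  ℚ.≤-reflexive (≡.trans (≡.cong (ℚ._+ B) (norm-0# n)) (ℚ.+-identityˡ B))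

⊏-exists : ∀ z → ∃ λ B → z ⊏ B
⊏-exists z with norm-bounded z
... | B , B>0 , N , bounded = B ℚ.+ 1ℚ , ⊏-intro 1ℚ (ℚ.positive⁻¹ 1ℚ) N λ n N≤n →
  ℚ.+-monoˡ-≤ 1ℚ (ℚ.≤-trans (p≤∣p∣ (norm z n)) (bounded n N≤n))

vanishing-norm⇒≃0 : ∀ {z} → (∀ ε → 0ℚ ℚ.< ε → ∃ λ N → ∀ n → N ℕ.≤ n → norm z n ℚ.< ε) → z ≃ 0#
vanishing-norm⇒≃0 {z} small = components≈0⇒≃0 z
  (component (re z) (re²≤norm z)) (component (im z) (im²≤norm z))
  where
  component : ∀ x → (∀ n → seq x n ℚ.* seq x n ℚ.≤ norm z n) → x ≈ᵣ 0ᵣ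
  -- The norm is a squared modulus, so it is tested against ε².
  component x x²≤ ε ε>0 with small (ε ℚ.* ε) (0<p*q ε>0 ε>0)
  ... | N , norm< = N , λ n N≤n → ≡.subst (λ p → ℚ.∣ p ∣ ℚ.< ε) (≡.sym (x-0≡x (seq x n)))
    (p²<q²⇒∣p∣<q (seq x n) (ℚ.<⇒≤ ε>0) (ℚ.≤-<-trans (x²≤ n) (norm< n N≤n)))

⊏-all⇒≃0 : ∀ {z} → (∀ ε → 0ℚ ℚ.< ε → z ⊏ ε) → z ≃ 0#
⊏-all⇒≃0 z⊏ = vanishing-norm⇒≃0 λ ε ε>0 → _⊏_.start (z⊏ ε ε>0) , ⊏⇒norm< (z⊏ ε ε>0)

≃0⇒⊏ : ∀ {z ε} → z ≃ 0# → 0ℚ ℚ.< ε → z ⊏ ε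
≃0⇒⊏ z≃0 ε>0 = ⊏-resp (≃-sym z≃0) (⊏-0 ε>0)

-- The squared modulus of z² is the square of |z|², so |z|² is eventually below every ε. This is the
-- reducedness that `edgeless⇒uniqueRoots` takes as hypothesis.
square≃0⇒≃0 : ∀ {z} → z * z ≃ 0# → z ≃ 0#
square≃0⇒≃0 {z} zz≃0 = vanishing-norm⇒≃0 λ ε ε>0 →
  let zz⊏ε² = ≃0⇒⊏ zz≃0 (0<p*q ε>0 ε>0) in
  _⊏_.start zz⊏ε² , λ n N≤n → ℚ.≤-<-trans (p≤∣p∣ (norm z n)) (p²<q²⇒∣p∣<q (norm z n) (ℚ.<⇒≤ ε>0)
    (≡.subst (ℚ._< ε ℚ.* ε) (norm-* z z n) (⊏⇒norm< zz⊏ε² n N≤n)))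

cancel-bound : ∀ {p q E η} → 0ℚ ℚ.< E → E ℚ.≤ p → 0ℚ ℚ.≤ q → p ℚ.* q ℚ.< E ℚ.* η → q ℚ.< η
cancel-bound {p} {q} {E} {η} E>0 E≤p 0≤q pq<Eη =
  ℚ.*-cancelˡ-<-nonNeg E {{ℚ.nonNegative (ℚ.<⇒≤ E>0)}} {q} {η}
    (ℚ.≤-<-trans (ℚ.*-monoʳ-≤-nonNeg q {{ℚ.nonNegative 0≤q}} {E} {p} E≤p) pq<Eη)

-- By multiplicativity E |y|² ≤ |z y|² eventually, so y is small whenever z y is; a positive lower
-- bound does the work of an inverse.
cancelable-if-away : ∀ z E → 0ℚ ℚ.< E → ∀ N → (∀ n → N ℕ.≤ n → E ℚ.≤ norm z n) → Cancelable z
cancelable-if-away z E E>0 N away = ℂ-Poly.cancelable λ y zy≃0 → vanishing-norm⇒≃0 (small y zy≃0)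
  where
  small : ∀ y → z * y ≃ 0# → ∀ ε → 0ℚ ℚ.< ε → ∃ λ M → ∀ n → M ℕ.≤ n → norm y n ℚ.< ε
  small y zy≃0 ε ε>0 = N ℕ.⊔ _⊏_.start zy⊏ , λ n M≤n → cancel-bound {norm z n} {norm y n} {E} {ε} E>0
    (away n (ℕ.m⊔n≤o⇒m≤o N _ M≤n)) (0≤norm y n)
    (≡.subst (ℚ._< E ℚ.* ε) (norm-* z y n) (⊏⇒norm< zy⊏ n (ℕ.m⊔n≤o⇒n≤o N _ M≤n)))
    where
    zy⊏ : z * y ⊏ E ℚ.* ε
    zy⊏ = ≃0⇒⊏ zy≃0 (0<p*q E>0 ε>0)

cancelable-if-re-positive : ∀ z e → 0ℚ ℚ.< e → ∀ N → (∀ n → N ℕ.≤ n → e ℚ.≤ seq (re z) n) → Cancelable z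
cancelable-if-re-positive z e e>0 N e≤ = cancelable-if-away z (e ℚ.* e) (0<p*q e>0 e>0) N λ n N≤n →
  ℚ.≤-trans (square-mono e (seq (re z) n) e>0 (e≤ n N≤n)) (re²≤norm z n)

cancelable-if-im-positive : ∀ z e → 0ℚ ℚ.< e → (∀ n → e ℚ.≤ seq (im z) n) → Cancelable z
cancelable-if-im-positive z e e>0 e≤ = cancelable-if-away z (e ℚ.* e) (0<p*q e>0 e>0) 0 λ n _ →
  ℚ.≤-trans (square-mono e (seq (im z) n) e>0 (e≤ n)) (im²≤norm z n)

1≤1+p : ∀ p → 0ℚ ℚ.≤ p → 1ℚ ℚ.≤ 1ℚ ℚ.+ p
1≤1+p p = p≤p+q 1ℚ {p}

0≤1+p : ∀ p → 0ℚ ℚ.≤ p → 0ℚ ℚ.≤ 1ℚ ℚ.+ p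
0≤1+p p 0≤p = ℚ.≤-trans (ℚ.<⇒≤ (ℚ.positive⁻¹ 1ℚ)) (1≤1+p p 0≤p)

opaque
  unfolding _⊕_

  re-1+ : ∀ z m → seq (re (1# + z)) m ≡ 1ℚ ℚ.+ seq (re z) m
  re-1+ z m = ≡.refl

  re-0# : ∀ m → seq (re 0#) m ≡ 0ℚ
  re-0# m = ≡.refl

0≤re-natural : ∀ n m → 0ℚ ℚ.≤ seq (re (n ℂ×.× 1#)) m
0≤re-natural zero    m = ℚ.≤-reflexive (≡.sym (re-0# m))
0≤re-natural (suc n) m = ≡.subst (0ℚ ℚ.≤_) (≡.sym (re-1+ (n ℂ×.× 1#) m))
  (0≤1+p (seq (re (n ℂ×.× 1#)) m) (0≤re-natural n m))

1≤re-natural : ∀ n m → 1ℚ ℚ.≤ seq (re (suc n ℂ×.× 1#)) m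
1≤re-natural n m = ≡.subst (1ℚ ℚ.≤_) (≡.sym (re-1+ (n ℂ×.× 1#) m))
  (1≤1+p (seq (re (n ℂ×.× 1#)) m) (0≤re-natural n m))

natural-cancelable : ∀ n → Cancelable (suc n ℂ×.× 1#)
natural-cancelable n =
  cancelable-if-re-positive (suc n ℂ×.× 1#) 1ℚ (ℚ.positive⁻¹ 1ℚ) 0 λ m _ → 1≤re-natural n m

-- Complex conjugation

conj : ℂ → ℂ
conj z = re z +i (-ᵣ im z)

conj-natural-cancelable : ∀ n → Cancelable (conj (suc n ℂ×.× 1#))
conj-natural-cancelable n =
  cancelable-if-re-positive (conj (suc n ℂ×.× 1#)) 1ℚ (ℚ.positive⁻¹ 1ℚ) 0 λ m _ → 1≤re-natural n m

conj-cong : ∀ {z w} → z ≃ w → conj z ≃ conj w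
conj-cong {z} {w} (≃-intro (p , q)) = ≃-intro (p , -ᵣ-cong (im z) (im w) q)

opaque
  unfolding _⊕_

  conj-+ : ∀ z w → conj (z + w) ≃ conj z + conj w
  conj-+ z w = pointwise (conj (z + w)) (conj z + conj w) (λ n → ≡.refl)
    (λ n → ℚ-Identities.im-conj-+ (seq (im z) n) (seq (im w) n))

  conj-* : ∀ z w → conj (z * w) ≃ conj z * conj w
  conj-* z w = pointwise (conj (z * w)) (conj z * conj w)
    (λ n → ℚ-Identities.re-conj-* (seq (re z) n) (seq (im z) n) (seq (re w) n) (seq (im w) n))
    (λ n → ℚ-Identities.im-conj-* (seq (re z) n) (seq (im z) n) (seq (re w) n) (seq (im w) n))

  real-square : ∀ x → ((x *ᵣ x) +i 0ᵣ) ≃ (x +i 0ᵣ) * (x +i 0ᵣ)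
  real-square x = pointwise ((x *ᵣ x) +i 0ᵣ) ((x +i 0ᵣ) * (x +i 0ᵣ))
    (λ n → ℚ-Identities.re-real-* (seq x n)) (λ n → ℚ-Identities.im-real-* (seq x n))

  difference≡ : ∀ z w → z - w ≡ z Defs.- w
  difference≡ z w = ≡.refl

  normSq≈⇒*-conj≃ : ∀ z w x → z ≡ w → normSq w ≈ᵣ x → z * conj z ≃ (x +i 0ᵣ)
  normSq≈⇒*-conj≃ z .z x ≡.refl eq = ≃-trans {z * conj z} {normSq z +i 0ᵣ} {x +i 0ᵣ}
    (pointwise (z * conj z) (normSq z +i 0ᵣ)
      (λ n → ℚ-Identities.re-*-conj (seq (re z) n) (seq (im z) n))
      (λ n → ℚ-Identities.im-*-conj (seq (re z) n) (seq (im z) n)))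
    (≃-intro (eq , ≈ᵣ-refl 0ᵣ))

  1≄0 : ¬ 1# ≃ 0#
  1≄0 (≃-intro (p , _)) with p 1ℚ (ℚ.positive⁻¹ 1ℚ)
  ... | N , close = ℚ.<-irrefl ≡.refl (close N ℕ.≤-refl)

positive⇒eventually≥ : ∀ x → Positive x → ∃ λ e → 0ℚ ℚ.< e × ∃ λ N → ∀ n → N ℕ.≤ n → e ℚ.≤ seq x n
positive⇒eventually≥ x (e , e>0 , N , bound) = e , e>0 , N , λ n N≤n →
  ≡.subst (ℚ._≤ seq x n) (ℚ.+-identityˡ e) (bound n N≤n)

-- Points on a circle from rational parameters

fromℕ : ℕ → ℚ
fromℕ zero    = 0ℚ
fromℕ (suc n) = 1ℚ ℚ.+ fromℕ n

fromℕ-mono : ∀ {i j} → i ℕ.< j → fromℕ i ℚ.< fromℕ j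
fromℕ-mono {i} {j} i<j = steps (ℕ.≤⇒≤′ i<j)
  where
  step : ∀ n → fromℕ n ℚ.< fromℕ (suc n)
  step n = ≡.subst (fromℕ n ℚ.<_) (ℚ.+-comm (fromℕ n) 1ℚ) (p<p+q (fromℕ n) (ℚ.positive⁻¹ 1ℚ))

  steps : ∀ {j} → suc i ℕ.≤′ j → fromℕ i ℚ.< fromℕ j
  steps (ℕ.≤′-reflexive ≡.refl) = step i
  steps (ℕ.≤′-step {j} i<j) = ℚ.<-trans (steps i<j) (step j)

inverse : ∀ t → ∃ λ u → 0ℚ ℚ.< u × (1ℚ ℚ.+ t ℚ.* t) ℚ.* u ≡ 1ℚ
inverse t = divide 1ℚ (ℚ.<-≤-trans (ℚ.positive⁻¹ 1ℚ) (p≤p+q 1ℚ (0≤p² t))) (ℚ.positive⁻¹ 1ℚ)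

conj-denominator numerator : ℚ → ℂ
conj-denominator t = 1ᵣ +i fromℚ (ℚ.- t)
numerator t = 1ᵣ +i fromℚ t

-- The difference `unit t - unit s` multiplied by both denominators. Its imaginary part is the
-- constant 2(t - s), bounded away from 0 when s < t.
chord : ℚ → ℚ → ℂ
chord s t = numerator t * conj-denominator s - numerator s * conj-denominator t

opaque
  unfolding _⊕_

  -- (1 + it) / (1 - it)
  unit : ℚ → ℂ
  unit t = fromℚ (proj₁ (inverse t) ℚ.* (1ℚ ℚ.- t ℚ.* t)) +i fromℚ (proj₁ (inverse t) ℚ.* (t ℚ.+ t))

  unit-* : ∀ t → unit t * conj-denominator t ≃ numerator t
  unit-* t = pointwise (unit t * conj-denominator t) (numerator t)
    (λ _ → ℚ-Identities.half-angle-re (proj₁ (inverse t)) t (proj₂ (proj₂ (inverse t))))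
    (λ _ → ℚ-Identities.half-angle-im (proj₁ (inverse t)) t (proj₂ (proj₂ (inverse t))))

  scaled-unit-norm : ∀ c r t → normSq ((c + (r +i 0ᵣ) * unit t) Defs.- c) ≈ᵣ r *ᵣ r
  scaled-unit-norm c r t = ≡⇒≈ᵣ (normSq ((c + (r +i 0ᵣ) * unit t) Defs.- c)) (r *ᵣ r) λ n →
    ℚ-Identities.on-circle (proj₁ (inverse t)) t (proj₂ (proj₂ (inverse t)))
      (seq (re c) n) (seq (im c) n) (seq r n)

  im-chord : ∀ s t n → seq (im (chord s t)) n ≡ (t ℚ.- s) ℚ.+ (t ℚ.- s)
  im-chord s t n = ℚ-Identities.im-chord s t

chord-cancelable : ∀ {s t} → s ℚ.< t → Cancelable (chord s t)
chord-cancelable {s} {t} s<t = cancelable-if-im-positive (chord s t)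
  ((t ℚ.- s) ℚ.+ (t ℚ.- s)) (ℚ.+-mono-< t-s>0 t-s>0)
  (λ n → ≡.subst ((t ℚ.- s) ℚ.+ (t ℚ.- s) ℚ.≤_) (≡.sym (im-chord s t n)) ℚ.≤-refl)
  where
  t-s>0 : 0ℚ ℚ.< t ℚ.- s
  t-s>0 = ≡.subst (ℚ._< t ℚ.- s) (ℚ.+-inverseʳ s) (ℚ.+-monoˡ-< (ℚ.- s) s<t)

unit-difference : ∀ s t → (unit t - unit s) * (conj-denominator s * conj-denominator t) ≃ chord s t
unit-difference s t = ℂ-Identities.chord (unit s) (unit t) (numerator s) (numerator t)
  (conj-denominator s) (conj-denominator t) (unit-* s) (unit-* t)

-- A factor of a cancelable element is cancelable, so the denominators never have to be inverted.
unit-distinct : ∀ {s t} → s ℚ.< t → Cancelable (unit t - unit s)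
unit-distinct {s} {t} s<t = cancelable-factor (conj-denominator s * conj-denominator t)
  (cancelable-resp (≃-sym (unit-difference s t)) (chord-cancelable s<t))

module _ (c : ℂ) (r : ℝ) (r>0 : Positive r) where

  -- Rational parameters avoid square roots and angles: the equation |z - c|² = r² holds for these
  -- points already term by term.
  circlePoint : ℕ → ℂ
  circlePoint i = c + (r +i 0ᵣ) * unit (fromℕ i)

  circlePoint-on-circle : ∀ i → normSq (circlePoint i Defs.- c) ≈ᵣ r *ᵣ r
  circlePoint-on-circle i = scaled-unit-norm c r (fromℕ i)

  radius-cancelable : Cancelable (r +i 0ᵣ)
  radius-cancelable = from-bound (positive⇒eventually≥ r r>0)
    where
    from-bound : (∃ λ e → 0ℚ ℚ.< e × ∃ λ N → ∀ n → N ℕ.≤ n → e ℚ.≤ seq r n) → Cancelable (r +i 0ᵣ)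
    from-bound (e , e>0 , N , e≤) = cancelable-if-re-positive (r +i 0ᵣ) e e>0 N e≤

  radius²-cancelable : Cancelable ((r +i 0ᵣ) * (r +i 0ᵣ))
  radius²-cancelable = cancelable-* radius-cancelable radius-cancelable

  circlePoint-distinct : ∀ i j → i ℕ.< j → Cancelable (circlePoint j - circlePoint i)
  circlePoint-distinct i j i<j = cancelable-resp
    (≃-sym (ℂ-Identities.scaled-difference c (r +i 0ᵣ) (unit (fromℕ i)) (unit (fromℕ j))))
    (cancelable-* radius-cancelable (unit-distinct (fromℕ-mono i<j)))

-- Return to the independence polynomial as defined

open SemiringExp semiring using () renaming (_^_ to _^ᵣ_)
open SemiringSum semiring using () renaming (sum to sumᵣ)

opaque
  unfolding _⊕_

  polynomial-agrees : ∀ n (a : ℕ → ℕ) z →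
    ℂ-Semiring.sum {n} (λ i → a (toℕ i) ℂ-Semiring.× (z ℂ-Semiring.^ toℕ i))
      ≡ sumᵣ {n} (λ i → a (toℕ i) ℂ×.× (z ^ᵣ toℕ i))
  polynomial-agrees = Agreement.polynomial-agrees _≈_ _≃_ Defs._+_ Defs._*_ Defs.0# Defs.1#

  independencePolynomial≃I : ∀ G z → independencePolynomial G z ≃ I G z
  independencePolynomial≃I G z = ≡.subst (_≃ I G z)
    (≡.sym (polynomial-agrees (suc (independenceNumber G)) (independentCount G) z))
    (independencePolynomial≈I G z)

  root⇒I≃0 : ∀ G z → IndependenceRoot G z → I G z ≃ 0#
  root⇒I≃0 G z root = ≃-trans (≃-sym (independencePolynomial≃I G z)) (≃-intro root)

  I≃0⇒root : ∀ G z → I G z ≃ 0# → IndependenceRoot G z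
  I≃0⇒root G z I≃0 = ≃⇒≈ (≃-trans (independencePolynomial≃I G z) I≃0)

  P : Graph → ℂ → ℂ
  P G z = I G z - 1#

  P≡ : ∀ G z → P G z ≡ I G z - 1#
  P≡ G z = ≡.refl

root-lexPower-suc : ∀ G k z → IndependenceRoot (lexPower G (suc k)) z →
                    IndependenceRoot (lexPower G k) (P G z)
root-lexPower-suc G k z root = I≃0⇒root (lexPower G k) (P G z)
  (≡.subst (λ w → I (lexPower G k) w ≃ 0#) (≡.sym (P≡ G z))
    (≃-trans (≃-sym (I-lexPower-suc G k z)) (root⇒I≃0 (lexPower G (suc k)) z root)))

-- Neighbourhoods and Lipschitz bounds in squared distance

opaque
  unfolding _⊕_ norm

  norm-neg : ∀ z n → norm (- z) n ≡ norm z n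
  norm-neg z n = ≡.trans (norm≡normSq (- z) n)
    (≡.trans (ℚ-Identities.norm-neg (seq (re z) n) (seq (im z) n)) (≡.sym (norm≡normSq z n)))

  within⇒⊏ : ∀ t z w → Within (fromℚ t) z w → z - w ⊏ t ℚ.* t
  within⇒⊏ t z w (g , g>0 , N , bound) = ⊏-intro g g>0 N λ n N≤n →
    ≡.subst (λ p → p ℚ.+ g ℚ.≤ t ℚ.* t) (≡.sym (norm≡normSq (z - w) n)) (bound n N≤n)

  -- `⊏` compares with rationals, so a real radius ε is replaced by a positive rational that is
  -- eventually below it.
  ⊏⇒within : ∀ ε e M → 0ℚ ℚ.< e → (∀ n → M ℕ.≤ n → e ℚ.≤ seq ε n) → ∀ z w → z - w ⊏ e ℚ.* e → Within ε z w
  ⊏⇒within ε e M e>0 e≤ z w (⊏-intro g g>0 N bound) = g , g>0 , M ℕ.⊔ N , bound′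
    where
    bound′ : ∀ n → M ℕ.⊔ N ℕ.≤ n → seq (normSq (z Defs.- w)) n ℚ.+ g ℚ.≤ seq ε n ℚ.* seq ε n
    bound′ n MN≤n = ℚ.≤-trans {norm (z - w) n ℚ.+ g} {e ℚ.* e} {seq ε n ℚ.* seq ε n}
      (bound n (ℕ.m⊔n≤o⇒n≤o M N MN≤n)) (square-mono e (seq ε n) e>0 (e≤ n (ℕ.m⊔n≤o⇒m≤o M N MN≤n)))

within-if-small : ∀ ε → Positive ε → ∃ λ η → 0ℚ ℚ.< η × (∀ z w → z - w ⊏ η → Within ε z w)
within-if-small ε ε>0 = from-bound (positive⇒eventually≥ ε ε>0)
  where
  from-bound : (∃ λ e → 0ℚ ℚ.< e × ∃ λ M → ∀ n → M ℕ.≤ n → e ℚ.≤ seq ε n) →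
               ∃ λ η → 0ℚ ℚ.< η × (∀ z w → z - w ⊏ η → Within ε z w)
  from-bound (e , e>0 , M , e≤) = e ℚ.* e , 0<p*q e>0 e>0 , ⊏⇒within ε e M e>0 e≤

fromℚ-positive : ∀ {t} → 0ℚ ℚ.< t → Positive (fromℚ t)
fromℚ-positive {t} t>0 = t , t>0 , 0 , λ _ _ → ℚ.≤-reflexive (ℚ.+-identityˡ t)

⊏-neg : ∀ {z B} → z ⊏ B → - z ⊏ B
⊏-neg {z} {B} (⊏-intro g g>0 N bound) = ⊏-intro g g>0 N λ n N≤n →
  ≡.subst (λ p → p ℚ.+ g ℚ.≤ B) (≡.sym (norm-neg z n)) (bound n N≤n)

*-≤-self : ∀ L {δ} → 0ℚ ℚ.≤ L → δ ℚ.≤ 1ℚ → L ℚ.* δ ℚ.≤ L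
*-≤-self L {δ} 0≤L δ≤1 = ≡.subst (L ℚ.* δ ℚ.≤_) (ℚ.*-identityʳ L)
  (ℚ.*-monoˡ-≤-nonNeg L {{ℚ.nonNegative 0≤L}} {δ} {1ℚ} δ≤1)

opaque
  small-enough : ∀ A η → 0ℚ ℚ.< A → 0ℚ ℚ.< η → ∃ λ t → 0ℚ ℚ.< t × t ℚ.≤ 1ℚ × A ℚ.* t ℚ.≤ η
  small-enough A η A>0 η>0 with ℚ.≤-total A η
  -- Here η / A may exceed 1, so t is capped at 1.
  ... | inj₁ A≤η = 1ℚ , ℚ.positive⁻¹ 1ℚ , ℚ.≤-refl , ≡.subst (ℚ._≤ η) (≡.sym (ℚ.*-identityʳ A)) A≤η
  ... | inj₂ η≤A with divide η A>0 η>0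
  ...   | t , t>0 , At≡η = t , t>0 ,
    ℚ.*-cancelˡ-≤-pos {p = t} {q = 1ℚ} A {{ℚ.positive A>0}}
      (≡.subst₂ ℚ._≤_ (≡.sym At≡η) (≡.sym (ℚ.*-identityʳ A)) η≤A) ,
    ℚ.≤-reflexive At≡η

lipschitz-constant : ∀ Z L K δ → (Z ℚ.* (L ℚ.* δ) ℚ.+ δ ℚ.* K) ℚ.+ (Z ℚ.* (L ℚ.* δ) ℚ.+ δ ℚ.* K)
                             ≡ ((Z ℚ.* L ℚ.+ K) ℚ.+ (Z ℚ.* L ℚ.+ K)) ℚ.* δ
lipschitz-constant = ℚ-Identities.lipschitz-constant

collect : ∀ L δ → (L ℚ.* δ ℚ.+ δ) ℚ.+ (L ℚ.* δ ℚ.+ δ) ≡ ((L ℚ.+ 1ℚ) ℚ.+ (L ℚ.+ 1ℚ)) ℚ.* δ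
collect = ℚ-Identities.collect

-- Both sides are squared distances, so `L` is the square of the usual constant. The restriction δ ≤
-- 1 keeps w near z, as a polynomial need not be globally Lipschitz.
LipschitzAt : ℂ → (ℂ → ℂ) → ℚ → Set
LipschitzAt z f L = ∀ δ → 0ℚ ℚ.< δ → δ ℚ.≤ 1ℚ → ∀ w → z - w ⊏ δ → f z - f w ⊏ L ℚ.* δ

0<double : ∀ {p} → 0ℚ ℚ.< p → 0ℚ ℚ.< p ℚ.+ p
0<double p>0 = ℚ.+-mono-< p>0 p>0

-- Along the Horner form f z - f w = z (g z - g w) + (z - w) g w. The value g w is written as g z -
-- (g z - g w); with δ ≤ 1 its squared modulus is below `K` = 2(M + L).
lipschitz : ∀ d {a f} → Poly d a f → ∀ z → ∃ λ L → 0ℚ ℚ.< L × LipschitzAt z f L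
lipschitz zero {a} {f} f≈a z = 1ℚ , ℚ.positive⁻¹ 1ℚ , λ δ δ>0 _ w _ →
  ≃0⇒⊏ (≃-trans (+-congʳ (≃-trans (f≈a z) (≃-sym (f≈a w)))) (-‿inverseʳ (f w)))
       (0<p*q (ℚ.positive⁻¹ 1ℚ) δ>0)
  where open CommutativeRing ℂ-commutativeRing using (+-congʳ; -‿inverseʳ)
lipschitz (suc d) {a} {f} (b , g , p , f≈) z with lipschitz d p z | ⊏-exists z | ⊏-exists (g z)
... | L , L>0 , g-lip | Z , z⊏Z | M , gz⊏M =
  (Z ℚ.* L ℚ.+ K) ℚ.+ (Z ℚ.* L ℚ.+ K) ,
  0<double (ℚ.+-mono-< (0<p*q (⊏⇒0< z⊏Z) L>0) (0<double (ℚ.+-mono-< (⊏⇒0< gz⊏M) L>0))) ,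
  bound
  where
  open CommutativeRing ℂ-commutativeRing using (+-cong; -‿cong)
  K = (M ℚ.+ L) ℚ.+ (M ℚ.+ L)

  bound : LipschitzAt z f ((Z ℚ.* L ℚ.+ K) ℚ.+ (Z ℚ.* L ℚ.+ K))
  bound δ δ>0 δ≤1 w z-w⊏δ = ≡.subst (f z - f w ⊏_) (lipschitz-constant Z L K δ)
    (⊏-resp (≃-sym difference≃) (⊏-+ (⊏-* z⊏Z gz-gw⊏) (⊏-* z-w⊏δ gw⊏)))
    where
    gz-gw⊏ : g z - g w ⊏ L ℚ.* δ
    gz-gw⊏ = g-lip δ δ>0 δ≤1 w z-w⊏δ

    gw⊏ : g w ⊏ K
    gw⊏ = ⊏-resp (ℂ-Identities.y≈x-[x-y] (g z) (g w))
      (⊏-+ gz⊏M (⊏-neg (⊏-mono (*-≤-self L (ℚ.<⇒≤ L>0) δ≤1) gz-gw⊏)))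

    difference≃ : f z - f w ≃ z * (g z - g w) + (z - w) * g w
    difference≃ = ≃-trans (+-cong (f≈ z) (-‿cong (f≈ w))) (ℂ-Identities.difference-quotient b z w (g z) (g w))

-- Turns a tolerance for squared distances into a radius t without a square root: t ≤ 1 gives t² ≤
-- t, so it is enough that 2(L + 1) t ≤ η.
double-square-bound : ∀ L η → 0ℚ ℚ.< L → 0ℚ ℚ.< η → ∃ λ t → 0ℚ ℚ.< t × t ℚ.* t ℚ.≤ 1ℚ ×
  (L ℚ.* (t ℚ.* t) ℚ.+ t ℚ.* t) ℚ.+ (L ℚ.* (t ℚ.* t) ℚ.+ t ℚ.* t) ℚ.≤ η
double-square-bound L η L>0 η>0 = from-small (small-enough A η A>0 η>0)
  where
  A = (L ℚ.+ 1ℚ) ℚ.+ (L ℚ.+ 1ℚ)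

  A>0 : 0ℚ ℚ.< A
  A>0 = 0<double {L ℚ.+ 1ℚ} (ℚ.+-mono-< {0ℚ} {L} {0ℚ} {1ℚ} L>0 (ℚ.positive⁻¹ 1ℚ))

  from-small : (∃ λ t → 0ℚ ℚ.< t × t ℚ.≤ 1ℚ × A ℚ.* t ℚ.≤ η) → ∃ λ t → 0ℚ ℚ.< t × t ℚ.* t ℚ.≤ 1ℚ ×
    (L ℚ.* (t ℚ.* t) ℚ.+ t ℚ.* t) ℚ.+ (L ℚ.* (t ℚ.* t) ℚ.+ t ℚ.* t) ℚ.≤ η
  from-small (t , t>0 , t≤1 , At≤η) = t , t>0 , ℚ.≤-trans {t ℚ.* t} {t} {1ℚ} t²≤t t≤1 ,
    ≡.subst (ℚ._≤ η) (≡.sym (collect L (t ℚ.* t)))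
      (ℚ.≤-trans {A ℚ.* (t ℚ.* t)} {A ℚ.* t} {η}
        (ℚ.*-monoˡ-≤-nonNeg A {{ℚ.nonNegative (ℚ.<⇒≤ A>0)}} {t ℚ.* t} {t} t²≤t) At≤η)
    where
    t²≤t : t ℚ.* t ℚ.≤ t
    t²≤t = *-≤-self t {t} (ℚ.<⇒≤ t>0) t≤1

⊏-via : ∀ x y v L t η → x - y ⊏ L ℚ.* (t ℚ.* t) → y - v ⊏ t ℚ.* t →
        (L ℚ.* (t ℚ.* t) ℚ.+ t ℚ.* t) ℚ.+ (L ℚ.* (t ℚ.* t) ℚ.+ t ℚ.* t) ℚ.≤ η → x - v ⊏ η
⊏-via x y v L t η x-y⊏ y-v⊏ bound = ⊏-resp {(x - y) + (y - v)} {x - v} {η}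
  (≃-sym (ℂ-Identities.sub-via x y v))
  (⊏-mono {(x - y) + (y - v)} {(L ℚ.* (t ℚ.* t) ℚ.+ t ℚ.* t) ℚ.+ (L ℚ.* (t ℚ.* t) ℚ.+ t ℚ.* t)} {η} bound
    (⊏-+ {x - y} {y - v} {L ℚ.* (t ℚ.* t)} {t ℚ.* t} x-y⊏ y-v⊏))

⊏-double : ∀ x y t η → x ⊏ t ℚ.* t → y ⊏ t ℚ.* t →
           (1ℚ ℚ.* (t ℚ.* t) ℚ.+ t ℚ.* t) ℚ.+ (1ℚ ℚ.* (t ℚ.* t) ℚ.+ t ℚ.* t) ℚ.≤ η → x + y ⊏ η
⊏-double x y t η x⊏ y⊏ bound =
  ⊏-mono {x + y} {(1ℚ ℚ.* (t ℚ.* t) ℚ.+ t ℚ.* t) ℚ.+ (1ℚ ℚ.* (t ℚ.* t) ℚ.+ t ℚ.* t)} {η} bound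
    (⊏-+ {x} {y} {1ℚ ℚ.* (t ℚ.* t)} {t ℚ.* t} (≡.subst (x ⊏_) (≡.sym (ℚ.*-identityˡ (t ℚ.* t))) x⊏) y⊏)

lipschitz-resp : ∀ z f g L → (∀ w → f z - f w ≃ g z - g w) → LipschitzAt z f L → LipschitzAt z g L
lipschitz-resp z f g L eq lip δ δ>0 δ≤1 w z-w⊏δ = ⊏-resp (eq w) (lip δ δ>0 δ≤1 w z-w⊏δ)

P-difference : ∀ G z w → I G z - I G w ≃ P G z - P G w
P-difference G z w = ≃-trans (≃-sym (ℂ-Identities.cancel-subtrahend (I G z) (I G w) 1#))
  (≡.subst₂ (λ p q → (I G z - 1#) - (I G w - 1#) ≃ p - q) (≡.sym (P≡ G z)) (≡.sym (P≡ G w)) ≃-refl)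

-- Consequences of Hausdorff convergence

module _ (G : Graph) (K : Pred ℂ 0ℓ)
  (converges : HausdorffConverges (λ k → IndependenceRoot (lexPower G k)) K) where

  P-lipschitz : ∀ z → ∃ λ L → 0ℚ ℚ.< L × LipschitzAt z (P G) L
  P-lipschitz z = from-I (lipschitz (independenceNumber G) (I-poly G) z)
    where
    from-I : (∃ λ L → 0ℚ ℚ.< L × LipschitzAt z (I G) L) → ∃ λ L → 0ℚ ℚ.< L × LipschitzAt z (P G) L
    from-I (L , L>0 , lip) = L , L>0 , lipschitz-resp z (I G) (P G) L (P-difference G z) lip

  P-invariant : IsClosed K → ∀ z → K z → K (P G z)
  P-invariant closed z Kz = closed (P G z) λ ε ε>0 →
    let η , η>0 , within          = within-if-small ε ε>0
        L , L>0 , lip             = P-lipschitz z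
        t , t>0 , t²≤1 , bound    = double-square-bound L η L>0 η>0
        N , close                 = converges (fromℚ t) (fromℚ-positive t>0)
        -- P lowers the power by one, so the root near z is taken at index N + 1; its image is a
        -- root at index N, where roots are still close to K.
        w , w-root , z~w          = proj₂ (close (suc N) (ℕ.n≤1+n N)) {z} Kz
        v , Kv , Pw~v             = proj₁ (close N ℕ.≤-refl) {P G w} (root-lexPower-suc G N w w-root)
    in v , Kv , within (P G z) v (⊏-via (P G z) (P G w) v L t η
         (lip (t ℚ.* t) (0<p*q t>0 t>0) t²≤1 w (within⇒⊏ t z w z~w)) (within⇒⊏ t (P G w) v Pw~v) bound)

  uniqueRoots⇒subsingleton : UniqueRoots G → ∀ x y → K x → K y → x - y ≃ 0#
  uniqueRoots⇒subsingleton unique x y Kx Ky = ⊏-all⇒≃0 λ ε ε>0 →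
    -- L = 1 because both errors, at x and at y, are bounded by the same t².
    let t , t>0 , _ , bound    = double-square-bound 1ℚ ε (ℚ.positive⁻¹ 1ℚ) ε>0
        N , close              = converges (fromℚ t) (fromℚ-positive t>0)
        u , u-root , x~u       = proj₂ (close N ℕ.≤-refl) {x} Kx
        v , v-root , y~v       = proj₂ (close N ℕ.≤-refl) {y} Ky
        u≃v                    = unique N u v (root⇒I≃0 (lexPower G N) u u-root)
                                             (root⇒I≃0 (lexPower G N) v v-root)
    in ⊏-resp (ℂ-Identities.detour x y u v u≃v)
         (⊏-double (x - u) (- (y - v)) t ε (within⇒⊏ t x u x~u) (⊏-neg (within⇒⊏ t y v y~v)) bound)

theoremA : (G : Graph) (K : Pred ℂ 0ℓ) → IsIndependenceAttractor G K → ¬ IsCircle K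
theoremA G K (_ , (closed , _) , converges) (c , r , r>0 , circle) = 1≄0
  (cases (independenceNumber G ℕ.≤? 1) (independenceNumber G ℕ.≟ order G))
  where
  s : ℕ → ℂ
  s = circlePoint c r r>0

  K⇒*-conj≃ : ∀ z → K z → (z - c) * conj (z - c) ≃ (r +i 0ᵣ) * (r +i 0ᵣ)
  K⇒*-conj≃ z Kz = ≃-trans
    (normSq≈⇒*-conj≃ (z - c) (z Defs.- c) (r *ᵣ r) (difference≡ z c) (Equivalence.to (circle z) Kz))
    (real-square r)

  Ks : ∀ i → K (s i)
  Ks i = Equivalence.from (circle (s i)) (circlePoint-on-circle c r r>0 i)

  unique-impossible : UniqueRoots G → 1# ≃ 0#
  -- The difference of two sample points is both cancelable and zero; cancelling it from its product
  -- with 1 gives 1 = 0.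
  unique-impossible unique = ℂ-Poly.cancel (circlePoint-distinct c r r>0 0 1 (ℕ.s≤s ℕ.z≤n)) 1#
    (≃-trans (*-identityʳ (s 1 - s 0)) (uniqueRoots⇒subsingleton G K converges unique (s 1) (s 0) (Ks 1) (Ks 0)))
    where open CommutativeRing ℂ-commutativeRing using (*-identityʳ)

  cases : Dec (independenceNumber G ℕ.≤ 1) → Dec (independenceNumber G ≡ order G) → 1# ≃ 0#
  cases (yes α≤1) _ = unique-impossible (small-independenceNumber⇒uniqueRoots G α≤1)
  cases (no α≰1) (yes α≡n) = unique-impossible (edgeless⇒uniqueRoots (λ _ → square≃0⇒≃0) G
    (full⇒edgeless G (ℕ.<⇒≤ (ℕ.≰⇒> α≰1)) α≡n))
  cases (no α≰1) (no α≢n) = InvariantCircle.no-invariant-circle ℂ-commutativeRing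
    conj conj-cong conj-+ conj-* natural-cancelable conj-natural-cancelable
    c ((r +i 0ᵣ) * (r +i 0ᵣ)) (radius²-cancelable c r r>0)
    s (circlePoint-distinct c r r>0) (λ i → K⇒*-conj≃ (s i) (Ks i))
    G (ℕ.≰⇒> α≰1) (ℕ.≤∧≢⇒< (independenceNumber≤order G (ℕ.<⇒≤ (ℕ.≰⇒> α≰1))) α≢n)
    (λ i → ≡.subst (λ w → (w - c) * conj (w - c) ≃ (r +i 0ᵣ) * (r +i 0ᵣ)) (P≡ G (s i))
      (K⇒*-conj≃ (P G (s i)) (P-invariant G K converges closed (s i) (Ks i))))
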